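{- Let $\Phi$ be an irreducible finite crystallographic root system of rank $n>1$, and let $\alpha,\alpha'\in\Phi_{\ge-1}$ satisfy $(\alpha\|\alpha')=(\alpha'\|\alpha)=1$. Then the set $E(\alpha,\alpha')=\{\sigma(\sigma^{ -1}(\alpha)+\sigma^{ -1}(\alpha')):\sigma\in\langle\tau_+,\tau_-\rangle\}$ consists of exactly two elements of $Q$, one of which is $\alpha+\alpha'$; denote the other by $\alpha\boxplus\alpha'$. In the special case $\alpha'=-\alpha_j$, $j\in I$, we have $(-\alpha_j)\boxplus\alpha=\tau_{ -\varepsilon(j)}\bigl(-\alpha_j+\tau_{ -\varepsilon(j)}(\alpha)\bigr)=\alpha-\alpha_j+\sum_{i\ne j}a_{ij}\alpha_i.$
   Context: $\Phi$ has simple roots $\Pi=\{\alpha_i:i\in I\}$, positive roots $\Phi_{>0}$, root lattice $Q=\mathbb{Z}\Pi$, ambient space $Q_\mathbb{R}$, Cartan matrix $(a_{ij})$ with $s_i(\alpha_j)=\alpha_j-a_{ij}\alpha_i$; $[\alpha:\alpha_i]$ is the coefficient of $\alpha_i$ in $\alpha$. $I=I_+\sqcup I_-$ is the bipartition of the tree Coxeter graph, and $\varepsilon(i)\in\{+,-\}$ is the sign with $i\in I_{\varepsilon(i)}$. For $\varepsilon=\pm$, $\tau_\varepsilon:Q_\mathbb{R}\to Q_\mathbb{R}$ is given by $[\tau_\varepsilon\alpha:\alpha_i]=-[\alpha:\alpha_i]-\sum_{j\ne i}a_{ij}\max([\alpha:\alpha_j],0)$ for $i\in I_\varepsilon$ and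 $[\tau_\varepsilon\alpha:\alpha_i]=[\alpha:\alpha_i]$ otherwise; these are involutions and $\langle\tau_+,\tau_-\rangle$ is the group they generate. $\Phi_{\ge-1}=\Phi_{>0}\cup(-\Pi)$. The compatibility degree is the unique nonnegative-integer-valued function $(\alpha\|\beta)$ on $\Phi_{\ge-1}\times\Phi_{\ge-1}$ with $(-\alpha_i\|\alpha)=\max([\alpha:\alpha_i],0)$ for all $i,\alpha$ and $(\tau_\varepsilon\alpha\|\tau_\varepsilon\beta)=(\alpha\|\beta)$ for all $\alpha,\beta,\varepsilon$. -}

module Defs where

open import Data.Nat as ℕ using (ℕ; zero; suc)
open import Data.Integer as ℤ using (ℤ; +_; _+_; _*_; -_; _-_; _⊔_; _≤_; _<_; 0ℤ; ∣_∣)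
open import Data.Fin as Fin using (Fin; zero; suc)
open import Data.Vec using (Vec; lookup; tabulate; zipWith; map; replicate)
open import Data.List using (List; foldr; reverse)
open import Data.Sign using (Sign; opposite)
import Data.Sign.Properties as SignP
open import Data.Bool using (Bool; if_then_else_)
open import Data.Product using (Σ; _×_)
open import Data.Sum using (_⊎_)
open import Relation.Nullary using (¬_)
open import Relation.Nullary.Decidable using (⌊_⌋)
open import Relation.Binary.PropositionalEquality using (_≡_; _≢_)

Matrix : ℕ → Set
Matrix n = Fin n → Fin n → ℤ

-- elements of the root lattice Q = ℤΠ, as coefficient vectors [α : α_i]
Lat : ℕ → Set
Lat n = Vec ℤ n

∑ : ∀ {n} → (Fin n → ℤ) → ℤ
∑ {zero} f = 0ℤ
∑ {suc n} f = f zero + ∑ (λ i → f (suc i))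

_+v_ : ∀ {n} → Lat n → Lat n → Lat n
u +v v = zipWith _+_ u v

negv : ∀ {n} → Lat n → Lat n
negv v = map -_ v

sr : ∀ {n} → Fin n → Lat n
sr i = tabulate (λ k → if ⌊ k Fin.≟ i ⌋ then + 1 else 0ℤ)

FiniteCartan : ∀ {n} → Matrix n → Set
FiniteCartan {n} A =
  (∀ i → A i i ≡ + 2) ×
  (∀ i j → i ≢ j → A i j ≤ 0ℤ) ×
  (∀ i j → A i j ≡ 0ℤ → A j i ≡ 0ℤ) ×
  Σ (Fin n → ℕ) (λ d →
    (∀ i → 0 ℕ.< d i) ×
    (∀ i j → + d i * A i j ≡ + d j * A j i) ×
    (∀ (x : Lat n) → x ≢ replicate n 0ℤ →
       0ℤ < ∑ (λ i → ∑ (λ j → lookup x i * (+ d i * A i j) * lookup x j))))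

-- indecomposable (connected Coxeter/Dynkin graph)
Irreducible : ∀ {n} → Matrix n → Set
Irreducible {n} A =
  ∀ (S : Fin n → Bool) → (∀ i j → A i j ≢ 0ℤ → S i ≡ S j) → ∀ i j → S i ≡ S j

-- simple reflection: s_i(α_j) = α_j - a_ij α_i
refl-s : ∀ {n} → Matrix n → Fin n → Lat n → Lat n
refl-s A i v = tabulate (λ k →
  if ⌊ k Fin.≟ i ⌋ then lookup v k - ∑ (λ j → A i j * lookup v j) else lookup v k)

IsRoot : ∀ {n} → Matrix n → Lat n → Set
IsRoot {n} A v = Σ (List (Fin n)) (λ w → Σ (Fin n) (λ i → foldr (refl-s A) (sr i) w ≡ v))

IsNonneg : ∀ {n} → Lat n → Set
IsNonneg v = ∀ k → 0ℤ ≤ lookup v k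

AlmostPos : ∀ {n} → Matrix n → Lat n → Set
AlmostPos {n} A v = (IsRoot A v × IsNonneg v) ⊎ Σ (Fin n) (λ i → v ≡ negv (sr i))

Bipartition : ∀ {n} → Matrix n → (Fin n → Sign) → Set
Bipartition {n} A ε = ∀ i j → i ≢ j → A i j ≢ 0ℤ → ε i ≢ ε j

τ : ∀ {n} → Matrix n → (Fin n → Sign) → Sign → Lat n → Lat n
τ A ε s v = tabulate (λ i →
  if ⌊ ε i SignP.≟ s ⌋
  then - lookup v i - ∑ (λ j → if ⌊ j Fin.≟ i ⌋ then 0ℤ else A i j * (lookup v j ⊔ 0ℤ))
  else lookup v i)

-- an element of ⟨τ₊,τ₋⟩ given by a word: [s₁,…,s_k] ↦ τ_{s₁} ∘ ⋯ ∘ τ_{s_k};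
-- its inverse is given by the reversed word (each τ_s is an involution)
applyW : ∀ {n} → Matrix n → (Fin n → Sign) → List Sign → Lat n → Lat n
applyW A ε ws v = foldr (τ A ε) v ws

InE : ∀ {n} → Matrix n → (Fin n → Sign) → Lat n → Lat n → Lat n → Set
InE A ε α α' x = Σ (List Sign) (λ ws →
  x ≡ applyW A ε ws (applyW A ε (reverse ws) α +v applyW A ε (reverse ws) α'))

IsCompatDegree : ∀ {n} → Matrix n → (Fin n → Sign) → (Lat n → Lat n → ℕ) → Set
IsCompatDegree {n} A ε c =
  (∀ (i : Fin n) α → AlmostPos A α → c (negv (sr i)) α ≡ ∣ lookup α i ⊔ 0ℤ ∣) ×
  (∀ s α β → AlmostPos A α → AlmostPos A β → c (τ A ε s α) (τ A ε s β) ≡ c α β)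

ExactlyTwo : ∀ {n} → Matrix n → (Fin n → Sign) → Lat n → Lat n → Lat n → Set
ExactlyTwo {n} A ε α α' γ =
  (γ ≢ α +v α') ×
  (∀ (x : Lat n) → (InE A ε α α' x → (x ≡ α +v α') ⊎ (x ≡ γ)) ×
                   ((x ≡ α +v α') ⊎ (x ≡ γ) → InE A ε α α' x))

nbrSum : ∀ {n} → Matrix n → Fin n → Lat n
nbrSum A j = tabulate (λ i → if ⌊ i Fin.≟ j ⌋ then 0ℤ else A i j)

{-# OPTIONS --safe #-}
-- By τ-invariance and since every orbit meets the negative simple roots, one may assume α = -α_j.
-- The vector σ(σ⁻¹α + σ⁻¹α′) can change along an alternating word σ⁻¹ only at the steps where
-- one of the two roots is a negative simple root fixed by the next τ. If k + 1 steps lead every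
-- simple root to a negative simple root, then the alternating word of length k + 3 permutes the
-- negative simple roots, hence acts on all roots by permuting coordinates (the coordinates are
-- compatibility degrees). As every element of Q is a sum of pairwise compatible roots, this word
-- is additive on Q, so the values are periodic; each of the two roots jumps at most once per
-- period, so only two values occur.
module Submission where

open import Defs
open import Data.Nat as ℕ using (ℕ; zero; suc; z≤n; s≤s)
import Data.Nat.Properties as ℕP
open import Data.Integer as ℤ
  using (ℤ; +_; -[1+_]; _+_; _*_; -_; _-_; _⊔_; _≤_; _<_; 0ℤ; 1ℤ; ∣_∣; +≤+; -≤+; +<+; -<+)
import Data.Integer.Properties as ℤP
open import Data.Integer.Divisibility.Signed
  using (_∣_; divides; ∣m∣n⇒∣m+n; ∣m∣n⇒∣m-n; ∣m⇒∣-m; ∣n⇒∣m*n; ∣m⇒∣m*n; ∣-refl)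
open import Data.Integer.Tactic.RingSolver using (solve-∀)
open import Data.Sign using (Sign; opposite)
import Data.Sign as Sign
import Data.Sign.Properties as SignP
open import Data.Bool using (Bool; true; false; if_then_else_; not)
open import Data.Fin as Fin using (Fin; zero; suc; toℕ)
import Data.Fin.Properties as FinP
open import Data.Fin.Subset using (Subset; _∈_; _∉_; ⊤; ⁅_⁆) renaming (∣_∣ to size; _-_ to _∖_)
open import Data.Fin.Subset.Properties
  using (_∈?_; x∈p⇒∣p-x∣<∣p∣; x∈p∧x≢y⇒x∈p-y; p─q⊆p; ∣p∣≤n; ∈⊤)
open import Data.Vec using (_∷_; there; lookup; tabulate; map; replicate)
import Data.Vec.Properties as VecP
open import Data.List as List using (List; []; _∷_)
import Data.List.Properties as ListP
import Data.List.Membership.Propositional as ListMem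
open import Data.List.Membership.Propositional.Properties using (∈-filter⁺; ∈-allFin)
open import Data.List.Relation.Unary.All as All using (All; []; _∷_)
import Data.List.Relation.Unary.All.Properties as AllP
open import Data.List.Relation.Unary.AllPairs using (AllPairs; []; _∷_)
open import Data.List.Relation.Unary.Any using (here; there)
open import Data.List.Relation.Unary.Unique.Propositional using (Unique)
import Data.List.Relation.Unary.Unique.Propositional.Properties as UniqueP
open import Data.Product using (Σ; ∃; _×_; _,_; proj₁; proj₂)
open import Data.Sum using (_⊎_; inj₁; inj₂; [_,_]′)
open import Data.Empty using (⊥; ⊥-elim)
open import Function using (_∘_; id)
open import Relation.Binary.Definitions using (tri<; tri≈; tri>)
open import Relation.Nullary using (¬_; Dec; yes; no)
open import Relation.Nullary.Decidable using (⌊_⌋)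
open import Relation.Binary.PropositionalEquality
  using (_≡_; _≢_; refl; sym; trans; cong; cong₂; subst; subst₂; module ≡-Reasoning)

-- Writing every lattice vector as a sum of pairwise compatible roots proceeds by deleting vertices,
-- which destroys irreducibility, while the compatibility degree is given only for the original
-- matrix and only by its axioms. Three notions are therefore set up for a class of systems closed
-- under cutting a vertex: `System` ignores the diagonal and connectedness; `Root` is an arithmetic
-- condition (positive norm and a divisibility) in place of words in simple reflections; and
-- compatibility is read off an Euler form. The compatibility degree enters only when a full period
-- is identified as a permutation of coordinates. That orbits reach the negative simple roots comes
-- from concavity: against a dominant vector, the weights along an alternating run have negative
-- second differences, so the run must leave the nonnegative cone. That all simple roots return
-- after the same number of steps comes from an additive relation between neighbouring orbits,
-- spread over the graph by connectedness. Irreducibility serves there and, with rank at least 2, in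
-- providing the neighbour that separates the two values.

private variable n : ℕ

-- Integer order

0≤⇒- : ∀ {x} → 0ℤ ≤ - x → x ≤ 0ℤ
0≤⇒- {x} p = subst (_≤ 0ℤ) (ℤP.neg-involutive x) (ℤP.neg-mono-≤ p)

≤0⇒0≤- : ∀ {x} → x ≤ 0ℤ → 0ℤ ≤ - x
≤0⇒0≤- = ℤP.neg-mono-≤

0≤+ : ∀ {x y} → 0ℤ ≤ x → 0ℤ ≤ y → 0ℤ ≤ x + y
0≤+ = ℤP.+-mono-≤

0<+ˡ : ∀ {x y} → 0ℤ < x → 0ℤ ≤ y → 0ℤ < x + y
0<+ˡ = ℤP.+-mono-<-≤

0<+ʳ : ∀ {x y} → 0ℤ ≤ x → 0ℤ < y → 0ℤ < x + y
0<+ʳ = ℤP.+-mono-≤-<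

0≤* : ∀ {x y} → 0ℤ ≤ x → 0ℤ ≤ y → 0ℤ ≤ x * y
0≤* {x} {y} p q = subst (_≤ x * y) (ℤP.*-zeroʳ x)
  (ℤP.*-monoˡ-≤-nonNeg x {{ℤ.nonNegative p}} q)

0<* : ∀ {x y} → 0ℤ < x → 0ℤ < y → 0ℤ < x * y
0<* {x} {y} p q = subst (_< x * y) (ℤP.*-zeroʳ x)
  (ℤP.*-monoˡ-<-pos x {{ℤ.positive p}} q)

0≤*⇒0≤ʳ : ∀ {x y} → 0ℤ < x → 0ℤ ≤ x * y → 0ℤ ≤ y
0≤*⇒0≤ʳ {x} {y} p q with 0ℤ ℤ.≤? y
... | yes r = r
... | no r = ⊥-elim (ℤP.<⇒≱ (subst (x * y <_) (ℤP.*-zeroʳ x)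
               (ℤP.*-monoˡ-<-pos x {{ℤ.positive p}} (ℤP.≰⇒> r))) q)

0<*⇒0<ʳ : ∀ {x y} → 0ℤ < x → 0ℤ < x * y → 0ℤ < y
0<*⇒0<ʳ {x} {y} p q with 0ℤ ℤ.<? y
... | yes r = r
... | no r = ⊥-elim (ℤP.<⇒≱ q (subst (x * y ≤_) (ℤP.*-zeroʳ x)
               (ℤP.*-monoˡ-≤-nonNeg x {{ℤ.nonNegative (ℤP.<⇒≤ p)}} (ℤP.≮⇒≥ r))))

≤-byDiff : ∀ {x y e} → 0ℤ ≤ e → y - x ≡ e → x ≤ y
≤-byDiff {x} {y} p q = ℤP.0≤i-j⇒j≤i (subst (0ℤ ≤_) (sym q) p)

<-byDiff : ∀ {x y e} → 0ℤ < e → y - x ≡ e → x < y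
<-byDiff {x} {y} p q = subst₂ _<_ (ℤP.+-identityˡ x)
  (trans (cong (_+ x) (sym q)) (lem y x)) (ℤP.+-monoˡ-< x p)
  where
  lem : ∀ y x → (y - x) + x ≡ y
  lem = solve-∀

0≤-<0 : ∀ {x} → 0ℤ ≤ x → ¬ (x < 0ℤ)
0≤-<0 p q = ℤP.<⇒≱ q p

0≤square : ∀ x → 0ℤ ≤ x * x
0≤square (+ n) = 0≤* {+ n} {+ n} (+≤+ z≤n) (+≤+ z≤n)
0≤square (-[1+ n ]) = +≤+ z≤n

⊔-nonneg : ∀ {x} → 0ℤ ≤ x → x ⊔ 0ℤ ≡ x
⊔-nonneg = ℤP.i≥j⇒i⊔j≡i

⊔-nonpos : ∀ {x} → x ≤ 0ℤ → x ⊔ 0ℤ ≡ 0ℤ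
⊔-nonpos = ℤP.i≤j⇒i⊔j≡j

-- The positive part is the only nonlinearity of `τ`, so every additivity statement about `τ`
-- reduces to this absence of sign clashes.
⊔0-+ : ∀ x y → (0ℤ < x → 0ℤ ≤ y) → (x < 0ℤ → y ≤ 0ℤ) → (x + y) ⊔ 0ℤ ≡ (x ⊔ 0ℤ) + (y ⊔ 0ℤ)
⊔0-+ x y p q with ℤP.<-cmp x 0ℤ
... | tri< x<0 _ _ = trans (⊔-nonpos (ℤP.+-mono-≤ (ℤP.<⇒≤ x<0) (q x<0)))
                       (sym (cong₂ _+_ (⊔-nonpos (ℤP.<⇒≤ x<0)) (⊔-nonpos (q x<0))))

... | tri≈ _ refl _ = trans (cong (_⊔ 0ℤ) (ℤP.+-identityˡ y)) (sym (ℤP.+-identityˡ (y ⊔ 0ℤ)))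
... | tri> _ _ 0<x = trans (⊔-nonneg (0≤+ (ℤP.<⇒≤ 0<x) (p 0<x)))
                       (sym (cong₂ _+_ (⊔-nonneg (ℤP.<⇒≤ 0<x)) (⊔-nonneg (p 0<x))))

-- Finite sums

∑-cong : {f g : Fin n → ℤ} → (∀ i → f i ≡ g i) → ∑ f ≡ ∑ g
∑-cong {zero} p = refl
∑-cong {suc n} p = cong₂ _+_ (p zero) (∑-cong (p ∘ suc))

∑-zero : {f : Fin n → ℤ} → (∀ i → f i ≡ 0ℤ) → ∑ f ≡ 0ℤ
∑-zero {zero} p = refl
∑-zero {suc n} p = cong₂ _+_ (p zero) (∑-zero (p ∘ suc))

∑-+ : (f g : Fin n → ℤ) → ∑ (λ i → f i + g i) ≡ ∑ f + ∑ g
∑-+ {zero} f g = refl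
∑-+ {suc n} f g = trans (cong (_+_ (f zero + g zero)) (∑-+ (f ∘ suc) (g ∘ suc)))
  (lem (f zero) (g zero) (∑ (f ∘ suc)) (∑ (g ∘ suc)))
  where
  lem : ∀ a b c d → a + b + (c + d) ≡ a + c + (b + d)
  lem = solve-∀

∑-*ˡ : (c : ℤ) (f : Fin n → ℤ) → ∑ (λ i → c * f i) ≡ c * ∑ f
∑-*ˡ {zero} c f = sym (ℤP.*-zeroʳ c)
∑-*ˡ {suc n} c f = trans (cong (_+_ (c * f zero)) (∑-*ˡ c (f ∘ suc)))
  (sym (ℤP.*-distribˡ-+ c (f zero) (∑ (f ∘ suc))))

∑-neg : (f : Fin n → ℤ) → ∑ (λ i → - f i) ≡ - ∑ f
∑-neg {zero} f = refl
∑-neg {suc n} f = trans (cong (_+_ (- f zero)) (∑-neg (f ∘ suc)))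
  (sym (ℤP.neg-distrib-+ (f zero) (∑ (f ∘ suc))))

∑-swap : ∀ {m} (f : Fin m → Fin n → ℤ) → ∑ (λ i → ∑ (f i)) ≡ ∑ (λ j → ∑ (λ i → f i j))
∑-swap {n} {m = zero} f = sym (∑-zero {n} {λ _ → 0ℤ} (λ _ → refl))
∑-swap {m = suc m} f = trans (cong (_+_ (∑ (f zero))) (∑-swap (f ∘ suc)))
  (sym (∑-+ (f zero) (λ j → ∑ (λ i → f (suc i) j))))

∑-mono : {f g : Fin n → ℤ} → (∀ i → f i ≤ g i) → ∑ f ≤ ∑ g
∑-mono {zero} p = ℤP.≤-refl
∑-mono {suc n} p = ℤP.+-mono-≤ (p zero) (∑-mono (p ∘ suc))

∑-nonneg : {f : Fin n → ℤ} → (∀ i → 0ℤ ≤ f i) → 0ℤ ≤ ∑ f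
∑-nonneg {zero} p = ℤP.≤-refl
∑-nonneg {suc n} p = 0≤+ (p zero) (∑-nonneg (p ∘ suc))

∑-pos : {f : Fin n → ℤ} → (∀ i → 0ℤ ≤ f i) → ∀ i → 0ℤ < f i → 0ℤ < ∑ f
∑-pos p zero q = 0<+ˡ q (∑-nonneg (p ∘ suc))
∑-pos p (suc i) q = 0<+ʳ (p zero) (∑-pos (p ∘ suc) i q)

∑-nonneg-zero : {f : Fin n → ℤ} → (∀ i → 0ℤ ≤ f i) → ∑ f ≡ 0ℤ → ∀ i → f i ≡ 0ℤ
∑-nonneg-zero {f = f} p q i with 0ℤ ℤ.<? f i
... | yes r = ⊥-elim (ℤP.<-irrefl (sym q) (∑-pos p i r))
... | no r = ℤP.≤-antisym (ℤP.≮⇒≥ r) (p i)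

∑-pos⇒∃ : {f : Fin n → ℤ} → 0ℤ < ∑ f → ∃ λ i → 0ℤ < f i
∑-pos⇒∃ {n} {f} p with FinP.any? (λ i → 0ℤ ℤ.<? f i)
... | yes q = q
... | no q = ⊥-elim (ℤP.<⇒≱ p (subst (∑ f ≤_) (∑-zero {n} {λ _ → 0ℤ} (λ _ → refl))
               (∑-mono (λ i → ℤP.≮⇒≥ (λ r → q (i , r))))))

∑-single : {f : Fin n → ℤ} (i : Fin n) → (∀ j → j ≢ i → f j ≡ 0ℤ) → ∑ f ≡ f i
∑-single {f = f} zero p = trans (cong (_+_ (f zero)) (∑-zero (λ j → p (suc j) (λ ()))))
  (ℤP.+-identityʳ (f zero))
∑-single {f = f} (suc i) p = trans (cong₂ _+_ (p zero (λ ()))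
  (∑-single i (λ j q → p (suc j) (q ∘ FinP.suc-injective)))) (ℤP.+-identityˡ (f (suc i)))

-- Lattice vectors

infix 9 _!_
_!_ : Lat n → Fin n → ℤ
_!_ = lookup

0v : Lat n
0v = replicate _ 0ℤ

lat-ext : {u v : Lat n} → (∀ i → u ! i ≡ v ! i) → u ≡ v
lat-ext {u = u} {v} p = trans (sym (VecP.tabulate∘lookup u))
  (trans (VecP.tabulate-cong p) (VecP.tabulate∘lookup v))

_≟v_ : (u v : Lat n) → Dec (u ≡ v)
_≟v_ = VecP.≡-dec ℤ._≟_

!-+ : ∀ (u v : Lat n) i → (u +v v) ! i ≡ u ! i + v ! i
!-+ u v i = VecP.lookup-zipWith _+_ i u v

!-neg : ∀ (u : Lat n) i → negv u ! i ≡ - (u ! i)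
!-neg u i = VecP.lookup-map i -_ u

!-0 : ∀ (i : Fin n) → 0v ! i ≡ 0ℤ
!-0 i = VecP.lookup-replicate i 0ℤ

δ : Fin n → Fin n → ℤ
δ i k = if ⌊ k Fin.≟ i ⌋ then 1ℤ else 0ℤ

δ-same : ∀ (i : Fin n) → δ i i ≡ 1ℤ
δ-same i with i Fin.≟ i
... | yes _ = refl
... | no p = ⊥-elim (p refl)

δ-diff : ∀ {i k : Fin n} → k ≢ i → δ i k ≡ 0ℤ
δ-diff {i = i} {k} p with k Fin.≟ i
... | yes q = ⊥-elim (p q)
... | no _ = refl

δ-nonneg : ∀ (i k : Fin n) → 0ℤ ≤ δ i k
δ-nonneg i k with k Fin.≟ i
... | yes _ = +≤+ z≤n
... | no _ = ℤP.≤-refl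

!-sr : ∀ (i k : Fin n) → sr i ! k ≡ δ i k
!-sr i k = VecP.lookup∘tabulate (δ i) k

sr-same : ∀ (i : Fin n) → sr i ! i ≡ 1ℤ
sr-same i = trans (!-sr i i) (δ-same i)

sr-diff : ∀ {i k : Fin n} → k ≢ i → sr i ! k ≡ 0ℤ
sr-diff {i = i} {k} p = trans (!-sr i k) (δ-diff p)

sr-sym : ∀ (i k : Fin n) → sr i ! k ≡ sr k ! i
sr-sym i k with k Fin.≟ i
... | yes refl = refl
... | no p = trans (sr-diff p) (sym (sr-diff (λ q → p (sym q))))

sr-nonneg : ∀ (i : Fin n) → IsNonneg (sr i)
sr-nonneg i k = subst (0ℤ ≤_) (sym (!-sr i k)) (δ-nonneg i k)

neg-sr-same : ∀ (i : Fin n) → negv (sr i) ! i ≡ - 1ℤ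
neg-sr-same i = trans (!-neg (sr i) i) (cong -_ (sr-same i))

neg-sr-diff : ∀ {i k : Fin n} → k ≢ i → negv (sr i) ! k ≡ 0ℤ
neg-sr-diff {i = i} {k} p = trans (!-neg (sr i) k) (cong -_ (sr-diff p))

neg-sr-nonpos : ∀ (i k : Fin n) → negv (sr i) ! k ≤ 0ℤ
neg-sr-nonpos i k = subst (_≤ 0ℤ) (sym (!-neg (sr i) k)) (ℤP.neg-mono-≤ (sr-nonneg i k))

neg-sr-negative : ∀ {i k : Fin n} → negv (sr i) ! k < 0ℤ → k ≡ i
neg-sr-negative {i = i} {k} p with k Fin.≟ i
... | yes q = q
... | no q = ⊥-elim (ℤP.<-irrefl (neg-sr-diff q) p)

¬nonneg-neg-sr : ∀ (i : Fin n) → ¬ IsNonneg (negv (sr i))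
¬nonneg-neg-sr i p with () ← subst (0ℤ ≤_) (neg-sr-same i) (p i)

∑-sr : ∀ (i : Fin n) (f : Fin n → ℤ) → ∑ (λ j → f j * sr i ! j) ≡ f i
∑-sr i f = trans (∑-single i (λ j p → trans (cong (f j *_) (sr-diff p)) (ℤP.*-zeroʳ (f j))))
  (trans (cong (f i *_) (sr-same i)) (ℤP.*-identityʳ (f i)))

Nonneg? : (v : Lat n) → IsNonneg v ⊎ ∃ λ i → v ! i < 0ℤ
Nonneg? v with FinP.any? (λ i → v ! i ℤ.<? 0ℤ)
... | yes p = inj₂ p
... | no p = inj₁ (λ i → ℤP.≮⇒≥ (λ q → p (i , q)))

nonneg-≢0 : {v : Lat n} → IsNonneg v → v ≢ 0v → ∃ λ i → 0ℤ < v ! i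
nonneg-≢0 {v = v} p q with FinP.any? (λ i → 0ℤ ℤ.<? v ! i)
... | yes r = r
... | no r = ⊥-elim (q (lat-ext (λ i → trans (ℤP.≤-antisym (ℤP.≮⇒≥ (λ s → r (i , s))) (p i))
               (sym (!-0 i)))))

<⇒0<- : ∀ {x y} → x < y → 0ℤ < y - x
<⇒0<- {x} {y} p = subst (_< y - x) (ℤP.+-inverseʳ x) (ℤP.+-monoˡ-< (- x) p)

<⇒-<0 : ∀ {x y} → x < y → x - y < 0ℤ
<⇒-<0 {x} {y} p = subst (x - y <_) (ℤP.+-inverseʳ y) (ℤP.+-monoˡ-< (- y) p)

-<0⇒< : ∀ {x y} → x - y < 0ℤ → x < y
-<0⇒< {x} {y} p = <-byDiff (ℤP.neg-mono-< p) (lem x y)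
  where
  lem : ∀ x y → y - x ≡ - (x - y)
  lem = solve-∀

-- Piecewise linear involutions and the bipartite Euler form

≢⇒opposite : ∀ {s t} → s ≢ t → s ≡ opposite t
≢⇒opposite {Sign.-} {Sign.-} p = ⊥-elim (p refl)
≢⇒opposite {Sign.-} {Sign.+} p = refl
≢⇒opposite {Sign.+} {Sign.-} p = refl
≢⇒opposite {Sign.+} {Sign.+} p = ⊥-elim (p refl)

opposite-≢ : ∀ s → opposite s ≢ s
opposite-≢ Sign.- ()
opposite-≢ Sign.+ ()

opposite² : ∀ s → opposite (opposite s) ≡ s
opposite² = SignP.opposite-involutive

_•_ : ℤ → Lat n → Lat n
k • v = map (k *_) v

!-• : ∀ k (v : Lat n) i → (k • v) ! i ≡ k * v ! i
!-• k v i = VecP.lookup-map i (k *_) v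

-- Only the off-diagonal entries enter `τ`; working with them alone allows the diagonal to be
-- arbitrary, as it is after a vertex has been isolated.
off : Matrix n → Matrix n
off A i j = if ⌊ j Fin.≟ i ⌋ then 0ℤ else A i j

off-diag : ∀ (A : Matrix n) i → off A i i ≡ 0ℤ
off-diag A i with i Fin.≟ i
... | yes _ = refl
... | no p = ⊥-elim (p refl)

off-≢ : ∀ (A : Matrix n) {i j} → i ≢ j → off A i j ≡ A i j
off-≢ A {i} {j} p with j Fin.≟ i
... | yes q = ⊥-elim (p (sym q))
... | no _ = refl

offSum : Matrix n → Lat n → Fin n → ℤ
offSum A v i = ∑ (λ j → off A i j * v ! j)

offSum-+ : ∀ (A : Matrix n) u v i → offSum A (u +v v) i ≡ offSum A u i + offSum A v i
offSum-+ A u v i = trans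
  (∑-cong (λ j → trans (cong (off A i j *_) (!-+ u v j)) (ℤP.*-distribˡ-+ (off A i j) (u ! j) (v ! j))))
  (∑-+ (λ j → off A i j * u ! j) (λ j → off A i j * v ! j))

offSum-• : ∀ (A : Matrix n) k v i → offSum A (k • v) i ≡ k * offSum A v i
offSum-• A k v i = trans
  (∑-cong (λ j → trans (cong (off A i j *_) (!-• k v j)) (lem (off A i j) k (v ! j))))
  (∑-*ˡ k (λ j → off A i j * v ! j))
  where
  lem : ∀ a b c → a * (b * c) ≡ b * (a * c)
  lem = solve-∀

offSum-sr : ∀ (A : Matrix n) j i → offSum A (sr j) i ≡ off A i j
offSum-sr A j i = ∑-sr j (off A i)

∑-diag : ∀ (A : Matrix n) (x : Fin n → ℤ) i →
  ∑ (λ j → A i j * x j) ≡ A i i * x i + ∑ (λ j → off A i j * x j)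
∑-diag A x i = trans (∑-cong split) (trans (∑-+ diag (λ j → off A i j * x j)) (cong (_+ ∑ (λ j → off A i j * x j)) single))
  where
  diag : _ → ℤ
  diag j = δ i j * (A i i * x i)
  split : ∀ j → A i j * x j ≡ diag j + off A i j * x j
  split j with j Fin.≟ i
  ... | yes refl = lem (A i i * x i) (x i)
    where
    lem : ∀ a b → a ≡ 1ℤ * a + 0ℤ * b
    lem = solve-∀
  ... | no _ = lem (A i j * x j) (A i i * x i)
    where
    lem : ∀ a b → a ≡ 0ℤ * b + a
    lem = solve-∀
  single : ∑ diag ≡ A i i * x i
  single = trans (∑-single i (λ j p → trans (cong (_* (A i i * x i)) (δ-diff p)) (ℤP.*-zeroˡ (A i i * x i))))
    (trans (cong (_* (A i i * x i)) (δ-same i)) (ℤP.*-identityˡ (A i i * x i)))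

module _ {n} (A : Matrix n) (ε : Fin n → Sign) where

  χ : Sign → Fin n → ℤ
  χ s i = if ⌊ ε i SignP.≟ s ⌋ then 1ℤ else 0ℤ

  χ-on : ∀ {s i} → ε i ≡ s → χ s i ≡ 1ℤ
  χ-on {s} {i} p with ε i SignP.≟ s
  ... | yes _ = refl
  ... | no q = ⊥-elim (q p)

  χ-off : ∀ {s i} → ε i ≢ s → χ s i ≡ 0ℤ
  χ-off {s} {i} p with ε i SignP.≟ s
  ... | yes q = ⊥-elim (p q)
  ... | no _ = refl

  -- The linear map agreeing with τ s on vectors whose coordinates outside I_s are nonnegative:
  -- the product of the commuting reflections s_i, i ∈ I_s.
  t : Sign → Lat n → Lat n
  t s v = tabulate (λ i →
    if ⌊ ε i SignP.≟ s ⌋ then - (v ! i) - offSum A v i else v ! i)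

  t-on : ∀ {s i} v → ε i ≡ s → t s v ! i ≡ - (v ! i) - offSum A v i
  t-on {s} {i} v p = trans (VecP.lookup∘tabulate _ i) lem
    where
    lem : (if ⌊ ε i SignP.≟ s ⌋ then - (v ! i) - offSum A v i else v ! i) ≡ - (v ! i) - offSum A v i
    lem with ε i SignP.≟ s
    ... | yes _ = refl
    ... | no q = ⊥-elim (q p)

  t-off : ∀ {s i} v → ε i ≢ s → t s v ! i ≡ v ! i
  t-off {s} {i} v p = trans (VecP.lookup∘tabulate _ i) lem
    where
    lem : (if ⌊ ε i SignP.≟ s ⌋ then - (v ! i) - offSum A v i else v ! i) ≡ v ! i
    lem with ε i SignP.≟ s
    ... | yes q = ⊥-elim (p q)
    ... | no _ = refl

  τ-on : ∀ {s i} v → ε i ≡ s →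
    τ A ε s v ! i ≡ - (v ! i) - ∑ (λ j → off A i j * (v ! j ⊔ 0ℤ))
  τ-on {s} {i} v p = trans (VecP.lookup∘tabulate _ i) (trans lem (cong (λ x → - (v ! i) - x) (∑-cong term)))
    where
    T : Fin n → ℤ
    T j = if ⌊ j Fin.≟ i ⌋ then 0ℤ else A i j * (v ! j ⊔ 0ℤ)
    lem : (if ⌊ ε i SignP.≟ s ⌋ then - (v ! i) - ∑ T else v ! i) ≡ - (v ! i) - ∑ T
    lem with ε i SignP.≟ s
    ... | yes _ = refl
    ... | no q = ⊥-elim (q p)
    term : ∀ j → T j ≡ off A i j * (v ! j ⊔ 0ℤ)
    term j with j Fin.≟ i
    ... | yes _ = sym (ℤP.*-zeroˡ (v ! j ⊔ 0ℤ))
    ... | no _ = refl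

  τ-off : ∀ {s i} v → ε i ≢ s → τ A ε s v ! i ≡ v ! i
  τ-off {s} {i} v p = trans (VecP.lookup∘tabulate _ i) lem
    where
    T : Fin n → ℤ
    T j = if ⌊ j Fin.≟ i ⌋ then 0ℤ else A i j * (v ! j ⊔ 0ℤ)
    lem : (if ⌊ ε i SignP.≟ s ⌋ then - (v ! i) - ∑ T else v ! i) ≡ v ! i
    lem with ε i SignP.≟ s
    ... | yes q = ⊥-elim (p q)
    ... | no _ = refl

-- The Euler form of the bipartite orientation; the symmetric form is its symmetrization.
euler : ∀ {n} (A : Matrix n) (ε : Fin n → Sign) (d : Fin n → ℤ) → Sign → Lat n → Lat n → ℤ
euler A ε d s u v = ∑ (λ i → d i * u ! i * (v ! i + χ A ε s i * offSum A v i))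

module _ {n} (A : Matrix n) (ε : Fin n → Sign) (d : Fin n → ℤ)
  (off-sym : ∀ i j → d i * off A i j ≡ d j * off A j i)
  (off-colour : ∀ i j → ε i ≡ ε j → off A i j ≡ 0ℤ) where

  private
    euler-expand : ∀ s u v → euler A ε d s u v ≡
      ∑ (λ i → d i * u ! i * v ! i) + ∑ (λ i → ∑ (λ j → χ A ε s i * (d i * off A i j) * (u ! i * v ! j)))
    euler-expand s u v = trans (∑-cong term) (∑-+ (λ i → d i * u ! i * v ! i) _)
      where
      lem : ∀ d u v c a → d * u * (v + c * a) ≡ d * u * v + (d * u * c) * a
      lem = solve-∀
      lem′ : ∀ d u c a v → (d * u * c) * (a * v) ≡ c * (d * a) * (u * v)
      lem′ = solve-∀
      term : ∀ i → d i * u ! i * (v ! i + χ A ε s i * offSum A v i) ≡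
        d i * u ! i * v ! i + ∑ (λ j → χ A ε s i * (d i * off A i j) * (u ! i * v ! j))
      term i = trans (lem (d i) (u ! i) (v ! i) (χ A ε s i) (offSum A v i))
        (cong (_+_ (d i * u ! i * v ! i)) (trans (sym (∑-*ˡ (d i * u ! i * χ A ε s i) (λ j → off A i j * v ! j)))
          (∑-cong (λ j → lem′ (d i) (u ! i) (χ A ε s i) (off A i j) (v ! j)))))

  -- Every edge joins the two colours, so the indicator of one colour at one end equals that of the
  -- other colour at the other end. Transposing the form thus reverses the orientation.
  euler-swap : ∀ s u v → euler A ε d (opposite s) u v ≡ euler A ε d s v u
  euler-swap s u v = trans (euler-expand (opposite s) u v) (trans (cong₂ _+_
    (∑-cong (λ i → comm (d i) (u ! i) (v ! i)))
    (trans (∑-swap (λ i j → χ A ε (opposite s) i * (d i * off A i j) * (u ! i * v ! j)))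
      (∑-cong (λ j → ∑-cong (λ i → cong₂ _*_ (coeff i j) (ℤP.*-comm (u ! i) (v ! j)))))))
    (sym (euler-expand s v u)))
    where
    comm : ∀ a b c → a * b * c ≡ a * c * b
    comm = solve-∀
    coeff : ∀ i j → χ A ε (opposite s) i * (d i * off A i j) ≡ χ A ε s j * (d j * off A j i)
    coeff i j with ε i SignP.≟ ε j
    ... | yes p rewrite off-colour i j p | off-colour j i (sym p) = lem (χ A ε (opposite s) i) (d i) (χ A ε s j) (d j)
      where
      lem : ∀ a b c e → a * (b * 0ℤ) ≡ c * (e * 0ℤ)
      lem = solve-∀
    ... | no p = cong₂ _*_ χχ (off-sym i j)
      where
      χχ : χ A ε (opposite s) i ≡ χ A ε s j
      χχ with ε j SignP.≟ s
      ... | yes q = χ-on A ε (trans (≢⇒opposite p) (cong opposite q))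
      ... | no q = χ-off A ε (λ r → p (trans r (sym (≢⇒opposite q))))

-- A symmetrizable positive definite system of weights on the edges of the bipartite graph;
-- w is a positive vector in the interior of the dominant cone.
record System {n} (ε : Fin n → Sign) (d w : Fin n → ℤ) (A : Matrix n) : Set where
  field
    0<d : ∀ i → 0ℤ < d i
    off-sym : ∀ i j → d i * off A i j ≡ d j * off A j i
    off-nonpos : ∀ i j → off A i j ≤ 0ℤ
    off-colour : ∀ i j → ε i ≡ ε j → off A i j ≡ 0ℤ
    euler-pos : ∀ v → v ≢ 0v → 0ℤ < euler A ε d Sign.+ v v
    0<w : ∀ i → 0ℤ < w i
    w-dominant : ∀ j → 0ℤ < + 2 * w j + ∑ (λ i → w i * off A i j)

-- Roots and sign coherence

∣∑ : ∀ {n N} {f : Fin n → ℤ} → (∀ i → N ∣ f i) → N ∣ ∑ f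
∣∑ {zero} p = divides 0ℤ refl
∣∑ {suc n} p = ∣m∣n⇒∣m+n (p zero) (∣∑ (p ∘ suc))

∣⇒≤ : ∀ {N x} → 0ℤ < N → 0ℤ < x → N ∣ x → N ≤ x
∣⇒≤ {N} {x} 0<N 0<x (divides q refl) =
  ≤-byDiff (0≤* {q - 1ℤ} (ℤP.i≤j⇒0≤j-i (ℤP.i<j⇒suc[i]≤j 0<q)) (ℤP.<⇒≤ 0<N)) (lem q N)
  where
  0<q : 0ℤ < q
  0<q = 0<*⇒0<ʳ 0<N (subst (0ℤ <_) (ℤP.*-comm q N) 0<x)
  lem : ∀ q N → q * N - N ≡ (q - 1ℤ) * N
  lem = solve-∀

module SystemProperties {n} {ε : Fin n → Sign} {d w : Fin n → ℤ} {A : Matrix n} (S : System ε d w A) where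
  open System S

  E : Sign → Lat n → Lat n → ℤ
  E = euler A ε d

  -- All neighbours of a vertex of colour `s` have the other colour, so the sum never sees the
  -- coordinates that a step of colour `s` changes.
  off-sum-cong : ∀ {s i} {x y : Fin n → ℤ} → ε i ≡ s → (∀ j → ε j ≢ s → x j ≡ y j) →
    ∑ (λ j → off A i j * x j) ≡ ∑ (λ j → off A i j * y j)
  off-sum-cong {s} {i} {x} {y} p q = ∑-cong term
    where
    term : ∀ j → off A i j * x j ≡ off A i j * y j
    term j with ε j SignP.≟ s
    ... | yes r = trans (cong (_* x j) z) (trans (ℤP.*-zeroˡ (x j)) (sym (trans (cong (_* y j) z) (ℤP.*-zeroˡ (y j)))))
      where
      z : off A i j ≡ 0ℤ
      z = off-colour i j (trans p (sym r))
    ... | no r = cong (off A i j *_) (q j r)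

  τ≡t : ∀ s v → (∀ j → ε j ≢ s → 0ℤ ≤ v ! j) → τ A ε s v ≡ t A ε s v
  τ≡t s v p = lat-ext go
    where
    go : ∀ i → τ A ε s v ! i ≡ t A ε s v ! i
    go i with ε i SignP.≟ s
    ... | yes q = trans (τ-on A ε v q) (trans
            (cong (λ x → - (v ! i) - x) (off-sum-cong q (λ j r → ⊔-nonneg (p j r)))) (sym (t-on A ε v q)))
    ... | no q = trans (τ-off A ε v q) (sym (t-off A ε v q))

  -- The quantity subtracted in I_s is computed from the untouched colour, hence is the same in both
  -- applications and cancels.
  τ-involutive : ∀ s v → τ A ε s (τ A ε s v) ≡ v
  τ-involutive s v = lat-ext go
    where
    go : ∀ i → τ A ε s (τ A ε s v) ! i ≡ v ! i
    go i with ε i SignP.≟ s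
    ... | yes q = trans (τ-on A ε (τ A ε s v) q) (trans
            (cong₂ (λ x y → - x - y) (τ-on A ε v q)
              (off-sum-cong q (λ j r → cong (_⊔ 0ℤ) (τ-off A ε v r))))
            (lem (v ! i) (∑ (λ j → off A i j * (v ! j ⊔ 0ℤ)))))
      where
      lem : ∀ a b → - (- a - b) - b ≡ a
      lem = solve-∀
    ... | no q = trans (τ-off A ε (τ A ε s v) q) (τ-off A ε v q)

  τ-+ : ∀ s u v → (∀ j → ε j ≢ s → (u ! j + v ! j) ⊔ 0ℤ ≡ (u ! j ⊔ 0ℤ) + (v ! j ⊔ 0ℤ)) →
    τ A ε s (u +v v) ≡ τ A ε s u +v τ A ε s v
  τ-+ s u v p = lat-ext go
    where
    go : ∀ i → τ A ε s (u +v v) ! i ≡ (τ A ε s u +v τ A ε s v) ! i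
    go i with ε i SignP.≟ s
    ... | yes q = trans (τ-on A ε (u +v v) q) (trans
            (cong₂ (λ x y → - x - y) (!-+ u v i) (trans
              (off-sum-cong q (λ j r → trans (cong (_⊔ 0ℤ) (!-+ u v j)) (p j r)))
              (trans (∑-cong (λ j → ℤP.*-distribˡ-+ (off A i j) (u ! j ⊔ 0ℤ) (v ! j ⊔ 0ℤ)))
                (∑-+ (λ j → off A i j * (u ! j ⊔ 0ℤ)) (λ j → off A i j * (v ! j ⊔ 0ℤ))))))
            (trans (lem (u ! i) (v ! i) (∑ (λ j → off A i j * (u ! j ⊔ 0ℤ))) (∑ (λ j → off A i j * (v ! j ⊔ 0ℤ))))
              (sym (trans (!-+ (τ A ε s u) (τ A ε s v) i) (cong₂ _+_ (τ-on A ε u q) (τ-on A ε v q))))))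
      where
      lem : ∀ a b c d → - (a + b) - (c + d) ≡ (- a - c) + (- b - d)
      lem = solve-∀
    ... | no q = trans (τ-off A ε (u +v v) q) (trans (!-+ u v i)
            (sym (trans (!-+ (τ A ε s u) (τ A ε s v) i) (cong₂ _+_ (τ-off A ε u q) (τ-off A ε v q)))))

  τ-+-nonneg : ∀ s u v → (∀ j → ε j ≢ s → 0ℤ ≤ u ! j) → (∀ j → ε j ≢ s → 0ℤ ≤ v ! j) →
    τ A ε s (u +v v) ≡ τ A ε s u +v τ A ε s v
  τ-+-nonneg s u v p q = τ-+ s u v (λ j r → ⊔0-+ (u ! j) (v ! j) (λ _ → q j r) (λ u<0 → ⊥-elim (0≤-<0 (p j r) u<0)))

  -- At a vertex of I_s the second factor for `t s v` collapses to minus the coordinate of `v`,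
  -- while the first is minus the second factor for `u`. Together with `euler-swap` this is the
  -- reflection at all sinks or sources: it carries the form of one orientation to that of the
  -- other.
  E-t : ∀ s u v → E s (t A ε s u) (t A ε s v) ≡ E s v u
  E-t s u v = ∑-cong term
    where
    term : ∀ i → d i * t A ε s u ! i * (t A ε s v ! i + χ A ε s i * offSum A (t A ε s v) i) ≡
                 d i * v ! i * (u ! i + χ A ε s i * offSum A u i)
    term i with ε i SignP.≟ s
    ... | yes q rewrite t-on A ε u q | t-on A ε v q
                | off-sum-cong {x = λ j → t A ε s v ! j} q (λ j r → t-off A ε v r) =
            lem (d i) (u ! i) (offSum A u i) (v ! i) (offSum A v i)
      where
      lem : ∀ d u a v b → d * (- u - a) * ((- v - b) + 1ℤ * b) ≡ d * v * (u + 1ℤ * a)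
      lem = solve-∀
    ... | no q rewrite t-off A ε u q | t-off A ε v q =
            lem (d i) (u ! i) (v ! i) (offSum A (t A ε s v) i) (offSum A u i)
      where
      lem : ∀ d u v a b → d * u * (v + 0ℤ * a) ≡ d * v * (u + 0ℤ * b)
      lem = solve-∀

  E-swap : ∀ s u v → E (opposite s) u v ≡ E s v u
  E-swap = euler-swap A ε d off-sym off-colour

  E-+ʳ : ∀ s u v x → E s u (v +v x) ≡ E s u v + E s u x
  E-+ʳ s u v x = trans (∑-cong term) (∑-+ (λ i → d i * u ! i * (v ! i + χ A ε s i * offSum A v i))
                                          (λ i → d i * u ! i * (x ! i + χ A ε s i * offSum A x i)))
    where
    lem : ∀ d u a b c e f → d * u * ((a + b) + c * (e + f)) ≡ d * u * (a + c * e) + d * u * (b + c * f)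
    lem = solve-∀
    term : ∀ i → d i * u ! i * ((v +v x) ! i + χ A ε s i * offSum A (v +v x) i) ≡
      d i * u ! i * (v ! i + χ A ε s i * offSum A v i) + d i * u ! i * (x ! i + χ A ε s i * offSum A x i)
    term i rewrite !-+ v x i | offSum-+ A v x i =
      lem (d i) (u ! i) (v ! i) (x ! i) (χ A ε s i) (offSum A v i) (offSum A x i)

  E-+ˡ : ∀ s u v x → E s (u +v v) x ≡ E s u x + E s v x
  E-+ˡ s u v x = trans (∑-cong term) (∑-+ (λ i → d i * u ! i * (x ! i + χ A ε s i * offSum A x i))
                                          (λ i → d i * v ! i * (x ! i + χ A ε s i * offSum A x i)))
    where
    lem : ∀ d u v y → d * (u + v) * y ≡ d * u * y + d * v * y
    lem = solve-∀
    term : ∀ i → d i * (u +v v) ! i * (x ! i + χ A ε s i * offSum A x i) ≡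
      d i * u ! i * (x ! i + χ A ε s i * offSum A x i) + d i * v ! i * (x ! i + χ A ε s i * offSum A x i)
    term i rewrite !-+ u v i = lem (d i) (u ! i) (v ! i) (x ! i + χ A ε s i * offSum A x i)

  E-•ʳ : ∀ s u k v → E s u (k • v) ≡ k * E s u v
  E-•ʳ s u k v = trans (∑-cong term) (∑-*ˡ k (λ i → d i * u ! i * (v ! i + χ A ε s i * offSum A v i)))
    where
    lem : ∀ d u k a c b → d * u * (k * a + c * (k * b)) ≡ k * (d * u * (a + c * b))
    lem = solve-∀
    term : ∀ i → d i * u ! i * ((k • v) ! i + χ A ε s i * offSum A (k • v) i) ≡
      k * (d i * u ! i * (v ! i + χ A ε s i * offSum A v i))
    term i rewrite !-• k v i | offSum-• A k v i = lem (d i) (u ! i) k (v ! i) (χ A ε s i) (offSum A v i)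

  E-•ˡ : ∀ s k u v → E s (k • u) v ≡ k * E s u v
  E-•ˡ s k u v = trans (sym (E-swap s v (k • u)))
    (trans (E-•ʳ (opposite s) v k u) (cong (k *_) (E-swap s v u)))

  E-srˡ : ∀ s i v → E s (sr i) v ≡ d i * (v ! i + χ A ε s i * offSum A v i)
  E-srˡ s i v = trans (∑-cong (λ j → lem (d j) (sr i ! j) (v ! j + χ A ε s j * offSum A v j)))
    (∑-sr i (λ j → d j * (v ! j + χ A ε s j * offSum A v j)))
    where
    lem : ∀ a b c → a * b * c ≡ a * c * b
    lem = solve-∀

  E-srˡ-off : ∀ {s i} v → ε i ≢ s → E s (sr i) v ≡ d i * v ! i
  E-srˡ-off {s} {i} v p = trans (E-srˡ s i v) (trans (cong (λ x → d i * (v ! i + x * offSum A v i)) (χ-off A ε p))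
    (lem (d i) (v ! i) (offSum A v i)))
    where
    lem : ∀ a b c → a * (b + 0ℤ * c) ≡ a * b
    lem = solve-∀

  E-srˡ-on : ∀ {s i} v → ε i ≡ s → E s (sr i) v ≡ d i * (- (t A ε s v ! i))
  E-srˡ-on {s} {i} v p = trans (E-srˡ s i v) (trans (cong (λ x → d i * (v ! i + x * offSum A v i)) (χ-on A ε p))
    (trans (lem (d i) (v ! i) (offSum A v i)) (cong (λ x → d i * (- x)) (sym (t-on A ε v p)))))
    where
    lem : ∀ a b c → a * (b + 1ℤ * c) ≡ a * (- (- b - c))
    lem = solve-∀

  N : Lat n → ℤ
  N v = E Sign.+ v v

  N-any : ∀ s v → E s v v ≡ N v
  N-any Sign.- v = E-swap Sign.+ v v
  N-any Sign.+ v = refl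

  -- For v = wα_i this says that N v = d_i is half the squared length of v
  -- and that the coroot 2v/(v,v) lies in the coroot lattice.
  record Root (v : Lat n) : Set where
    constructor root
    field
      N-pos : 0ℤ < N v
      N-div : ∀ j → N v ∣ d j * v ! j

  N-t : ∀ s v → N (t A ε s v) ≡ N v
  N-t s v = trans (sym (N-any s (t A ε s v))) (trans (E-t s v v) (N-any s v))

  -- Symmetry moves the factor from row to column: d_i a_ij v_j = a_ji (d_j v_j), and the bracket is
  -- divisible by assumption.
  offSum-∣ : ∀ {m v} → (∀ j → m ∣ d j * v ! j) → ∀ i → m ∣ d i * offSum A v i
  offSum-∣ {m} {v} p i = subst (m ∣_) (∑-*ˡ (d i) (λ j → off A i j * v ! j)) (∣∑ term)
    where
    lem : ∀ a e v → a * (e * v) ≡ e * a * v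
    lem = solve-∀
    lem′ : ∀ a e v → a * e * v ≡ a * (e * v)
    lem′ = solve-∀
    term : ∀ j → m ∣ d i * (off A i j * v ! j)
    term j = subst (m ∣_) (trans (lem (off A j i) (d j) (v ! j))
               (trans (cong (_* v ! j) (off-sym j i)) (lem′ (d i) (off A i j) (v ! j))))
               (∣n⇒∣m*n (off A j i) (p j))

  Root-t : ∀ s {v} → Root v → Root (t A ε s v)
  Root-t s {v} (root 0<N div) = root (subst (0ℤ <_) (sym (N-t s v)) 0<N)
    (λ j → subst (_∣ d j * t A ε s v ! j) (sym (N-t s v)) (go j))
    where
    lem : ∀ a b c → - (a * b) - a * c ≡ a * (- b - c)
    lem = solve-∀
    go : ∀ j → N v ∣ d j * t A ε s v ! j
    go j with ε j SignP.≟ s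
    ... | yes q rewrite t-on A ε v q = subst (N v ∣_) (lem (d j) (v ! j) (offSum A v j))
            (∣m∣n⇒∣m-n (∣m⇒∣-m (div j)) (offSum-∣ {v = v} div j))
    ... | no q rewrite t-off A ε v q = div j

  Root-≢0 : ∀ {v} → Root v → v ≢ 0v
  Root-≢0 (root 0<N _) refl = ℤP.<-irrefl (sym (∑-zero (λ i → trans
    (cong (λ x → d i * x * (0v {n} ! i + χ A ε Sign.+ i * offSum A 0v i)) (!-0 i)) (lem (d i) _)))) 0<N
    where
    lem : ∀ a b → a * 0ℤ * b ≡ 0ℤ
    lem = solve-∀

  part : (Fin n → Bool) → Lat n → Lat n
  part g v = tabulate (λ k → if g k then v ! k else 0ℤ)

  part-in : ∀ g v {i} → g i ≡ true → part g v ! i ≡ v ! i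
  part-in g v {i} p = trans (VecP.lookup∘tabulate _ i) (cong (λ b → if b then v ! i else 0ℤ) p)

  part-out : ∀ g v {i} → g i ≡ false → part g v ! i ≡ 0ℤ
  part-out g v {i} p = trans (VecP.lookup∘tabulate _ i) (cong (λ b → if b then v ! i else 0ℤ) p)

  -- Disjointness kills the diagonal terms, so only the edges between the two supports contribute.
  E-part-nonneg : ∀ g h v → (∀ i → g i ≡ true → h i ≡ true → ⊥) →
    (∀ i j → g i ≡ true → h j ≡ true → 0ℤ ≤ v ! i * (off A i j * v ! j)) →
    0ℤ ≤ E Sign.+ (part g v) (part h v)
  E-part-nonneg g h v disj cross = ∑-nonneg term
    where
    lem : ∀ d p q c m → p * q ≡ 0ℤ → d * p * (q + c * m) ≡ d * c * (p * m)
    lem d p q c m pq = trans (lem₁ d p q c m) (trans (cong (λ x → d * x + d * c * (p * m)) pq) (lem₂ d (d * c * (p * m))))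
      where
      lem₁ : ∀ d p q c m → d * p * (q + c * m) ≡ d * (p * q) + d * c * (p * m)
      lem₁ = solve-∀
      lem₂ : ∀ d x → d * 0ℤ + x ≡ x
      lem₂ = solve-∀
    0≤χ : ∀ i → 0ℤ ≤ χ A ε Sign.+ i
    0≤χ i with ε i SignP.≟ Sign.+
    ... | yes _ = +≤+ z≤n
    ... | no _ = +≤+ z≤n
    inner : ∀ i j → 0ℤ ≤ part g v ! i * (off A i j * part h v ! j)
    inner i j with g i in eg | h j in eh
    ... | true | true rewrite part-in g v eg | part-in h v eh = cross i j eg eh
    ... | false | _ rewrite part-out g v eg = subst (0ℤ ≤_) (sym (ℤP.*-zeroˡ (off A i j * part h v ! j))) ℤP.≤-refl
    ... | true | false rewrite part-out h v eh = subst (0ℤ ≤_) (sym (zz (part g v ! i) (off A i j))) ℤP.≤-refl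
      where
      zz : ∀ a b → a * (b * 0ℤ) ≡ 0ℤ
      zz = solve-∀
    prod : ∀ i → part g v ! i * part h v ! i ≡ 0ℤ
    prod i with g i in eg | h i in eh
    ... | true | true = ⊥-elim (disj i eg eh)
    ... | false | _ rewrite part-out g v eg = ℤP.*-zeroˡ (part h v ! i)
    ... | true | false rewrite part-out h v eh = ℤP.*-zeroʳ (part g v ! i)
    term : ∀ i → 0ℤ ≤ d i * part g v ! i * (part h v ! i + χ A ε Sign.+ i * offSum A (part h v) i)
    term i = subst (0ℤ ≤_) (sym (lem (d i) (part g v ! i) (part h v ! i) (χ A ε Sign.+ i) (offSum A (part h v) i) (prod i)))
      (0≤* (0≤* (ℤP.<⇒≤ (0<d i)) (0≤χ i))
        (subst (0ℤ ≤_) (∑-*ˡ (part g v ! i) (λ j → off A i j * part h v ! j)) (∑-nonneg (inner i))))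

  -- N v divides N p and N q when v = p + q with disjoint supports, so such a splitting
  -- with nonnegative cross terms would force N v ≥ 2 N v.
  Root-indecomposable : ∀ {v} → Root v → (f : Fin n → Bool) →
    (∀ i j → f i ≢ f j → 0ℤ ≤ v ! i * (off A i j * v ! j)) →
    (∀ i → f i ≡ true → v ! i ≡ 0ℤ) ⊎ (∀ i → f i ≡ false → v ! i ≡ 0ℤ)
  Root-indecomposable {v} (root 0<N div) f cross with part f v ≟v 0v | part (not ∘ f) v ≟v 0v
  ... | yes p | _ = inj₁ (λ i q → trans (sym (part-in f v q)) (trans (cong (_! i) p) (!-0 i)))
  ... | no _ | yes p = inj₂ (λ i q → trans (sym (part-in (not ∘ f) v (cong not q))) (trans (cong (_! i) p) (!-0 i)))
  ... | no p | no q = ⊥-elim (ℤP.<⇒≱ 0<N (≤-byDiff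
          (0≤+ (0≤+ (ℤP.i≤j⇒0≤j-i (N≤ f p)) (ℤP.i≤j⇒0≤j-i (N≤ (not ∘ f) q)))
               (0≤+ (E-part-nonneg f (not ∘ f) v (λ i a b → disj (f i) a b)
                       (λ i j a b → cross i j (λ c → disj (f j) (trans (sym c) a) b)))
                    (E-part-nonneg (not ∘ f) f v (λ i a b → disj (f i) b a)
                       (λ i j a b → cross i j (λ c → disj (f i) (trans c b) a)))))
          (trans (cong (λ x → 0ℤ - x) (sym (ℤP.+-identityʳ (N v))))
            (trans (lem₁ (N v)) (trans (cong (λ x → x - N v - N v) split)
              (lem₂ (N P) (E Sign.+ P Q) (E Sign.+ Q P) (N Q) (N v)))))))
    where
    P Q : Lat n
    P = part f v
    Q = part (not ∘ f) v
    disj : ∀ b → b ≡ true → not b ≡ true → ⊥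
    disj true _ ()
    disj false () _
    v≡P+Q : v ≡ P +v Q
    v≡P+Q = lat-ext go
      where
      go : ∀ i → v ! i ≡ (P +v Q) ! i
      go i with f i in e
      ... | true = sym (trans (!-+ P Q i) (trans (cong₂ _+_ (part-in f v e) (part-out (not ∘ f) v (cong not e))) (ℤP.+-identityʳ (v ! i))))
      ... | false = sym (trans (!-+ P Q i) (trans (cong₂ _+_ (part-out f v e) (part-in (not ∘ f) v (cong not e))) (ℤP.+-identityˡ (v ! i))))
    split : N v ≡ N P + E Sign.+ P Q + (E Sign.+ Q P + N Q)
    split = trans (cong N v≡P+Q) (trans (E-+ˡ Sign.+ P Q (P +v Q)) (cong₂ _+_ (E-+ʳ Sign.+ P P Q) (E-+ʳ Sign.+ Q P Q)))
    lem₁ : ∀ a → 0ℤ - (a + 0ℤ) ≡ a - a - a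
    lem₁ = solve-∀
    lem₂ : ∀ p pq qp q a → p + pq + (qp + q) - a - a ≡ (p - a + (q - a)) + (pq + qp)
    lem₂ = solve-∀
    N≤ : ∀ g → part g v ≢ 0v → N v ≤ N (part g v)
    N≤ g p = ∣⇒≤ 0<N (euler-pos (part g v) p) (∣∑ (λ i → ∣m⇒∣m*n (part g v ! i + χ A ε Sign.+ i * offSum A (part g v) i) (coord i)))
      where
      coord : ∀ i → N v ∣ d i * part g v ! i
      coord i with g i in e
      ... | true rewrite part-in g v e = div i
      ... | false rewrite part-out g v e = divides 0ℤ (ℤP.*-zeroʳ (d i))

  -- Cut `v` between its nonnegative and its negative coordinates: an edge across the cut pairs
  -- coordinates of opposite sign with a nonpositive entry, so the cross terms are nonnegative and
  -- `Root-indecomposable` empties one side.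
  Root-sign : ∀ {v} → Root v → IsNonneg v ⊎ (∀ i → v ! i ≤ 0ℤ)
  Root-sign {v} r with Root-indecomposable r f cross
    where
    f : Fin n → Bool
    f i = ⌊ 0ℤ ℤ.≤? v ! i ⌋
    lem : ∀ a b c → a * (b * c) ≡ - b * (- a * c)
    lem = solve-∀
    lem′ : ∀ a b c → a * (b * c) ≡ - b * (a * - c)
    lem′ = solve-∀
    cross : ∀ i j → f i ≢ f j → 0ℤ ≤ v ! i * (off A i j * v ! j)
    cross i j p with 0ℤ ℤ.≤? v ! i | 0ℤ ℤ.≤? v ! j
    ... | yes _ | yes _ = ⊥-elim (p refl)
    ... | no _ | no _ = ⊥-elim (p refl)
    ... | yes a | no b = subst (0ℤ ≤_) (sym (lem′ (v ! i) (off A i j) (v ! j)))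
            (0≤* (≤0⇒0≤- (off-nonpos i j)) (0≤* a (≤0⇒0≤- (ℤP.<⇒≤ (ℤP.≰⇒> b)))))
    ... | no a | yes b = subst (0ℤ ≤_) (sym (lem (v ! i) (off A i j) (v ! j)))
            (0≤* (≤0⇒0≤- (off-nonpos i j)) (0≤* (≤0⇒0≤- (ℤP.<⇒≤ (ℤP.≰⇒> a))) b))
  ... | inj₁ p = inj₂ nonpos
    where
    nonpos : ∀ i → v ! i ≤ 0ℤ
    nonpos i with 0ℤ ℤ.≤? v ! i | p i
    ... | yes _ | z = ℤP.≤-reflexive (z refl)
    ... | no a | _ = ℤP.<⇒≤ (ℤP.≰⇒> a)
  ... | inj₂ p = inj₁ nonneg
    where
    nonneg : ∀ i → 0ℤ ≤ v ! i
    nonneg i with 0ℤ ℤ.≤? v ! i | p i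
    ... | yes a | _ = a
    ... | no _ | z = ℤP.≤-reflexive (sym (z refl))

  -- No edge joins two vertices of one colour, so `v` may be cut around a single vertex i of its
  -- support and must vanish elsewhere. Then `N v` equals d_i v_i² and divides d_i v_i, which leaves
  -- only v_i = 1.
  Root-unicolour : ∀ {s v} → Root v → IsNonneg v → (∀ i → ε i ≢ s → v ! i ≡ 0ℤ) →
    ∃ λ i → ε i ≡ s × v ≡ sr i
  Root-unicolour {s} {v} r@(root 0<N div) v≥0 uni with nonneg-≢0 {v = v} v≥0 (Root-≢0 r)
  ... | i , 0<vi = i , εi , lat-ext coords
    where
    εi : ε i ≡ s
    εi with ε i SignP.≟ s
    ... | yes p = p
    ... | no p = ⊥-elim (ℤP.<-irrefl (sym (uni i p)) 0<vi)
    f : Fin n → Bool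
    f k = ⌊ k Fin.≟ i ⌋
    cross : ∀ k l → f k ≢ f l → 0ℤ ≤ v ! k * (off A k l * v ! l)
    cross k l _ with ε k SignP.≟ s | ε l SignP.≟ s
    ... | no p | _ rewrite uni k p = ℤP.≤-reflexive (sym (ℤP.*-zeroˡ (off A k l * v ! l)))
    ... | yes _ | no p rewrite uni l p = ℤP.≤-reflexive (sym (lem (v ! k) (off A k l)))
      where
      lem : ∀ a b → a * (b * 0ℤ) ≡ 0ℤ
      lem = solve-∀
    ... | yes p | yes q rewrite off-colour k l (trans p (sym q)) = ℤP.≤-reflexive (sym (lem (v ! k) (v ! l)))
      where
      lem : ∀ a b → a * (0ℤ * b) ≡ 0ℤ
      lem = solve-∀
    rest : ∀ k → k ≢ i → v ! k ≡ 0ℤ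
    rest k p with Root-indecomposable r f cross
    ... | inj₁ z = ⊥-elim (ℤP.<-irrefl (sym (z i fi)) 0<vi)
      where
      fi : f i ≡ true
      fi with i Fin.≟ i
      ... | yes _ = refl
      ... | no q = ⊥-elim (q refl)
    ... | inj₂ z = z k fk
      where
      fk : f k ≡ false
      fk with k Fin.≟ i
      ... | yes q = ⊥-elim (p q)
      ... | no _ = refl
    offSum0 : offSum A v i ≡ 0ℤ
    offSum0 = ∑-zero term
      where
      term : ∀ j → off A i j * v ! j ≡ 0ℤ
      term j with j Fin.≟ i
      ... | yes refl = ℤP.*-zeroˡ (v ! i)
      ... | no p rewrite rest j p = ℤP.*-zeroʳ (A i j)
    Nv : N v ≡ d i * v ! i * v ! i
    Nv = trans (∑-single i (λ j p → trans
           (cong (λ x → d j * x * (v ! j + χ A ε Sign.+ j * offSum A v j)) (rest j p)) (lem (d j) _)))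
           (trans (cong (λ x → d i * v ! i * (v ! i + χ A ε Sign.+ i * x)) offSum0) (lem′ (d i) (v ! i) (χ A ε Sign.+ i)))
      where
      lem : ∀ a b → a * 0ℤ * b ≡ 0ℤ
      lem = solve-∀
      lem′ : ∀ a b c → a * b * (b + c * 0ℤ) ≡ a * b * b
      lem′ = solve-∀
    0<dv : 0ℤ < d i * v ! i
    0<dv = 0<* (0<d i) 0<vi
    vi≡1 : v ! i ≡ 1ℤ
    vi≡1 with v ! i ℤ.≤? 1ℤ
    ... | yes p = ℤP.≤-antisym p (ℤP.i<j⇒suc[i]≤j 0<vi)
    ... | no p = ⊥-elim (ℤP.<⇒≱ (<-byDiff (0<* 0<dv 0<v-1) (lem (d i * v ! i) (v ! i)))
                   (∣⇒≤ (subst (0ℤ <_) Nv 0<N) 0<dv (subst (_∣ d i * v ! i) Nv (div i))))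
      where
      0<v-1 : 0ℤ < v ! i - 1ℤ
      0<v-1 = <⇒0<- (ℤP.≰⇒> p)
      lem : ∀ a b → a * b - a ≡ a * (b - 1ℤ)
      lem = solve-∀
    coords : ∀ k → v ! k ≡ sr i ! k
    coords k with k Fin.≟ i
    ... | yes refl = trans vi≡1 (sym (sr-same i))
    ... | no p = trans (rest k p) (sym (sr-diff p))

-- Compatibility of almost positive roots

module _ {n} (A : Matrix n) (ε : Fin n → Sign) where

  -- Alternating words: in `run s k` the letter `s` is innermost, in the inverse `back s k` it is
  -- outermost.
  run back : Sign → ℕ → Lat n → Lat n
  run s zero v = v
  run s (suc k) v = run (opposite s) k (τ A ε s v)
  back s zero v = v
  back s (suc k) v = τ A ε s (back (opposite s) k v)

-- The colour of the letter that comes next once k letters of an alternating run starting with `s`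
-- have been applied.
sgn : Sign → ℕ → Sign
sgn s zero = s
sgn s (suc k) = sgn (opposite s) k

sgn-suc : ∀ s k → sgn s (suc k) ≡ opposite (sgn s k)
sgn-suc s zero = refl
sgn-suc s (suc k) = sgn-suc (opposite s) k

sgn-sgn : ∀ s k → sgn (sgn s k) k ≡ s
sgn-sgn s zero = refl
sgn-sgn s (suc k) = trans (cong (λ x → sgn (opposite x) k) (sgn-suc s k))
  (trans (cong (λ x → sgn x k) (opposite² (sgn s k))) (sgn-sgn s k))

module AlmostPositive {n} {ε : Fin n → Sign} {d w : Fin n → ℤ} {A : Matrix n} (S : System ε d w A) where
  open System S
  open SystemProperties S

  N-sr : ∀ i → N (sr i) ≡ d i
  N-sr i = trans (E-srˡ Sign.+ i (sr i)) (trans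
    (cong₂ (λ x y → d i * (x + χ A ε Sign.+ i * y)) (sr-same i) (trans (offSum-sr A i i) (off-diag A i)))
    (lem (d i) (χ A ε Sign.+ i)))
    where
    lem : ∀ a b → a * (1ℤ + b * 0ℤ) ≡ a
    lem = solve-∀

  Root-sr : ∀ i → Root (sr i)
  Root-sr i = root (subst (0ℤ <_) (sym (N-sr i)) (0<d i)) (λ j → subst (_∣ d j * sr i ! j) (sym (N-sr i)) (div j))
    where
    div : ∀ j → d i ∣ d j * sr i ! j
    div j with j Fin.≟ i
    ... | yes refl = ∣m⇒∣m*n (sr i ! i) ∣-refl
    ... | no p rewrite sr-diff p = divides 0ℤ (ℤP.*-zeroʳ (d j))

  private
    offSum-⊔-neg-sr : ∀ i k → ∑ (λ j → off A k j * (negv (sr i) ! j ⊔ 0ℤ)) ≡ 0ℤ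
    offSum-⊔-neg-sr i k = ∑-zero (λ j → trans (cong (off A k j *_) (⊔-nonpos (neg-sr-nonpos i j))) (ℤP.*-zeroʳ (off A k j)))

    flip-sr : ∀ (i k : Fin n) x → x ≡ 0ℤ → - (negv (sr i) ! k) - x ≡ sr i ! k
    flip-sr i k x refl = trans (cong (λ y → - y - 0ℤ) (!-neg (sr i) k)) (lem (sr i ! k))
      where
      lem : ∀ a → - (- a) - 0ℤ ≡ a
      lem = solve-∀

  -- The positive part of a negative simple root is zero, so its neighbours do not feel it and the
  -- only effect is a change of sign at its own vertex.
  τ-neg-sr-on : ∀ {s i} → ε i ≡ s → τ A ε s (negv (sr i)) ≡ sr i
  τ-neg-sr-on {s} {i} p = lat-ext go
    where
    go : ∀ k → τ A ε s (negv (sr i)) ! k ≡ sr i ! k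
    go k with ε k SignP.≟ s
    ... | yes q = trans (τ-on A ε (negv (sr i)) q) (flip-sr i k _ (offSum-⊔-neg-sr i k))
    ... | no q = trans (τ-off A ε (negv (sr i)) q) (trans (neg-sr-diff k≢i) (sym (sr-diff k≢i)))
      where
      k≢i : k ≢ i
      k≢i refl = q p

  τ-neg-sr-off : ∀ {s i} → ε i ≢ s → τ A ε s (negv (sr i)) ≡ negv (sr i)
  τ-neg-sr-off {s} {i} p = lat-ext go
    where
    go : ∀ k → τ A ε s (negv (sr i)) ! k ≡ negv (sr i) ! k
    go k with ε k SignP.≟ s
    ... | yes q = trans (τ-on A ε (negv (sr i)) q) (trans (flip-sr i k _ (offSum-⊔-neg-sr i k))
            (trans (sr-diff k≢i) (sym (neg-sr-diff k≢i))))
      where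
      k≢i : k ≢ i
      k≢i refl = p q
    ... | no q = τ-off A ε (negv (sr i)) q

  τ-sr-on : ∀ {s i} → ε i ≡ s → τ A ε s (sr i) ≡ negv (sr i)
  τ-sr-on {s} {i} p = trans (cong (τ A ε s) (sym (τ-neg-sr-on p))) (τ-involutive s (negv (sr i)))

  -- The counterpart of `AlmostPos` with the arithmetic `Root` in place of `IsRoot`, so that it can
  -- be transferred between a system and its isolated subsystems. `AlmostPos⇒AP` and `AP⇒AlmostPos`
  -- show that the two agree for a Cartan matrix.
  data AP (v : Lat n) : Set where
    pos : IsNonneg v → Root v → AP v
    neg : ∀ i → v ≡ negv (sr i) → AP v

  -- The reflected root has a sign. If it is nonpositive, the coordinates that `t s` leaves alone
  -- are both nonnegative and nonpositive, so `v` lives on one colour and is simple.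
  nonneg-step : ∀ s {v} → IsNonneg v → Root v →
    (IsNonneg (τ A ε s v) × Root (τ A ε s v)) ⊎ ∃ λ i → ε i ≡ s × v ≡ sr i
  nonneg-step s {v} v≥0 r with Root-sign (Root-t s r)
  ... | inj₁ p = inj₁ (subst (λ u → IsNonneg u × Root u) (sym (τ≡t s v (λ j _ → v≥0 j))) (p , Root-t s r))
  ... | inj₂ p = inj₂ (Root-unicolour r v≥0 (λ j q →
          ℤP.≤-antisym (subst (_≤ 0ℤ) (t-off A ε v q) (p j)) (v≥0 j)))

  -- The four motions of an almost positive root under `τ s`. Only in the case `fixed` is there a
  -- negative coordinate outside I_s, which is where additivity of `τ s` can fail.
  data View (s : Sign) : Lat n → Set where
    stay : ∀ {v} → IsNonneg v → Root v → IsNonneg (τ A ε s v) → Root (τ A ε s v) → View s v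
    down : ∀ i → ε i ≡ s → View s (sr i)
    up : ∀ i → ε i ≡ s → View s (negv (sr i))
    fixed : ∀ i → ε i ≢ s → View s (negv (sr i))

  view : ∀ s {v} → AP v → View s v
  view s (pos p r) with nonneg-step s p r
  ... | inj₁ (q , r′) = stay p r q r′
  ... | inj₂ (i , q , refl) = down i q
  view s (neg i refl) with ε i SignP.≟ s
  ... | yes p = up i p
  ... | no p = fixed i p

  AP-τ : ∀ s {v} → AP v → AP (τ A ε s v)
  AP-τ s a with view s a
  ... | stay _ _ q r = pos q r
  ... | down i p = neg i (τ-sr-on p)
  ... | up i p = subst AP (sym (τ-neg-sr-on p)) (pos (sr-nonneg i) (Root-sr i))
  ... | fixed i p = neg i (τ-neg-sr-off p)

  AP-run : ∀ s k {v} → AP v → AP (run A ε s k v)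
  AP-run s zero a = a
  AP-run s (suc k) a = AP-run (opposite s) k (AP-τ s a)

  AP-back : ∀ s k {v} → AP v → AP (back A ε s k v)
  AP-back s zero a = a
  AP-back s (suc k) a = AP-τ s (AP-back (opposite s) k a)

  back-run : ∀ s k v → back A ε s k (run A ε s k v) ≡ v
  back-run s zero v = refl
  back-run s (suc k) v = trans (cong (τ A ε s) (back-run (opposite s) k (τ A ε s v))) (τ-involutive s v)

  run-back : ∀ s k v → run A ε s k (back A ε s k v) ≡ v
  run-back s zero v = refl
  run-back s (suc k) v = trans (cong (run A ε (opposite s) k) (τ-involutive s (back A ε (opposite s) k v)))
    (run-back (opposite s) k v)

  -- For positive roots this says that Ext¹ vanishes in both directions for the bipartite orientation.
  record Compat (u v : Lat n) : Set where
    constructor compat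
    field
      neg-left : ∀ j → u ! j < 0ℤ → v ! j ≤ 0ℤ
      neg-right : ∀ j → v ! j < 0ℤ → u ! j ≤ 0ℤ
      euler-nonneg : IsNonneg u → IsNonneg v → ∀ s → 0ℤ ≤ E s u v

  Compat-sym : ∀ {u v} → Compat u v → Compat v u
  Compat-sym {u} {v} (compat a b c) = compat b a (λ p q s → subst (0ℤ ≤_) (E-swap s u v) (c q p (opposite s)))

  private
    E-simple-nonneg : ∀ {s i} w → ε i ≡ s → IsNonneg w → t A ε s w ! i ≤ 0ℤ → ∀ s′ → 0ℤ ≤ E s′ (sr i) w
    E-simple-nonneg {s} {i} w p w≥0 q s′ with s SignP.≟ s′
    ... | yes refl = subst (0ℤ ≤_) (sym (E-srˡ-on w p)) (0≤* (ℤP.<⇒≤ (0<d i)) (≤0⇒0≤- q))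
    ... | no r = subst (0ℤ ≤_) (sym (E-srˡ-off w (λ x → r (trans (sym p) x)))) (0≤* (ℤP.<⇒≤ (0<d i)) (w≥0 i))

    nonneg-τ≡t : ∀ s v → IsNonneg v → τ A ε s v ≡ t A ε s v
    nonneg-τ≡t s v p = τ≡t s v (λ j _ → p j)

    Compat-neg-sr : ∀ {u} i → u ! i ≤ 0ℤ → Compat u (negv (sr i))
    Compat-neg-sr {u} i p = compat (λ j _ → neg-sr-nonpos i j)
      (λ j q → subst (λ k → u ! k ≤ 0ℤ) (sym (neg-sr-negative {i = i} q)) p) (λ _ q → ⊥-elim (¬nonneg-neg-sr i q))

    Compat-nonneg : ∀ {u v} → IsNonneg u → IsNonneg v → (∀ s → 0ℤ ≤ E s u v) → Compat u v
    Compat-nonneg p q e = compat (λ j r → ⊥-elim (0≤-<0 (p j) r)) (λ j r → ⊥-elim (0≤-<0 (q j) r)) (λ _ _ → e)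

  -- The Euler pairing of a simple root of colour `s` with w is d_i times w_i in one orientation and
  -- minus d_i times the i-th coordinate of `t s w` in the other. So when α_i and its negative are
  -- exchanged by the step, a sign condition at the vertex i turns into an Euler condition and back.
  Compat-τ : ∀ s {u v} → AP u → AP v → Compat u v → Compat (τ A ε s u) (τ A ε s v)
  Compat-τ s au av c = go (view s au) (view s av) c
    where
    stay-other : ∀ {u v} → IsNonneg u → IsNonneg (τ A ε s u) → View s v → Compat u v → Compat (τ A ε s u) (τ A ε s v)
    stay-other {u} {v} p p′ (stay q _ q′ _) (compat _ _ e) = Compat-nonneg p′ q′ (subst₂ (λ x y → ∀ s′ → 0ℤ ≤ E s′ x y)
        (sym (nonneg-τ≡t s u p)) (sym (nonneg-τ≡t s v q)) e′)
      where
      -- Reflection exchanges the two orientations, so nonnegativity is preserved only as a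
      -- condition on both of them.
      e′ : ∀ s′ → 0ℤ ≤ E s′ (t A ε s u) (t A ε s v)
      e′ s′ with s′ SignP.≟ s
      ... | yes refl = subst (0ℤ ≤_) (trans (E-swap s u v) (sym (E-t s u v))) (e p q (opposite s))
      ... | no r = subst (0ℤ ≤_) (trans (sym (E-t s v u)) (trans (sym (E-swap s (t A ε s u) (t A ε s v)))
                     (cong (λ x → E x (t A ε s u) (t A ε s v)) (sym (≢⇒opposite r))))) (e p q s)
    stay-other {u} p p′ (down i r) (compat _ _ e) = subst (Compat (τ A ε s u)) (sym (τ-sr-on r))
      (Compat-neg-sr i (subst (λ x → x ! i ≤ 0ℤ) (sym (nonneg-τ≡t s u p)) (0≤⇒- (0≤*⇒0≤ʳ (0<d i)
        (subst (0ℤ ≤_) (trans (E-swap s u (sr i)) (E-srˡ-on u r)) (e p (sr-nonneg i) (opposite s)))))))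
    stay-other {u} p p′ (up i r) (compat _ c₂ _) = subst (Compat (τ A ε s u)) (sym (τ-neg-sr-on r))
      (Compat-sym (Compat-nonneg (sr-nonneg i) p′ (E-simple-nonneg (τ A ε s u) r p′
        (subst (λ x → x ! i ≤ 0ℤ) (sym (trans (sym (nonneg-τ≡t s (τ A ε s u) p′)) (τ-involutive s u)))
          (c₂ i (subst (_< 0ℤ) (sym (neg-sr-same i)) -<+))))))
    stay-other {u} p p′ (fixed i r) (compat _ c₂ _) = subst (Compat (τ A ε s u)) (sym (τ-neg-sr-off r))
      (Compat-neg-sr i (subst (_≤ 0ℤ) (sym (τ-off A ε u r)) (c₂ i (subst (_< 0ℤ) (sym (neg-sr-same i)) -<+))))

    down-other : ∀ {v} i → ε i ≡ s → View s v → Compat (sr i) v → Compat (τ A ε s (sr i)) (τ A ε s v)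
    down-other i r (stay q _ q′ _) c = Compat-sym (stay-other q q′ (down i r) (Compat-sym c))
    down-other i r (down k r′) _ = subst₂ Compat (sym (τ-sr-on r)) (sym (τ-sr-on r′)) (Compat-neg-sr k (neg-sr-nonpos i k))
    down-other i r (up k r′) (compat _ c₂ _) = subst₂ Compat (sym (τ-sr-on r)) (sym (τ-neg-sr-on r′))
      (Compat-sym (Compat-neg-sr i (ℤP.≤-reflexive (sr-diff i≢k))))
      where
      i≢k : i ≢ k
      i≢k refl with subst (_≤ 0ℤ) (sr-same i) (c₂ i (subst (_< 0ℤ) (sym (neg-sr-same i)) -<+))
      ... | +≤+ ()
    down-other i r (fixed k r′) _ = subst₂ Compat (sym (τ-sr-on r)) (sym (τ-neg-sr-off r′)) (Compat-neg-sr k (neg-sr-nonpos i k))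

    up-other : ∀ {v} i → ε i ≡ s → View s v → Compat (negv (sr i)) v → Compat (τ A ε s (negv (sr i))) (τ A ε s v)
    up-other i r (stay q _ q′ _) c = Compat-sym (stay-other q q′ (up i r) (Compat-sym c))
    up-other i r (down k r′) c = Compat-sym (down-other k r′ (up i r) (Compat-sym c))
    up-other i r (up k r′) _ = subst₂ Compat (sym (τ-neg-sr-on r)) (sym (τ-neg-sr-on r′))
      (Compat-nonneg (sr-nonneg i) (sr-nonneg k) (E-simple-nonneg (sr k) r (sr-nonneg k)
        (subst (λ x → x ! i ≤ 0ℤ) (trans (sym (τ-sr-on r′)) (nonneg-τ≡t s (sr k) (sr-nonneg k))) (neg-sr-nonpos k i))))
    up-other i r (fixed k r′) _ = subst₂ Compat (sym (τ-neg-sr-on r)) (sym (τ-neg-sr-off r′))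
      (Compat-neg-sr k (ℤP.≤-reflexive (sr-diff {i = i} {k} (λ { refl → r′ r }))))

    go : ∀ {u v} → View s u → View s v → Compat u v → Compat (τ A ε s u) (τ A ε s v)
    go (stay p _ p′ _) y c = stay-other p p′ y c
    go (down i r) y c = down-other i r y c
    go (up i r) y c = up-other i r y c
    go x@(fixed i r) (stay q _ q′ _) c = Compat-sym (stay-other q q′ x (Compat-sym c))
    go x@(fixed i r) (down k r′) c = Compat-sym (down-other k r′ x (Compat-sym c))
    go x@(fixed i r) (up k r′) c = Compat-sym (up-other k r′ x (Compat-sym c))
    go (fixed i r) (fixed k r′) c = subst₂ Compat (sym (τ-neg-sr-off r)) (sym (τ-neg-sr-off r′)) c

-- Leaving the positive cone

module Hitting {n} {ε : Fin n → Sign} {d w : Fin n → ℤ} {A : Matrix n} (S : System ε d w A) where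
  open System S
  open SystemProperties S
  open AlmostPositive S

  weight : Sign → Lat n → ℤ
  weight s v = ∑ (λ i → χ A ε s i * (w i * v ! i))

  private
    drop : Sign → Lat n → Fin n → ℤ
    drop s v j = χ A ε (opposite s) j * (v ! j * (+ 2 * w j + ∑ (λ i → w i * off A i j)))

    0≤χ : ∀ s i → 0ℤ ≤ χ A ε s i
    0≤χ s i with ε i SignP.≟ s
    ... | yes _ = +≤+ z≤n
    ... | no _ = +≤+ z≤n

    weight-other : ∀ s v → weight (opposite s) (τ A ε s v) ≡ weight (opposite s) v
    weight-other s v = ∑-cong term
      where
      term : ∀ i → χ A ε (opposite s) i * (w i * τ A ε s v ! i) ≡ χ A ε (opposite s) i * (w i * v ! i)
      term i with ε i SignP.≟ opposite s
      ... | yes p = cong (λ x → 1ℤ * (w i * x)) (τ-off A ε v (λ q → opposite-≢ s (trans (sym p) q)))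
      ... | no _ = trans (ℤP.*-zeroˡ (w i * τ A ε s v ! i)) (sym (ℤP.*-zeroˡ (w i * v ! i)))

    -- A second difference: the weight of colour `s` is the older time slice, that of the opposite
    -- colour the current one, and `τ s` replaces the older by the next. Dominance of `w` makes the
    -- correction `drop` nonnegative.
    weight-step : ∀ s v → IsNonneg v →
      weight s (τ A ε s v) + weight s v ≡ + 2 * weight (opposite s) v - ∑ (drop s v)
    weight-step s v v≥0 = begin
      weight s (τ A ε s v) + weight s v
        ≡⟨ ∑-+ (λ i → χ A ε s i * (w i * τ A ε s v ! i)) (λ i → χ A ε s i * (w i * v ! i)) ⟨
      ∑ (λ i → χ A ε s i * (w i * τ A ε s v ! i) + χ A ε s i * (w i * v ! i))
        ≡⟨ ∑-cong flow ⟩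
      ∑ (λ i → ∑ (λ j → - (χ A ε (opposite s) j * (v ! j * (w i * off A i j)))))
        ≡⟨ ∑-swap (λ i j → - (χ A ε (opposite s) j * (v ! j * (w i * off A i j)))) ⟩
      ∑ (λ j → ∑ (λ i → - (χ A ε (opposite s) j * (v ! j * (w i * off A i j)))))
        ≡⟨ ∑-cong collect ⟩
      ∑ (λ j → + 2 * (χ A ε (opposite s) j * (w j * v ! j)) + - drop s v j)
        ≡⟨ ∑-+ (λ j → + 2 * (χ A ε (opposite s) j * (w j * v ! j))) (λ j → - drop s v j) ⟩
      ∑ (λ j → + 2 * (χ A ε (opposite s) j * (w j * v ! j))) + ∑ (λ j → - drop s v j)
        ≡⟨ cong₂ _+_ (∑-*ˡ (+ 2) (λ j → χ A ε (opposite s) j * (w j * v ! j))) (∑-neg (drop s v)) ⟩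
      + 2 * weight (opposite s) v - ∑ (drop s v) ∎
      where
      open ≡-Reasoning
      edge : ∀ i j → χ A ε s i * off A i j ≡ χ A ε (opposite s) j * off A i j
      edge i j with ε i SignP.≟ ε j
      ... | yes p rewrite off-colour i j p = trans (ℤP.*-zeroʳ (χ A ε s i)) (sym (ℤP.*-zeroʳ (χ A ε (opposite s) j)))
      ... | no p = cong (_* off A i j) χχ
        where
        χχ : χ A ε s i ≡ χ A ε (opposite s) j
        χχ with ε i SignP.≟ s
        ... | yes q = sym (χ-on A ε (trans (≢⇒opposite (λ r → p (sym r))) (cong opposite q)))
        ... | no q = sym (χ-off A ε (λ r → p (trans (≢⇒opposite q) (sym r))))
      flow : ∀ i → χ A ε s i * (w i * τ A ε s v ! i) + χ A ε s i * (w i * v ! i) ≡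
        ∑ (λ j → - (χ A ε (opposite s) j * (v ! j * (w i * off A i j))))
      flow i = trans here′ (trans (sym (∑-*ˡ (- (χ A ε s i * w i)) (λ j → off A i j * v ! j))) (∑-cong term))
        where
        lem₁ : ∀ a x y → 1ℤ * (a * (- x - y)) + 1ℤ * (a * x) ≡ - (1ℤ * a) * y
        lem₁ = solve-∀
        lem₂ : ∀ a b c e → 0ℤ * (a * b) + 0ℤ * (a * c) ≡ - (0ℤ * a) * e
        lem₂ = solve-∀
        here′ : χ A ε s i * (w i * τ A ε s v ! i) + χ A ε s i * (w i * v ! i) ≡ - (χ A ε s i * w i) * offSum A v i
        here′ with ε i SignP.≟ s
        ... | yes p rewrite τ≡t s v (λ j _ → v≥0 j) | t-on A ε v p = lem₁ (w i) (v ! i) (offSum A v i)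
        ... | no p = lem₂ (w i) (τ A ε s v ! i) (v ! i) (offSum A v i)
        lem₃ : ∀ c a o x → - (c * a) * (o * x) ≡ - (c * o * (a * x))
        lem₃ = solve-∀
        lem₄ : ∀ c a o x → - (c * o * (a * x)) ≡ - (c * (x * (a * o)))
        lem₄ = solve-∀
        term : ∀ j → - (χ A ε s i * w i) * (off A i j * v ! j) ≡ - (χ A ε (opposite s) j * (v ! j * (w i * off A i j)))
        term j = trans (lem₃ (χ A ε s i) (w i) (off A i j) (v ! j)) (trans
          (cong (λ x → - (x * (w i * v ! j))) (edge i j)) (lem₄ (χ A ε (opposite s) j) (w i) (off A i j) (v ! j)))
      collect : ∀ j → ∑ (λ i → - (χ A ε (opposite s) j * (v ! j * (w i * off A i j)))) ≡
        + 2 * (χ A ε (opposite s) j * (w j * v ! j)) + - drop s v j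
      collect j = trans (∑-cong (λ i → lem₁ (χ A ε (opposite s) j) (v ! j) (w i * off A i j)))
        (trans (∑-*ˡ (- (χ A ε (opposite s) j * v ! j)) (λ i → w i * off A i j))
          (lem₂ (χ A ε (opposite s) j) (v ! j) (w j) (∑ (λ i → w i * off A i j))))
        where
        lem₁ : ∀ c x y → - (c * (x * y)) ≡ - (c * x) * y
        lem₁ = solve-∀
        lem₂ : ∀ c x a y → - (c * x) * y ≡ + 2 * (c * (a * x)) + - (c * (x * (+ 2 * a + y)))
        lem₂ c x a y = lem₃ c x a y (+ 2)
          where
          lem₃ : ∀ c x a y k → - (c * x) * y ≡ k * (c * (a * x)) + - (c * (x * (k * a + y)))
          lem₃ = solve-∀

    drop-nonneg : ∀ s v → IsNonneg v → ∀ j → 0ℤ ≤ drop s v j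
    drop-nonneg s v v≥0 j = 0≤* (0≤χ (opposite s) j) (0≤* (v≥0 j) (ℤP.<⇒≤ (w-dominant j)))

    weight-nonneg : ∀ s v → IsNonneg v → 0ℤ ≤ weight s v
    weight-nonneg s v v≥0 = ∑-nonneg (λ j → 0≤* (0≤χ s j) (0≤* (ℤP.<⇒≤ (0<w j)) (v≥0 j)))

    drop-pos : ∀ s v → IsNonneg v → 0ℤ < weight (opposite s) v → 0ℤ < ∑ (drop s v)
    drop-pos s v v≥0 p with ∑-pos⇒∃ p
    ... | j , q = ∑-pos (drop-nonneg s v v≥0) j (go q)
      where
      go : 0ℤ < χ A ε (opposite s) j * (w j * v ! j) → 0ℤ < drop s v j
      go r with ε j SignP.≟ opposite s
      ... | yes _ = 0<* {1ℤ} (+<+ (s≤s z≤n)) (0<* (0<*⇒0<ʳ (0<w j) (0<*⇒0<ʳ {1ℤ} (+<+ (s≤s z≤n)) r)) (w-dominant j))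
      ... | no _ = ⊥-elim (ℤP.<-irrefl (sym (ℤP.*-zeroˡ (w j * v ! j))) r)

    rearrange : ∀ x a b e → x + a ≡ + 2 * b - e → (b - a) - (x - b) ≡ e
    rearrange x a b e p = trans (lem x a b) (trans (cong (λ y → + 2 * b - y) p) (lem₂ (+ 2 * b) e))
      where
      lem : ∀ x a b → (b - a) - (x - b) ≡ (1ℤ + 1ℤ) * b - (x + a)
      lem = solve-∀
      lem₂ : ∀ b e → b - (b - e) ≡ e
      lem₂ = solve-∀

    weight-step-≤ : ∀ s v → IsNonneg v →
      weight s (τ A ε s v) - weight (opposite s) v ≤ weight (opposite s) v - weight s v
    weight-step-≤ s v v≥0 = ≤-byDiff (∑-nonneg (drop-nonneg s v v≥0))
      (rearrange (weight s (τ A ε s v)) (weight s v) (weight (opposite s) v) (∑ (drop s v)) (weight-step s v v≥0))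

    weight-step-< : ∀ s v → IsNonneg v → 0ℤ < weight (opposite s) v →
      weight s (τ A ε s v) - weight (opposite s) v < weight (opposite s) v - weight s v
    weight-step-< s v v≥0 p = <-byDiff (drop-pos s v v≥0 p)
      (rearrange (weight s (τ A ε s v)) (weight s v) (weight (opposite s) v) (∑ (drop s v)) (weight-step s v v≥0))

  -- The trace of an alternating run up to its first negative coordinate. As an inductive family it
  -- supports recursion along the orbit, for instance to pull data back step by step.
  data Hit : Sign → Lat n → Set where
    here : ∀ {s v} i → v ! i < 0ℤ → Hit s v
    there : ∀ {s v} → IsNonneg v → Hit (opposite s) (τ A ε s v) → Hit s v

  private
    weight-next : ∀ s v → weight (opposite (opposite s)) (τ A ε s v) ≡ weight s (τ A ε s v)
    weight-next s v = cong (λ x → weight x (τ A ε s v)) (opposite² s)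

    -- Once the weights have begun to fall, concavity keeps every later difference negative. The
    -- current weight, bounded by `m`, therefore drops strictly and cannot stay nonnegative for more
    -- than `m` steps.
    descend : ∀ m s v → IsNonneg v → weight (opposite s) v < weight s v → weight (opposite s) v ≤ + m → Hit s v
    descend m s v v≥0 b<a b≤m with Nonneg? (τ A ε s v)
    ... | inj₂ (i , p) = there v≥0 (here i p)
    ... | inj₁ q = there v≥0 (go m b≤m)
      where
      b′<b : weight s (τ A ε s v) < weight (opposite s) v
      b′<b = -<0⇒< (ℤP.≤-<-trans (weight-step-≤ s v v≥0) (<⇒-<0 b<a))
      go : ∀ m → weight (opposite s) v ≤ + m → Hit (opposite s) (τ A ε s v)
      go zero b≤0 = ⊥-elim (0≤-<0 (weight-nonneg s (τ A ε s v) q) (ℤP.<-≤-trans b′<b b≤0))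
      go (suc m) b≤m = descend m (opposite s) (τ A ε s v) q
        (subst₂ _<_ (sym (weight-next s v)) (sym (weight-other s v)) b′<b)
        (subst (_≤ + m) (sym (weight-next s v)) (ℤP.i<j⇒i≤pred[j] (ℤP.<-≤-trans b′<b b≤m)))

    -- While the weights do not fall, the current weight is positive and the difference of
    -- consecutive weights, bounded by `m`, decreases strictly. From a difference of at most 0 one
    -- more step makes it negative, and `descend` takes over.
    climb : ∀ m s v → IsNonneg v → 0ℤ < weight s v ⊎ 0ℤ < weight (opposite s) v →
      weight (opposite s) v - weight s v ≤ + m → Hit s v
    climb m s v v≥0 nz bound with weight (opposite s) v ℤ.<? weight s v
    ... | yes b<a = descend ∣ weight (opposite s) v ∣ s v v≥0 b<a
            (ℤP.≤-reflexive (sym (ℤP.0≤i⇒+∣i∣≡i (weight-nonneg (opposite s) v v≥0))))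
    ... | no b≮a with Nonneg? (τ A ε s v)
    ...   | inj₂ (i , p) = there v≥0 (here i p)
    ...   | inj₁ q = there v≥0 (go m bound)
      where
      0<b : 0ℤ < weight (opposite s) v
      0<b = [ (λ p → ℤP.<-≤-trans p (ℤP.≮⇒≥ b≮a)) , id ]′ nz
      go : ∀ m → weight (opposite s) v - weight s v ≤ + m → Hit (opposite s) (τ A ε s v)
      go zero bd = descend ∣ weight s (τ A ε s v) ∣ (opposite s) (τ A ε s v) q
        (subst₂ _<_ (sym (weight-next s v)) (sym (weight-other s v))
          (-<0⇒< (ℤP.<-≤-trans (weight-step-< s v v≥0 0<b) bd)))
        (ℤP.≤-reflexive (trans (weight-next s v) (sym (ℤP.0≤i⇒+∣i∣≡i (weight-nonneg s (τ A ε s v) q)))))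
      go (suc m) bd = climb m (opposite s) (τ A ε s v) q
        (inj₁ (subst (0ℤ <_) (sym (weight-other s v)) 0<b))
        (subst (_≤ + m) (sym (cong₂ _-_ (weight-next s v) (weight-other s v)))
          (ℤP.i<j⇒i≤pred[j] (ℤP.<-≤-trans (weight-step-< s v v≥0 0<b) bd)))

  -- The weight of successive time slices is a strictly concave integer sequence
  -- as long as all coordinates stay nonnegative.
  hit : ∀ s v → IsNonneg v → v ≢ 0v → Hit s v
  hit s v v≥0 v≢0 = climb ∣ weight (opposite s) v - weight s v ∣ s v v≥0 nz (i≤∣i∣ (weight (opposite s) v - weight s v))
    where
    i≤∣i∣ : ∀ x → x ≤ + ∣ x ∣
    i≤∣i∣ (+ _) = ℤP.≤-refl
    i≤∣i∣ -[1+ _ ] = -≤+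
    pos-at : ∀ r i → ε i ≡ r → 0ℤ < v ! i → 0ℤ < weight r v
    pos-at r i p q = ∑-pos (λ j → 0≤* (0≤χ r j) (0≤* (ℤP.<⇒≤ (0<w j)) (v≥0 j))) i
      (subst (λ x → 0ℤ < x * (w i * v ! i)) (sym (χ-on A ε p)) (0<* {1ℤ} (+<+ (s≤s z≤n)) (0<* (0<w i) q)))
    nz : 0ℤ < weight s v ⊎ 0ℤ < weight (opposite s) v
    nz with nonneg-≢0 {v = v} v≥0 v≢0
    ... | i , q with ε i SignP.≟ s
    ...   | yes p = inj₁ (pos-at s i p q)
    ...   | no p = inj₂ (pos-at (opposite s) i (≢⇒opposite p) q)

-- Cluster expansions

≡-or-≢ : ∀ {n} (i j : Fin n) → i ≡ j ⊎ i ≢ j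
≡-or-≢ i j with i Fin.≟ j
... | yes p = inj₁ p
... | no p = inj₂ p

-- The parabolic subsystem without `j`, realised by cutting the edges at `j` instead of removing the
-- index: vectors keep their length, and `d`, `w` and `ε` stay the same.
isolate : ∀ {n} → Fin n → Matrix n → Matrix n
isolate j A i k = if ⌊ i Fin.≟ j ⌋ then 0ℤ else if ⌊ k Fin.≟ j ⌋ then 0ℤ else A i k

module _ {n} (A : Matrix n) (j : Fin n) where

  off-isolate-row : ∀ k → off (isolate j A) j k ≡ 0ℤ
  off-isolate-row k with k Fin.≟ j
  ... | yes _ = refl
  ... | no _ with j Fin.≟ j
  ...   | yes _ = refl
  ...   | no p = ⊥-elim (p refl)

  off-isolate-col : ∀ i → off (isolate j A) i j ≡ 0ℤ
  off-isolate-col i with j Fin.≟ i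
  ... | yes _ = refl
  ... | no _ with i Fin.≟ j | j Fin.≟ j
  ...   | yes _ | _ = refl
  ...   | no _ | yes _ = refl
  ...   | no _ | no p = ⊥-elim (p refl)

  off-isolate : ∀ {i k} → i ≢ j → k ≢ j → off (isolate j A) i k ≡ off A i k
  off-isolate {i} {k} p q with k Fin.≟ i
  ... | yes _ = refl
  ... | no _ with i Fin.≟ j | k Fin.≟ j
  ...   | yes r | _ = ⊥-elim (p r)
  ...   | no _ | yes r = ⊥-elim (q r)
  ...   | no _ | no _ = refl

erase : ∀ {n} → Fin n → Lat n → Lat n
erase j v = tabulate (λ k → if ⌊ k Fin.≟ j ⌋ then 0ℤ else v ! k)

erase-same : ∀ {n} (j : Fin n) v → erase j v ! j ≡ 0ℤ
erase-same j v = trans (VecP.lookup∘tabulate _ j) lem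
  where
  lem : (if ⌊ j Fin.≟ j ⌋ then 0ℤ else v ! j) ≡ 0ℤ
  lem with j Fin.≟ j
  ... | yes _ = refl
  ... | no p = ⊥-elim (p refl)

erase-diff : ∀ {n} (j : Fin n) v {k} → k ≢ j → erase j v ! k ≡ v ! k
erase-diff j v {k} p = trans (VecP.lookup∘tabulate _ k) lem
  where
  lem : (if ⌊ k Fin.≟ j ⌋ then 0ℤ else v ! k) ≡ v ! k
  lem with k Fin.≟ j
  ... | yes q = ⊥-elim (p q)
  ... | no _ = refl

module Isolation {n} {ε : Fin n → Sign} {d w : Fin n → ℤ} {A : Matrix n} (S : System ε d w A) (j : Fin n) where
  open System S
  open SystemProperties S using (E)

  private
    A′ : Matrix n
    A′ = isolate j A

    off-case : ∀ i k → off A′ i k ≡ 0ℤ ⊎ off A′ i k ≡ off A i k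
    off-case i k with ≡-or-≢ i j | ≡-or-≢ k j
    ... | inj₁ refl | _ = inj₁ (off-isolate-row A j k)
    ... | inj₂ _ | inj₁ refl = inj₁ (off-isolate-col A j i)
    ... | inj₂ p | inj₂ q = inj₂ (off-isolate A j p q)

    offSum-isolate : ∀ {i} v → i ≢ j → offSum A′ v i ≡ offSum A (erase j v) i
    offSum-isolate {i} v p = ∑-cong term
      where
      term : ∀ k → off A′ i k * v ! k ≡ off A i k * erase j v ! k
      term k with ≡-or-≢ k j
      ... | inj₁ refl rewrite off-isolate-col A j i | erase-same j v = trans (ℤP.*-zeroˡ (v ! j)) (sym (ℤP.*-zeroʳ (off A i j)))
      ... | inj₂ q rewrite off-isolate A j p q | erase-diff j v q = refl

    erase-id : ∀ v → v ! j ≡ 0ℤ → erase j v ≡ v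
    erase-id v p = lat-ext go
      where
      go : ∀ k → erase j v ! k ≡ v ! k
      go k with ≡-or-≢ k j
      ... | inj₁ refl = trans (erase-same j v) (sym p)
      ... | inj₂ q = erase-diff j v q

  euler-isolate : ∀ s {u v} → u ! j ≡ 0ℤ → v ! j ≡ 0ℤ → euler A′ ε d s u v ≡ E s u v
  euler-isolate s {u} {v} p q = ∑-cong term
    where
    term : ∀ i → d i * u ! i * (v ! i + χ A′ ε s i * offSum A′ v i) ≡ d i * u ! i * (v ! i + χ A ε s i * offSum A v i)
    term i with ≡-or-≢ i j
    ... | inj₁ refl rewrite p = lem (d i) (v ! i + χ A′ ε s i * offSum A′ v i) (v ! i + χ A ε s i * offSum A v i)
      where
      lem : ∀ a b c → a * 0ℤ * b ≡ a * 0ℤ * c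
      lem = solve-∀
    ... | inj₂ r = cong (λ x → d i * u ! i * (v ! i + χ A ε s i * x))
            (trans (offSum-isolate v r) (cong (λ x → offSum A x i) (erase-id v q)))

  private
    -- After the cut, `j` spans an orthogonal summand of rank one.
    euler-split : ∀ v → euler A′ ε d Sign.+ v v ≡ E Sign.+ (erase j v) (erase j v) + d j * (v ! j * v ! j)
    euler-split v = trans (∑-cong term) (trans (∑-+ (λ i → d i * erase j v ! i * (erase j v ! i + χ A ε Sign.+ i * offSum A (erase j v) i)) extra)
      (cong (_+_ (E Sign.+ (erase j v) (erase j v))) (trans (∑-single j (λ i p → trans (cong (_* c) (δ-diff p)) (ℤP.*-zeroˡ c)))
        (trans (cong (_* c) (δ-same j)) (ℤP.*-identityˡ c)))))
      where
      c : ℤ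
      c = d j * (v ! j * v ! j)
      extra : Fin n → ℤ
      extra i = δ j i * c
      term : ∀ i → d i * v ! i * (v ! i + χ A′ ε Sign.+ i * offSum A′ v i) ≡
        d i * erase j v ! i * (erase j v ! i + χ A ε Sign.+ i * offSum A (erase j v) i) + extra i
      term i with ≡-or-≢ i j
      ... | inj₁ refl rewrite erase-same j v | δ-same j =
              trans (cong (λ x → d i * v ! i * (v ! i + χ A′ ε Sign.+ i * x))
                      (∑-zero (λ k → trans (cong (_* v ! k) (off-isolate-row A j k)) (ℤP.*-zeroˡ (v ! k)))))
                    (lem (d i) (v ! i) (χ A′ ε Sign.+ i) (0ℤ + χ A ε Sign.+ i * offSum A (erase j v) i))
        where
        lem : ∀ a x b y → a * x * (x + b * 0ℤ) ≡ a * 0ℤ * y + 1ℤ * (a * (x * x))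
        lem = solve-∀
      ... | inj₂ p rewrite erase-diff j v p | δ-diff p = trans
              (cong (λ x → d i * v ! i * (v ! i + χ A ε Sign.+ i * x)) (offSum-isolate v p))
              (lem (d i * v ! i * (v ! i + χ A ε Sign.+ i * offSum A (erase j v) i)) c)
        where
        lem : ∀ a c → a ≡ a + 0ℤ * c
        lem = solve-∀

  -- Cutting edges replaces nonpositive entries by zero, so the column sums for the same `w` can
  -- only grow and dominance persists. Positivity follows from the orthogonal splitting.
  isolate-system : System ε d w A′
  isolate-system = record
    { 0<d = 0<d
    ; off-sym = sym′
    ; off-nonpos = λ i k → nonpos i k (off-case i k)
    ; off-colour = λ i k p → colour i k p (off-case i k)
    ; euler-pos = pos′
    ; 0<w = 0<w
    ; w-dominant = λ k → ℤP.<-≤-trans (w-dominant k) (ℤP.+-monoʳ-≤ (+ 2 * w k) (∑-mono (λ i → mono i k (off-case i k))))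
    }
    where
    sym′ : ∀ i k → d i * off A′ i k ≡ d k * off A′ k i
    sym′ i k with ≡-or-≢ i j | ≡-or-≢ k j
    ... | inj₁ refl | _ rewrite off-isolate-row A j k | off-isolate-col A j k = trans (ℤP.*-zeroʳ (d i)) (sym (ℤP.*-zeroʳ (d k)))
    ... | inj₂ _ | inj₁ refl rewrite off-isolate-row A j i | off-isolate-col A j i = trans (ℤP.*-zeroʳ (d i)) (sym (ℤP.*-zeroʳ (d k)))
    ... | inj₂ p | inj₂ q rewrite off-isolate A j p q | off-isolate A j q p = off-sym i k
    nonpos : ∀ i k → off A′ i k ≡ 0ℤ ⊎ off A′ i k ≡ off A i k → off A′ i k ≤ 0ℤ
    nonpos i k (inj₁ p) = ℤP.≤-reflexive p
    nonpos i k (inj₂ p) = subst (_≤ 0ℤ) (sym p) (off-nonpos i k)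
    colour : ∀ i k → ε i ≡ ε k → off A′ i k ≡ 0ℤ ⊎ off A′ i k ≡ off A i k → off A′ i k ≡ 0ℤ
    colour i k _ (inj₁ p) = p
    colour i k q (inj₂ p) = trans p (off-colour i k q)
    mono : ∀ i k → off A′ i k ≡ 0ℤ ⊎ off A′ i k ≡ off A i k → w i * off A i k ≤ w i * off A′ i k
    mono i k (inj₁ p) rewrite p = ℤP.*-monoˡ-≤-nonNeg (w i) {{ℤ.nonNegative (ℤP.<⇒≤ (0<w i))}} (off-nonpos i k)
    mono i k (inj₂ p) rewrite p = ℤP.≤-refl
    pos′ : ∀ v → v ≢ 0v → 0ℤ < euler A′ ε d Sign.+ v v
    pos′ v p = subst (0ℤ <_) (sym (euler-split v)) (go (erase j v ≟v 0v) (v ! j ℤ.≟ 0ℤ))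
      where
      0≤c : 0ℤ ≤ d j * (v ! j * v ! j)
      0≤c = 0≤* (ℤP.<⇒≤ (0<d j)) (0≤square (v ! j))
      0<sq : ∀ x → x ≢ 0ℤ → 0ℤ < x * x
      0<sq x q = ℤP.≤∧≢⇒< (0≤square x) (λ e → [ q , q ]′ (ℤP.i*j≡0⇒i≡0∨j≡0 x (sym e)))
      go : Dec (erase j v ≡ 0v) → Dec (v ! j ≡ 0ℤ) → 0ℤ < E Sign.+ (erase j v) (erase j v) + d j * (v ! j * v ! j)
      go (no q) _ = 0<+ˡ (euler-pos (erase j v) q) 0≤c
      go (yes q) (yes r) = ⊥-elim (p (trans (sym (erase-id v r)) q))
      go (yes q) (no r) = subst (λ u → 0ℤ < E Sign.+ u u + d j * (v ! j * v ! j)) (sym q)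
        (0<+ʳ (ℤP.≤-reflexive (sym (∑-zero (λ i → trans
          (cong (λ x → d i * x * (0v {n} ! i + χ A ε Sign.+ i * offSum A 0v i)) (!-0 i))
          (lem (d i) (0v {n} ! i + χ A ε Sign.+ i * offSum A 0v i)))))) (0<* (0<d j) (0<sq (v ! j) r)))
        where
        lem : ∀ a b → a * 0ℤ * b ≡ 0ℤ
        lem = solve-∀

sumv : ∀ {n} → List (Lat n) → Lat n
sumv = List.foldr _+v_ 0v

module Expansions {n} {ε : Fin n → Sign} {d w : Fin n → ℤ} where

  module _ {A : Matrix n} (S : System ε d w A) where
    open System S
    open SystemProperties S
    open AlmostPositive S

    -- Multiplicities are repetitions in the list, so a repeated root is also required to be
    -- compatible with itself. The subset `p` confines the supports, which is what shows that roots
    -- found after isolating a vertex vanish there.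
    record Expansion (p : Subset n) (v : Lat n) : Set where
      constructor expansion
      field
        roots : List (Lat n)
        almost-positive : All AP roots
        compatible : AllPairs Compat roots
        support : All (λ ρ → ∀ i → i ∉ p → ρ ! i ≡ 0ℤ) roots
        total : sumv roots ≡ v

    τ-0v : ∀ s → τ A ε s 0v ≡ 0v
    τ-0v s = lat-ext go
      where
      go : ∀ i → τ A ε s 0v ! i ≡ 0v ! i
      go i with ε i SignP.≟ s
      ... | no p = τ-off A ε 0v p
      ... | yes p = trans (τ-on A ε 0v p) (trans (cong₂ (λ x y → - x - y) (!-0 i)
              (∑-zero (λ j → trans (cong (λ x → off A i j * (x ⊔ 0ℤ)) (!-0 j)) (ℤP.*-zeroʳ (off A i j))))) (sym (!-0 i)))

    private
      sum-nonneg : ∀ {u} L j → All (Compat u) L → 0ℤ < u ! j → 0ℤ ≤ sumv L ! j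
      sum-nonneg [] j [] p = ℤP.≤-reflexive (sym (!-0 j))
      sum-nonneg (x ∷ L) j (c ∷ cs) p = subst (0ℤ ≤_) (sym (!-+ x (sumv L) j))
        (0≤+ (ℤP.≮⇒≥ (λ q → ℤP.<⇒≱ p (Compat.neg-right c j q))) (sum-nonneg L j cs p))

      sum-nonpos : ∀ {u} L j → All (Compat u) L → u ! j < 0ℤ → sumv L ! j ≤ 0ℤ
      sum-nonpos [] j [] p = ℤP.≤-reflexive (!-0 j)
      sum-nonpos (x ∷ L) j (c ∷ cs) p = subst (_≤ 0ℤ) (sym (!-+ x (sumv L) j))
        (ℤP.+-mono-≤ (Compat.neg-left c j p) (sum-nonpos L j cs p))

    -- Compatible vectors never have opposite signs in a coordinate, so positive parts add up over
    -- the list.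
    τ-sumv : ∀ s {L} → AllPairs Compat L → τ A ε s (sumv L) ≡ sumv (List.map (τ A ε s) L)
    τ-sumv s [] = τ-0v s
    τ-sumv s {x ∷ L} (c ∷ cs) = trans
      (τ-+ s x (sumv L) (λ j _ → ⊔0-+ (x ! j) (sumv L ! j) (sum-nonneg L j c) (sum-nonpos L j c)))
      (cong (τ A ε s x +v_) (τ-sumv s cs))

    All-AP-τ : ∀ s {L} → All AP L → All AP (List.map (τ A ε s) L)
    All-AP-τ s [] = []
    All-AP-τ s (a ∷ as) = AP-τ s a ∷ All-AP-τ s as

    AllPairs-Compat-τ : ∀ s {L} → All AP L → AllPairs Compat L → AllPairs Compat (List.map (τ A ε s) L)
    AllPairs-Compat-τ s [] [] = []
    AllPairs-Compat-τ s (a ∷ as) (c ∷ cs) = go as c ∷ AllPairs-Compat-τ s as cs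
      where
      go : ∀ {L} → All AP L → All (Compat _) L → All (Compat _) (List.map (τ A ε s) L)
      go [] [] = []
      go (b ∷ bs) (c ∷ cs) = Compat-τ s a b c ∷ go bs cs

    -- No vertex outside `p` receives anything from its neighbours, so `τ` cannot create a
    -- coordinate there.
    Rows : Subset n → Set
    Rows p = ∀ i → i ∉ p → ∀ k → off A i k ≡ 0ℤ

    support-τ : ∀ s {p v} → Rows p → (∀ i → i ∉ p → v ! i ≡ 0ℤ) → ∀ i → i ∉ p → τ A ε s v ! i ≡ 0ℤ
    support-τ s {v = v} rows z i i∉p with ε i SignP.≟ s
    ... | no q = trans (τ-off A ε v q) (z i i∉p)
    ... | yes q = trans (τ-on A ε v q) (cong₂ (λ x y → - x - y) (z i i∉p)
            (∑-zero (λ j → trans (cong (_* (v ! j ⊔ 0ℤ)) (rows i i∉p j)) (ℤP.*-zeroˡ (v ! j ⊔ 0ℤ)))))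

    Expansion-τ : ∀ s {p v} → Rows p → Expansion p v → Expansion p (τ A ε s v)
    Expansion-τ s {p} rows (expansion L a c z refl) = expansion (List.map (τ A ε s) L) (All-AP-τ s a)
      (AllPairs-Compat-τ s a c) (go z) (sym (τ-sumv s c))
      where
      go : ∀ {L} → All (λ ρ → ∀ i → i ∉ p → ρ ! i ≡ 0ℤ) L → All (λ ρ → ∀ i → i ∉ p → ρ ! i ≡ 0ℤ) (List.map (τ A ε s) L)
      go [] = []
      go {x ∷ _} (z ∷ zs) = support-τ s {v = x} rows z ∷ go zs

  open Expansion

  private
    module _ {A : Matrix n} (S : System ε d w A) (j : Fin n) where
      open AlmostPositive
      S′ = Isolation.isolate-system S j
      open SystemProperties using (root)

      AP-unisolate : ∀ {v} → v ! j ≡ 0ℤ → AP S′ v → AP S v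
      AP-unisolate {v} z (pos v≥0 (root a b)) = pos v≥0 (root (subst (0ℤ <_) eq a) (λ i → subst (_∣ d i * v ! i) eq (b i)))
        where
        eq : SystemProperties.N S′ v ≡ SystemProperties.N S v
        eq = Isolation.euler-isolate S j Sign.+ {v} {v} z z
      AP-unisolate z (neg i p) = neg i p

      Compat-unisolate : ∀ {u v} → u ! j ≡ 0ℤ → v ! j ≡ 0ℤ → Compat S′ u v → Compat S u v
      Compat-unisolate {u} {v} z z′ (compat a b c) = compat a b
        (λ p q s → subst (0ℤ ≤_) (Isolation.euler-isolate S j s {u} {v} z z′) (c p q s))

      Compat-unisolate-all : ∀ {L} → All (λ ρ → ρ ! j ≡ 0ℤ) L → AllPairs (Compat S′) L → AllPairs (Compat S) L
      Compat-unisolate-all [] [] = []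
      Compat-unisolate-all (z ∷ zs) (c ∷ cs) = go zs c ∷ Compat-unisolate-all zs cs
        where
        go : ∀ {L} → All (λ ρ → ρ ! j ≡ 0ℤ) L → All (Compat S′ _) L → All (Compat S _) L
        go [] [] = []
        go (y ∷ ys) (c ∷ cs) = Compat-unisolate z y c ∷ go ys cs

    subtract : Fin n → ℕ → Lat n → Lat n
    subtract j zero v = v
    subtract j (suc k) v = negv (sr j) +v subtract j k v

    subtract-same : ∀ j k v → subtract j k v ! j ≡ v ! j - + k
    subtract-same j zero v = sym (ℤP.+-identityʳ (v ! j))
    subtract-same j (suc k) v = trans (!-+ (negv (sr j)) (subtract j k v) j)
      (trans (cong₂ _+_ (neg-sr-same j) (subtract-same j k v)) (lem (v ! j) (+ k)))
      where
      lem : ∀ x y → - 1ℤ + (x - y) ≡ x - (1ℤ + y)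
      lem = solve-∀

    subtract-diff : ∀ j k v {i} → i ≢ j → subtract j k v ! i ≡ v ! i
    subtract-diff j zero v p = refl
    subtract-diff j (suc k) v {i} p = trans (!-+ (negv (sr j)) (subtract j k v) i)
      (trans (cong₂ _+_ (neg-sr-diff p) (subtract-diff j k v p)) (ℤP.+-identityˡ (v ! i)))

    -- The root -α_j is compatible with every root whose coordinate at `j` is nonpositive, earlier
    -- copies of itself included. Tracking `≤` instead of equality with zero lets the recursion
    -- continue.
    Expansion-subtract : ∀ {A} (S : System ε d w A) {p v} j k → j ∈ p → (e : Expansion S p v) →
      All (λ ρ → ρ ! j ≤ 0ℤ) (roots e) →
      Σ (Expansion S p (subtract j k v)) (λ e′ → All (λ ρ → ρ ! j ≤ 0ℤ) (roots e′))
    Expansion-subtract S j zero j∈p e z = e , z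
    Expansion-subtract S j (suc k) j∈p e z with Expansion-subtract S j k j∈p e z
    ... | expansion L a c sup tot , z′ = expansion (negv (sr j) ∷ L) (neg j refl ∷ a)
            (All.map (λ {ρ} q → compat
               (λ i r → subst (λ x → ρ ! x ≤ 0ℤ) (sym (neg-sr-negative r)) q)
               (λ i _ → neg-sr-nonpos j i) (λ r → ⊥-elim (¬nonneg-neg-sr j r))) z′ ∷ c)
            ((λ i i∉p → neg-sr-diff {i = j} {i} (λ { refl → i∉p j∈p })) ∷ sup) (cong (negv (sr j) +v_) tot)
          , neg-sr-nonpos j j ∷ z′
      where open AlmostPositive S

    outside-or-same : ∀ (p : Subset n) {i j} → i ∉ p ∖ j → i ≡ j ⊎ i ∉ p
    outside-or-same p {i} {j} q with i Fin.≟ j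
    ... | yes r = inj₁ r
    ... | no r = inj₂ (λ i∈p → q (x∈p∧x≢y⇒x∈p-y i∈p r))

    p-j-outside : ∀ (p : Subset n) j → j ∉ p ∖ j
    p-j-outside p j = go p j
      where
      go : ∀ {m} (p : Subset m) x → x ∉ p ∖ x
      go (_ ∷ p) (suc x) (there q) = go p x q

    -- A negative coordinate at `j` is supplied by copies of -α_j. What remains vanishes at `j` and
    -- is expanded in the system with `j` isolated, where the vertex set has lost an element;
    -- vanishing at `j` also makes norms and Euler forms agree in the two systems.
    expand-negative : ∀ m p → size p ℕ.≤ m → ∀ {A} (S : System ε d w A) → Rows S p → ∀ v →
      (∀ i → i ∉ p → v ! i ≡ 0ℤ) → ∀ j → v ! j < 0ℤ → Expansion S p v

    -- A nonzero nonnegative vector is run until a coordinate turns negative and is expanded there.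
    -- Since `τ` is an involution preserving expansions, the result is carried back along the `Hit`
    -- trace.
    expand : ∀ m p → size p ℕ.≤ m → ∀ {A} (S : System ε d w A) → Rows S p → ∀ v →
      (∀ i → i ∉ p → v ! i ≡ 0ℤ) → Expansion S p v

    expand-negative m p h S rows v z j v<0 with j ∈? p
    ... | no j∉p = ⊥-elim (ℤP.<-irrefl (z j j∉p) v<0)
    expand-negative zero p h S rows v z j v<0 | yes j∈p with ℕP.<-≤-trans (x∈p⇒∣p-x∣<∣p∣ j∈p) h
    ... | ()
    expand-negative (suc m) p h {A} S rows v z j v<0 | yes j∈p =
      subst (Expansion S p) v-eq (proj₁ (Expansion-subtract S j ∣ v ! j ∣ j∈p e₁
        (All.map (λ {ρ} q → ℤP.≤-reflexive (q j (p-j-outside p j))) (support e₀))))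
      where
      rows′ : Rows (Isolation.isolate-system S j) (p ∖ j)
      rows′ i q k with outside-or-same p q
      ... | inj₁ refl = off-isolate-row A j k
      ... | inj₂ i∉p with ≡-or-≢ i j | ≡-or-≢ k j
      ...   | inj₁ refl | _ = off-isolate-row A j k
      ...   | inj₂ _ | inj₁ refl = off-isolate-col A j i
      ...   | inj₂ a | inj₂ b = trans (off-isolate A j a b) (rows i i∉p k)
      z′ : ∀ i → i ∉ p ∖ j → erase j v ! i ≡ 0ℤ
      z′ i q with outside-or-same p q
      ... | inj₁ refl = erase-same j v
      ... | inj₂ i∉p with ≡-or-≢ i j
      ...   | inj₁ refl = erase-same j v
      ...   | inj₂ a = trans (erase-diff j v a) (z i i∉p)
      e₀ : Expansion (Isolation.isolate-system S j) (p ∖ j) (erase j v)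
      e₀ = expand m (p ∖ j) (ℕP.≤-pred (ℕP.<-≤-trans (x∈p⇒∣p-x∣<∣p∣ j∈p) h)) (Isolation.isolate-system S j) rows′ (erase j v) z′
      zeros : All (λ ρ → ρ ! j ≡ 0ℤ) (roots e₀)
      zeros = All.map (λ q → q j (p-j-outside p j)) (support e₀)
      e₁ : Expansion S p (erase j v)
      e₁ = expansion (roots e₀) (All.zipWith (λ (q , r) → AP-unisolate S j q r) (zeros , almost-positive e₀))
        (Compat-unisolate-all S j zeros (compatible e₀))
        (All.map (λ q i i∉p → q i (λ r → i∉p (p─q⊆p p ⁅ j ⁆ r))) (support e₀)) (total e₀)
      v-eq : subtract j ∣ v ! j ∣ (erase j v) ≡ v
      v-eq = lat-ext go
        where
        lem : ∀ x → x < 0ℤ → 0ℤ - + ∣ x ∣ ≡ x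
        lem -[1+ k ] _ = refl
        lem (+ k) q = ⊥-elim (0≤-<0 (+≤+ z≤n) q)
        go : ∀ i → subtract j ∣ v ! j ∣ (erase j v) ! i ≡ v ! i
        go i with ≡-or-≢ i j
        ... | inj₁ refl = trans (subtract-same j ∣ v ! j ∣ (erase j v)) (trans (cong (_- + ∣ v ! j ∣) (erase-same j v)) (lem (v ! j) v<0))
        ... | inj₂ q = trans (subtract-diff j ∣ v ! j ∣ (erase j v) q) (erase-diff j v q)

    expand m p h S rows v z with Nonneg? v
    ... | inj₂ (j , q) = expand-negative m p h S rows v z j q
    ... | inj₁ v≥0 with v ≟v 0v
    ...   | yes refl = expansion [] [] [] [] refl
    ...   | no v≢0 = pull-back (Hitting.hit S Sign.+ v v≥0 v≢0) z
      where
      pull-back : ∀ {s u} → Hitting.Hit S s u → (∀ i → i ∉ p → u ! i ≡ 0ℤ) → Expansion S p u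
      pull-back {u = u} (Hitting.here i q) y = expand-negative m p h S rows u y i q
      pull-back {s} {u} (Hitting.there _ t) y = subst (Expansion S p) (SystemProperties.τ-involutive S s u)
        (Expansion-τ S s rows (pull-back t (support-τ S s {v = u} rows y)))

  cluster-expansion : ∀ {A} (S : System ε d w A) v → Expansion S ⊤ v
  cluster-expansion S v = expand n ⊤ (∣p∣≤n ⊤) S (λ i q → ⊥-elim (q ∈⊤)) v (λ i q → ⊥-elim (q ∈⊤))

-- Cartan matrices of finite type

module FromCartan {n} (A : Matrix n) (ε : Fin n → Sign) (bip : Bipartition A ε)
  (A-diag : ∀ i → A i i ≡ + 2) (A-off : ∀ i j → i ≢ j → A i j ≤ 0ℤ)
  (dn : Fin n → ℕ) (dn-pos : ∀ i → 0 ℕ.< dn i) (A-sym : ∀ i j → + dn i * A i j ≡ + dn j * A j i)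
  (A-posdef : ∀ (x : Lat n) → x ≢ 0v → 0ℤ < ∑ (λ i → ∑ (λ j → lookup x i * (+ dn i * A i j) * lookup x j)))
  where

  private
    d : Fin n → ℤ
    d i = + dn i

    0<d : ∀ i → 0ℤ < d i
    0<d i = +<+ (dn-pos i)

    off-sym : ∀ i j → d i * off A i j ≡ d j * off A j i
    off-sym i j with ≡-or-≢ i j
    ... | inj₁ refl = refl
    ... | inj₂ p rewrite off-≢ A p | off-≢ A {j} {i} (λ q → p (sym q)) = A-sym i j

    off-nonpos : ∀ i j → off A i j ≤ 0ℤ
    off-nonpos i j with ≡-or-≢ i j
    ... | inj₁ refl = ℤP.≤-reflexive (off-diag A i)
    ... | inj₂ p rewrite off-≢ A p = A-off i j p

    off-colour : ∀ i j → ε i ≡ ε j → off A i j ≡ 0ℤ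
    off-colour i j q with ≡-or-≢ i j
    ... | inj₁ refl = off-diag A i
    ... | inj₂ p with A i j ℤ.≟ 0ℤ
    ...   | yes r = trans (off-≢ A p) r
    ...   | no r = ⊥-elim (bip i j p r q)

    -- The pairing with the i-th simple coroot, that is, the i-th entry of A applied to v.
    coroot : Lat n → Fin n → ℤ
    coroot v i = + 2 * v ! i + offSum A v i

    coroot-+ : ∀ u v i → coroot (u +v v) i ≡ coroot u i + coroot v i
    coroot-+ u v i rewrite !-+ u v i | offSum-+ A u v i = lem (+ 2) (u ! i) (v ! i) (offSum A u i) (offSum A v i)
      where
      lem : ∀ k a b c e → k * (a + b) + (c + e) ≡ (k * a + c) + (k * b + e)
      lem = solve-∀

    coroot-• : ∀ k v i → coroot (k • v) i ≡ k * coroot v i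
    coroot-• k v i rewrite !-• k v i | offSum-• A k v i = lem (+ 2) k (v ! i) (offSum A v i)
      where
      lem : ∀ t k a c → t * (k * a) + k * c ≡ k * (t * a + c)
      lem = solve-∀

    form-pos : ∀ v → v ≢ 0v → 0ℤ < ∑ (λ i → v ! i * d i * coroot v i)
    form-pos v p = subst (0ℤ <_) (∑-cong row) (A-posdef v p)
      where
      lem : ∀ a b c e → a * (b * c) * e ≡ a * b * (c * e)
      lem = solve-∀
      row : ∀ i → ∑ (λ j → v ! i * (d i * A i j) * v ! j) ≡ v ! i * d i * coroot v i
      row i = trans (∑-cong (λ j → lem (v ! i) (d i) (A i j) (v ! j)))
        (trans (∑-*ˡ (v ! i * d i) (λ j → A i j * v ! j))
          (cong (v ! i * d i *_) (trans (∑-diag A (v !_) i) (cong (λ x → x * v ! i + offSum A v i) (A-diag i)))))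

    -- The Euler forms of the two orientations add up to the symmetric form and agree on equal
    -- arguments by `euler-swap`, so the symmetric form is twice either of them.
    euler-pos : ∀ v → v ≢ 0v → 0ℤ < euler A ε d Sign.+ v v
    euler-pos v p = 0<*⇒0<ʳ {+ 2} (+<+ (s≤s z≤n)) (subst (0ℤ <_) eq (form-pos v p))
      where
      χχ : ∀ i → χ A ε Sign.+ i + χ A ε Sign.- i ≡ 1ℤ
      χχ i with ε i
      ... | Sign.- = refl
      ... | Sign.+ = refl
      lem : ∀ d x a b m → a + b ≡ 1ℤ → x * d * ((1ℤ + 1ℤ) * x + m) ≡ d * x * (x + a * m) + d * x * (x + b * m)
      lem d x a b m q = trans (cong (λ y → x * d * ((1ℤ + 1ℤ) * x + y)) (sym (trans (cong (_* m) q) (ℤP.*-identityˡ m)))) (lem′ d x a b m)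
        where
        lem′ : ∀ d x a b m → x * d * ((1ℤ + 1ℤ) * x + (a + b) * m) ≡ d * x * (x + a * m) + d * x * (x + b * m)
        lem′ = solve-∀
      double : ∀ x → x + x ≡ (1ℤ + 1ℤ) * x
      double = solve-∀
      eq : ∑ (λ i → v ! i * d i * coroot v i) ≡ + 2 * euler A ε d Sign.+ v v
      eq = trans (∑-cong (λ i → lem (d i) (v ! i) (χ A ε Sign.+ i) (χ A ε Sign.- i) (offSum A v i) (χχ i)))
        (trans (∑-+ (λ i → d i * v ! i * (v ! i + χ A ε Sign.+ i * offSum A v i)) (λ i → d i * v ! i * (v ! i + χ A ε Sign.- i * offSum A v i)))
          (trans (cong (_+_ (euler A ε d Sign.+ v v)) (euler-swap A ε d off-sym off-colour Sign.+ v v))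
            (double (euler A ε d Sign.+ v v))))

    offSum-nonpos : ∀ v → IsNonneg v → ∀ i → offSum A v i ≤ 0ℤ
    offSum-nonpos v v≥0 i = 0≤⇒- (subst (0ℤ ≤_) (∑-neg (λ j → off A i j * v ! j)) (∑-nonneg (λ j →
      subst (0ℤ ≤_) (sym (ℤP.neg-distribˡ-* (off A i j) (v ! j))) (0≤* (≤0⇒0≤- (off-nonpos i j)) (v≥0 j)))))

    -- The leading k by k part of the system A v = b, with `scale` as a positive common denominator
    -- to keep the solution integral.
    record Solution (k : ℕ) (b : Fin n → ℤ) : Set where
      field
        scale : ℤ
        vector : Lat n
        scale-pos : 0ℤ < scale
        vector-nonneg : IsNonneg vector
        vector-support : ∀ i → k ℕ.≤ toℕ i → vector ! i ≡ 0ℤ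
        solves : ∀ i → toℕ i ℕ.< k → coroot vector i ≡ scale * b i

    -- Fraction-free elimination: e spans the kernel of the first k rows on the first k + 1
    -- coordinates, and positive definiteness makes the new pivot positive.
    solve : ∀ k → k ℕ.≤ n → (b : Fin n → ℤ) → (∀ i → 0ℤ ≤ b i) → Solution k b
    solve zero _ b _ = record
      { scale = 1ℤ ; vector = 0v ; scale-pos = +<+ (s≤s z≤n)
      ; vector-nonneg = λ i → ℤP.≤-reflexive (sym (!-0 i))
      ; vector-support = λ i _ → !-0 i ; solves = λ i () }
    solve (suc k) k<n b b≥0 = record
      { scale = p * m₁ ; vector = y
      ; scale-pos = 0<* 0<p (Solution.scale-pos sol₁)
      ; vector-nonneg = λ i → subst (0ℤ ≤_) (sym (y-at i)) (0≤+ (0≤* (ℤP.<⇒≤ 0<p) (Solution.vector-nonneg sol₁ i)) (0≤* 0≤q (e-nonneg i)))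
      ; vector-support = λ i h → trans (y-at i) (trans
          (cong₂ (λ a c → p * a + q * c) (Solution.vector-support sol₁ i (ℕP.<⇒≤ h)) (e-support i h)) (lem₀ p q))
      ; solves = solves′ }
      where
      κ : Fin n
      κ = Fin.fromℕ< k<n
      toℕ-κ : toℕ κ ≡ k
      toℕ-κ = FinP.toℕ-fromℕ< k<n
      sol₁ : Solution k b
      sol₁ = solve k (ℕP.<⇒≤ k<n) b b≥0
      sol₂ : Solution k (λ i → - off A i κ)
      sol₂ = solve k (ℕP.<⇒≤ k<n) (λ i → - off A i κ) (λ i → ≤0⇒0≤- (off-nonpos i κ))
      y₁ z e y : Lat n
      m₁ m₂ p q : ℤ
      y₁ = Solution.vector sol₁
      m₁ = Solution.scale sol₁
      z = Solution.vector sol₂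
      m₂ = Solution.scale sol₂
      e = z +v (m₂ • sr κ)
      p = coroot e κ
      q = m₁ * b κ - coroot y₁ κ
      -- Here `p` is the pivot, the value of row κ on `e`, and `q` is the defect of `y₁` in that
      -- row. Scaling `y₁` by `p` and adding `q` times `e` repairs row κ and leaves the earlier rows
      -- solved, since they vanish on `e`.
      y = (p • y₁) +v (q • e)
      lem₀ : ∀ p q → p * 0ℤ + q * 0ℤ ≡ 0ℤ
      lem₀ = solve-∀
      y-at : ∀ i → y ! i ≡ p * y₁ ! i + q * e ! i
      y-at i = trans (!-+ (p • y₁) (q • e) i) (cong₂ _+_ (!-• p y₁ i) (!-• q e i))
      e-at : ∀ i → e ! i ≡ z ! i + m₂ * sr κ ! i
      e-at i = trans (!-+ z (m₂ • sr κ) i) (cong (_+_ (z ! i)) (!-• m₂ (sr κ) i))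
      e-nonneg : IsNonneg e
      e-nonneg i = subst (0ℤ ≤_) (sym (e-at i)) (0≤+ (Solution.vector-nonneg sol₂ i)
        (0≤* (ℤP.<⇒≤ (Solution.scale-pos sol₂)) (sr-nonneg κ i)))
      e-κ : e ! κ ≡ m₂
      e-κ = trans (e-at κ) (trans (cong₂ (λ a c → a + m₂ * c)
        (Solution.vector-support sol₂ κ (ℕP.≤-reflexive (sym toℕ-κ))) (sr-same κ)) (lem m₂))
        where
        lem : ∀ m → 0ℤ + m * 1ℤ ≡ m
        lem = solve-∀
      e-support : ∀ i → suc k ℕ.≤ toℕ i → e ! i ≡ 0ℤ
      e-support i h = trans (e-at i) (trans (cong₂ (λ a c → a + m₂ * c)
        (Solution.vector-support sol₂ i (ℕP.<⇒≤ h)) (sr-diff {i = κ} {i} (λ { refl → ℕP.<-irrefl (sym toℕ-κ) h }))) (lem m₂))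
        where
        lem : ∀ m → 0ℤ + m * 0ℤ ≡ 0ℤ
        lem = solve-∀
      e-kernel : ∀ i → toℕ i ℕ.< k → coroot e i ≡ 0ℤ
      e-kernel i h = trans (coroot-+ z (m₂ • sr κ) i) (trans (cong₂ _+_ (Solution.solves sol₂ i h)
          (trans (coroot-• m₂ (sr κ) i) (cong (m₂ *_) (cong₂ (λ a c → + 2 * a + c) (sr-diff i≢κ) (offSum-sr A κ i)))))
          (lem m₂ (off A i κ)))
        where
        i≢κ : i ≢ κ
        i≢κ refl = ℕP.<-irrefl toℕ-κ h
        lem : ∀ m x → m * - x + m * (0ℤ + x) ≡ 0ℤ
        lem = solve-∀
      0<p : 0ℤ < p
      0<p = 0<*⇒0<ʳ (0<* (Solution.scale-pos sol₂) (0<d κ)) (subst (0ℤ <_) single (form-pos e e≢0))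
        where
        e≢0 : e ≢ 0v
        e≢0 r = ℤP.<-irrefl (sym (trans (sym e-κ) (trans (cong (_! κ) r) (!-0 κ)))) (Solution.scale-pos sol₂)
        -- Before κ the pairings of `e` vanish, after κ its coordinates do, so the quadratic form
        -- reduces to the term at κ.
        single : ∑ (λ i → e ! i * d i * coroot e i) ≡ m₂ * d κ * p
        single = trans (∑-single κ vanish) (cong (λ x → x * d κ * p) e-κ)
          where
          vanish : ∀ i → i ≢ κ → e ! i * d i * coroot e i ≡ 0ℤ
          vanish i r with ℕP.<-cmp (toℕ i) k
          ... | tri< h _ _ = trans (cong (e ! i * d i *_) (e-kernel i h)) (ℤP.*-zeroʳ (e ! i * d i))
          ... | tri≈ _ h _ = ⊥-elim (r (FinP.toℕ-injective (trans h (sym toℕ-κ))))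
          ... | tri> _ _ h rewrite e-support i h = lem (d i) (coroot e i)
            where
            lem : ∀ a b → 0ℤ * a * b ≡ 0ℤ
            lem = solve-∀
      0≤q : 0ℤ ≤ q
      0≤q = 0≤+ (0≤* (ℤP.<⇒≤ (Solution.scale-pos sol₁)) (b≥0 κ)) (≤0⇒0≤- (subst (_≤ 0ℤ)
        (sym (trans (cong (λ x → + 2 * x + offSum A y₁ κ) (Solution.vector-support sol₁ κ (ℕP.≤-reflexive (sym toℕ-κ)))) (ℤP.+-identityˡ (offSum A y₁ κ))))
        (offSum-nonpos y₁ (Solution.vector-nonneg sol₁) κ)))
      coroot-y : ∀ i → coroot y i ≡ p * coroot y₁ i + q * coroot e i
      coroot-y i = trans (coroot-+ (p • y₁) (q • e) i) (cong₂ _+_ (coroot-• p y₁ i) (coroot-• q e i))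
      solves′ : ∀ i → toℕ i ℕ.< suc k → coroot y i ≡ p * m₁ * b i
      solves′ i h with ℕP.m≤n⇒m<n∨m≡n (ℕP.≤-pred h)
      ... | inj₁ i<k = trans (coroot-y i) (trans (cong₂ (λ a c → p * a + q * c) (Solution.solves sol₁ i i<k) (e-kernel i i<k))
              (lem p q m₁ (b i)))
        where
        lem : ∀ p q m b → p * (m * b) + q * 0ℤ ≡ p * m * b
        lem = solve-∀
      ... | inj₂ i≡k with FinP.toℕ-injective {i = i} {κ} (trans i≡k (sym toℕ-κ))
      ...   | refl = trans (coroot-y i) (lem p (coroot y₁ i) m₁ (b i))
        where
        lem : ∀ p x m b → p * x + (m * b - x) * p ≡ p * m * b
        lem = solve-∀

    -- Its vector is a positive multiple of the Weyl vector, on which all simple coroots take the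
    -- same value.
    ones : Solution n (λ _ → 1ℤ)
    ones = solve n ℕP.≤-refl (λ _ → 1ℤ) (λ _ → +≤+ z≤n)
    open Solution ones

    coroot-ones : ∀ i → coroot vector i ≡ scale
    coroot-ones i = trans (solves i (FinP.toℕ<n i)) (ℤP.*-identityʳ scale)

    vector-pos : ∀ i → 0ℤ < vector ! i
    vector-pos i = 0<*⇒0<ʳ {+ 2} (+<+ (s≤s z≤n)) (subst (0ℤ <_)
      (trans (cong (_+ - offSum A vector i) (sym (coroot-ones i))) (lem (+ 2 * vector ! i) (offSum A vector i)))
      (0<+ˡ scale-pos (≤0⇒0≤- (offSum-nonpos vector vector-nonneg i))))
      where
      lem : ∀ a b → a + b + - b ≡ a
      lem = solve-∀

  -- The equations for `vector` concern rows of A, whereas `w-dominant` concerns columns; the factor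
  -- d_i in the weights converts one into the other by symmetry of d_i a_ij.
  system : System ε d (λ i → d i * vector ! i) A
  system = record
    { 0<d = 0<d ; off-sym = off-sym ; off-nonpos = off-nonpos ; off-colour = off-colour ; euler-pos = euler-pos
    ; 0<w = λ i → 0<* (0<d i) (vector-pos i)
    ; w-dominant = λ j → subst (0ℤ <_) (dominant j) (0<* (0<d j) (subst (0ℤ <_) (sym (coroot-ones j)) scale-pos)) }
    where
    lem₁ : ∀ k a b c → a * (k * b + c) ≡ k * (a * b) + a * c
    lem₁ = solve-∀
    lem₂ : ∀ a b c → a * (b * c) ≡ (a * b) * c
    lem₂ = solve-∀
    lem₃ : ∀ a b c → a * b * c ≡ a * c * b
    lem₃ = solve-∀
    dominant : ∀ j → d j * coroot vector j ≡ + 2 * (d j * vector ! j) + ∑ (λ i → d i * vector ! i * off A i j)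
    dominant j = trans (lem₁ (+ 2) (d j) (vector ! j) (offSum A vector j)) (cong (_+_ (+ 2 * (d j * vector ! j)))
      (trans (sym (∑-*ˡ (d j) (λ i → off A j i * vector ! i))) (∑-cong (λ i →
        trans (lem₂ (d j) (off A j i) (vector ! i)) (trans (cong (_* vector ! i) (off-sym j i)) (lem₃ (d i) (off A i j) (vector ! i)))))))

-- Orbits of almost positive roots

module Roots {n} {ε : Fin n → Sign} {d w : Fin n → ℤ} {A : Matrix n} (S : System ε d w A)
  (A-diag : ∀ i → A i i ≡ + 2) where
  open System S
  open SystemProperties S
  open AlmostPositive S

  private
    refl-s-same : ∀ i v → refl-s A i v ! i ≡ v ! i - (+ 2 * v ! i + offSum A v i)
    refl-s-same i v = trans (VecP.lookup∘tabulate _ i) (trans lem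
      (cong (λ x → v ! i - x) (trans (∑-diag A (v !_) i) (cong (λ x → x * v ! i + offSum A v i) (A-diag i)))))
      where
      R : ℤ
      R = v ! i - ∑ (λ j → A i j * v ! j)
      lem : (if ⌊ i Fin.≟ i ⌋ then R else v ! i) ≡ R
      lem with i Fin.≟ i
      ... | yes _ = refl
      ... | no p = ⊥-elim (p refl)

    refl-s-diff : ∀ i v {k} → k ≢ i → refl-s A i v ! k ≡ v ! k
    refl-s-diff i v {k} p = trans (VecP.lookup∘tabulate _ k) lem
      where
      lem : (if ⌊ k Fin.≟ i ⌋ then v ! k - ∑ (λ j → A i j * v ! j) else v ! k) ≡ v ! k
      lem with k Fin.≟ i
      ... | yes q = ⊥-elim (p q)
      ... | no _ = refl

    -- With c the coroot pairing of `v`, the two cross terms carry the Euler forms of both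
    -- orientations and add up to d_i c. Scaled by -c they cancel the c² d_i contributed by the
    -- multiple of the simple root.
    N-refl-s : ∀ i v → N (refl-s A i v) ≡ N v
    N-refl-s i v = trans (cong N refl-s-+) (trans (E-+ˡ Sign.+ v u (v +v u)) (trans
        (cong₂ _+_ (trans (E-+ʳ Sign.+ v v u) (cong (_+_ (N v)) (trans (E-•ʳ Sign.+ v (- c) (sr i))
          (cong (- c *_) (trans (E-swap Sign.- v (sr i)) (E-srˡ Sign.- i v))))))
          (trans (E-•ˡ Sign.+ (- c) (sr i) (v +v u)) (cong (- c *_) (trans (E-+ʳ Sign.+ (sr i) v u)
            (cong₂ _+_ (E-srˡ Sign.+ i v) (trans (E-•ʳ Sign.+ (sr i) (- c) (sr i)) (cong (- c *_) (N-sr i))))))))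
        (cancel (N v) (d i) (v ! i) (offSum A v i) (χ A ε Sign.- i) (χ A ε Sign.+ i) χχ)))
      where
      c : ℤ
      c = + 2 * v ! i + offSum A v i
      u : Lat n
      u = (- c) • sr i
      χχ : χ A ε Sign.- i + χ A ε Sign.+ i ≡ 1ℤ
      χχ with ε i
      ... | Sign.- = refl
      ... | Sign.+ = refl
      cancel : ∀ N d x m a b → a + b ≡ 1ℤ →
        N + - (+ 2 * x + m) * (d * (x + a * m)) + - (+ 2 * x + m) * (d * (x + b * m) + - (+ 2 * x + m) * d) ≡ N
      cancel N d x m a b p = trans (lem N d x m a b (+ 2 * x + m)) (trans
        (cong (λ y → N + - (+ 2 * x + m) * (d * ((1ℤ + 1ℤ) * x + y * m - (+ 2 * x + m)))) p) (lem′ N d x m (+ 2)))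
        where
        lem : ∀ N d x m a b c → N + - c * (d * (x + a * m)) + - c * (d * (x + b * m) + - c * d) ≡ N + - c * (d * ((1ℤ + 1ℤ) * x + (a + b) * m - c))
        lem = solve-∀
        lem′ : ∀ N d x m k → N + - (k * x + m) * (d * (k * x + 1ℤ * m - (k * x + m))) ≡ N
        lem′ = solve-∀
      refl-s-+ : refl-s A i v ≡ v +v u
      refl-s-+ = lat-ext go
        where
        lem : ∀ x c → x - c ≡ x + - c * 1ℤ
        lem = solve-∀
        lem′ : ∀ x c → x ≡ x + - c * 0ℤ
        lem′ = solve-∀
        go : ∀ k → refl-s A i v ! k ≡ (v +v u) ! k
        go k with ≡-or-≢ k i
        ... | inj₁ refl = trans (refl-s-same i v) (trans (lem (v ! i) c) (sym (trans (!-+ v u i)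
                (cong (_+_ (v ! i)) (trans (!-• (- c) (sr i) i) (cong (- c *_) (sr-same i)))))))
        ... | inj₂ p = trans (refl-s-diff i v p) (trans (lem′ (v ! k) c) (sym (trans (!-+ v u k)
                (cong (_+_ (v ! k)) (trans (!-• (- c) (sr i) k) (cong (- c *_) (sr-diff p)))))))

  Root-refl-s : ∀ i {v} → Root v → Root (refl-s A i v)
  Root-refl-s i {v} (root a b) = root (subst (0ℤ <_) (sym (N-refl-s i v)) a)
    (λ j → subst (_∣ d j * refl-s A i v ! j) (sym (N-refl-s i v)) (go j))
    where
    lem : ∀ d x m k → d * x - (k * (d * x) + d * m) ≡ d * (x - (k * x + m))
    lem = solve-∀
    go : ∀ j → N v ∣ d j * refl-s A i v ! j
    go j with ≡-or-≢ j i
    ... | inj₁ refl rewrite refl-s-same i v = subst (N v ∣_) (lem (d i) (v ! i) (offSum A v i) (+ 2))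
            (∣m∣n⇒∣m-n (b i) (∣m∣n⇒∣m+n (∣n⇒∣m*n (+ 2) (b i)) (offSum-∣ {v = v} b i)))
    ... | inj₂ p rewrite refl-s-diff i v p = b j

  IsRoot⇒Root : ∀ {v} → IsRoot A v → Root v
  IsRoot⇒Root (word , i , refl) = go word
    where
    go : ∀ word → Root (List.foldr (refl-s A) (sr i) word)
    go [] = Root-sr i
    go (j ∷ word) = Root-refl-s j (go word)

  AlmostPos⇒AP : ∀ {v} → AlmostPos A v → AP v
  AlmostPos⇒AP (inj₁ (r , v≥0)) = pos v≥0 (IsRoot⇒Root r)
  AlmostPos⇒AP (inj₂ (i , p)) = neg i p

  private
    -- Reflections of one colour read only the other colour and write only their own coordinate, so
    -- they do not disturb each other. A repeated index would undo its reflection, hence `Unique`.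
    reflect-unicolour : ∀ s v L → Unique L → All (λ i → ε i ≡ s) L → ∀ k →
      (k ListMem.∈ L → List.foldr (refl-s A) v L ! k ≡ - (v ! k) - offSum A v k) ×
      (k ListMem.∉ L → List.foldr (refl-s A) v L ! k ≡ v ! k)
    reflect-unicolour s v [] _ _ k = (λ ()) , (λ _ → refl)
    reflect-unicolour s v (i ∷ L) uniq@(_ ∷ uniq′) (p ∷ ps) k = inside , outside
      where
      u : Lat n
      u = List.foldr (refl-s A) v L
      IH : ∀ k → (k ListMem.∈ L → u ! k ≡ - (v ! k) - offSum A v k) × (k ListMem.∉ L → u ! k ≡ v ! k)
      IH = reflect-unicolour s v L uniq′ ps
      lem : ∀ x m → x - ((1ℤ + 1ℤ) * x + m) ≡ - x - m
      lem = solve-∀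
      reflected : refl-s A i u ! i ≡ - (v ! i) - offSum A v i
      reflected = trans (refl-s-same i u) (trans (cong₂ (λ x m → x - (+ 2 * x + m))
        (proj₂ (IH i) (UniqueP.Unique[x∷xs]⇒x∉xs uniq))
        (off-sum-cong p (λ j q → proj₂ (IH j) (λ r → q (All.lookup ps r))))) (lem (v ! i) (offSum A v i)))
      inside : k ListMem.∈ (i ∷ L) → refl-s A i u ! k ≡ - (v ! k) - offSum A v k
      inside (here refl) = reflected
      inside (there q) with ≡-or-≢ k i
      ... | inj₁ refl = reflected
      ... | inj₂ r = trans (refl-s-diff i u r) (proj₁ (IH k) q)
      outside : k ListMem.∉ (i ∷ L) → refl-s A i u ! k ≡ v ! k
      outside q = trans (refl-s-diff i u (λ r → q (here r))) (proj₂ (IH k) (λ r → q (there r)))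

  IsRoot-t : ∀ s {v} → IsRoot A v → IsRoot A (t A ε s v)
  IsRoot-t s {v} (word , i , p) = L List.++ word , i , trans (ListP.foldr-++ (refl-s A) (sr i) L word)
      (trans (cong (λ u → List.foldr (refl-s A) u L) p) (lat-ext go))
    where
    L : List (Fin n)
    L = List.filter (λ k → ε k SignP.≟ s) (List.allFin n)
    refls : ∀ k → _
    refls = reflect-unicolour s v L (UniqueP.filter⁺ (λ k → ε k SignP.≟ s) (UniqueP.allFin⁺ n))
      (AllP.all-filter (λ k → ε k SignP.≟ s) (List.allFin n))
    go : ∀ k → List.foldr (refl-s A) v L ! k ≡ t A ε s v ! k
    go k with ε k SignP.≟ s
    ... | yes q = trans (proj₁ (refls k) (∈-filter⁺ (λ k → ε k SignP.≟ s) (∈-allFin k) q)) (sym (t-on A ε v q))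
    ... | no q = trans (proj₂ (refls k) (λ r → q (All.lookup (AllP.all-filter (λ k → ε k SignP.≟ s) (List.allFin n)) r)))
                   (sym (t-off A ε v q))

  AlmostPos-τ : ∀ s {v} → AlmostPos A v → AlmostPos A (τ A ε s v)
  AlmostPos-τ s {v} (inj₁ (r , v≥0)) with nonneg-step s v≥0 (IsRoot⇒Root r)
  ... | inj₁ (q , _) = inj₁ (subst (IsRoot A) (sym (τ≡t s v (λ j _ → v≥0 j))) (IsRoot-t s r) , q)
  ... | inj₂ (i , q , refl) = inj₂ (i , τ-sr-on q)
  AlmostPos-τ s (inj₂ (i , refl)) with ε i SignP.≟ s
  ... | yes p = inj₁ (([] , i , sym (τ-neg-sr-on p)) , subst IsNonneg (sym (τ-neg-sr-on p)) (sr-nonneg i))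
  ... | no p = inj₂ (i , τ-neg-sr-off p)

  AlmostPos-run : ∀ s k {v} → AlmostPos A v → AlmostPos A (run A ε s k v)
  AlmostPos-run s zero a = a
  AlmostPos-run s (suc k) a = AlmostPos-run (opposite s) k (AlmostPos-τ s a)

  AlmostPos-back : ∀ s k {v} → AlmostPos A v → AlmostPos A (back A ε s k v)
  AlmostPos-back s zero a = a
  AlmostPos-back s (suc k) a = AlmostPos-τ s (AlmostPos-back (opposite s) k a)

  -- A positive root must leave the nonnegative cone under the run, and the only almost positive
  -- roots outside the cone are the negative simple ones.
  orbit-meets-neg-simples : ∀ s {v} → AP v → ∃ λ k → ∃ λ i → run A ε s k v ≡ negv (sr i)
  orbit-meets-neg-simples s (neg i p) = 0 , i , p
  orbit-meets-neg-simples s {v} a@(pos v≥0 r) = go (Hitting.hit S s v v≥0 (Root-≢0 r)) a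
    where
    go : ∀ {s v} → Hitting.Hit S s v → AP v → ∃ λ k → ∃ λ i → run A ε s k v ≡ negv (sr i)
    go (Hitting.here i p) (pos q _) = ⊥-elim (0≤-<0 (q i) p)
    go (Hitting.here _ _) (neg i p) = 0 , i , p
    go {s} (Hitting.there _ h) a with go h (AP-τ s a)
    ... | k , i , p = suc k , i , p

  -- Undoing the run from the negative simple root it meets uses only steps that preserve
  -- `AlmostPos`. So the norm and divisibility conditions admit no vectors beyond the actual roots.
  AP⇒AlmostPos : ∀ {v} → AP v → AlmostPos A v
  AP⇒AlmostPos {v} a with orbit-meets-neg-simples Sign.+ a
  ... | k , i , p = subst (AlmostPos A) (trans (cong (back A ε Sign.+ k) (sym p)) (back-run Sign.+ k v))
                      (AlmostPos-back Sign.+ k (inj₂ (i , refl)))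

-- The common return time

run-suc : ∀ {n} (A : Matrix n) ε s k v → run A ε s (suc k) v ≡ τ A ε (sgn s k) (run A ε s k v)
run-suc A ε s zero v = refl
run-suc A ε s (suc k) v = run-suc A ε (opposite s) k (τ A ε s v)

run-+ : ∀ {n} (A : Matrix n) ε s k m v → run A ε s (k ℕ.+ m) v ≡ run A ε (sgn s k) m (run A ε s k v)
run-+ A ε s zero m v = refl
run-+ A ε s (suc k) m v = run-+ A ε (opposite s) k m (τ A ε s v)

back-+ : ∀ {n} (A : Matrix n) ε s k m v → back A ε s (k ℕ.+ m) v ≡ back A ε s k (back A ε (sgn s k) m v)
back-+ A ε s zero m v = refl
back-+ A ε s (suc k) m v = cong (τ A ε s) (back-+ A ε (opposite s) k m v)

-- The reverse of an alternating word is alternating. Its innermost letter has the colour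
-- `sgn s (k - 1)`, written as `sgn (opposite s) k` to avoid the subtraction.
back≡run : ∀ {n} (A : Matrix n) ε s k v → back A ε s k v ≡ run A ε (sgn (opposite s) k) k v
back≡run A ε s zero v = refl
back≡run A ε s (suc k) v = trans (cong (τ A ε s) (back≡run A ε (opposite s) k v)) (trans
  (cong (λ x → τ A ε x (run A ε (sgn (opposite (opposite s)) k) k v)) (sym last))
  (sym (run-suc A ε (sgn (opposite (opposite s)) k) k v)))
  where
  last : sgn (sgn (opposite (opposite s)) k) k ≡ s
  last = trans (sgn-sgn (opposite (opposite s)) k) (opposite² s)

module Return {n} {ε : Fin n → Sign} {d w : Fin n → ℤ} {A : Matrix n} (S : System ε d w A) where
  open System S
  open SystemProperties S
  open AlmostPositive S

  private
    -- The linearised run, equal to `run` as long as the vectors met are nonnegative. Linearity is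
    -- what allows the orbits of neighbouring simple roots to be compared.
    lrun : Sign → ℕ → Lat n → Lat n
    lrun s zero v = v
    lrun s (suc k) v = lrun (opposite s) k (t A ε s v)

    lrun-suc : ∀ s k v → lrun s (suc k) v ≡ t A ε (sgn s k) (lrun s k v)
    lrun-suc s zero v = refl
    lrun-suc s (suc k) v = lrun-suc (opposite s) k (t A ε s v)

    run≡lrun : ∀ s k v → (∀ m → m ℕ.< k → IsNonneg (run A ε s m v)) → run A ε s k v ≡ lrun s k v
    run≡lrun s zero v p = refl
    run≡lrun s (suc k) v p = trans (run≡lrun (opposite s) k (τ A ε s v) (λ m q → p (suc m) (s≤s q)))
      (cong (lrun (opposite s) k) (τ≡t s v (λ j _ → p 0 (s≤s z≤n) j)))

    t-linear : ∀ s v l → t A ε s v ! l ≡ ∑ (λ i → v ! i * t A ε s (sr i) ! l)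
    t-linear s v l with ε l SignP.≟ s
    ... | no p = trans (t-off A ε v p) (sym (trans (∑-cong (λ i → cong (v ! i *_) (trans (t-off A ε (sr i) p) (sr-sym i l))))
            (∑-sr l (v !_))))
    ... | yes p = trans (t-on A ε v p) (sym (trans
            (∑-cong (λ i → trans (cong (v ! i *_) (trans (t-on A ε (sr i) p)
              (cong₂ (λ x y → - x - y) (sr-sym i l) (offSum-sr A i l))))
              (lem (v ! i) (sr l ! i) (off A l i))))
            (trans (∑-+ (λ i → (- (v ! i)) * sr l ! i) (λ i → - (off A l i * v ! i)))
              (cong₂ _+_ (∑-sr l (λ i → - (v ! i))) (∑-neg (λ i → off A l i * v ! i))))))
      where
      lem : ∀ x s o → x * (- s - o) ≡ - x * s + - (o * x)
      lem = solve-∀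

    lrun-linear : ∀ s k v l → lrun s k v ! l ≡ ∑ (λ i → v ! i * lrun s k (sr i) ! l)
    lrun-linear s zero v l = trans (sym (∑-sr l (v !_))) (∑-cong (λ i → cong (v ! i *_) (sr-sym l i)))
    lrun-linear s (suc k) v l = begin
      lrun (opposite s) k (t A ε s v) ! l
        ≡⟨ lrun-linear (opposite s) k (t A ε s v) l ⟩
      ∑ (λ m → t A ε s v ! m * g m)
        ≡⟨ ∑-cong (λ m → trans (cong (_* g m) (t-linear s v m)) (trans (ℤP.*-comm (∑ (λ i → v ! i * T i m)) (g m))
             (sym (∑-*ˡ (g m) (λ i → v ! i * T i m))))) ⟩
      ∑ (λ m → ∑ (λ i → g m * (v ! i * T i m)))
        ≡⟨ ∑-swap (λ m i → g m * (v ! i * T i m)) ⟩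
      ∑ (λ i → ∑ (λ m → g m * (v ! i * T i m)))
        ≡⟨ ∑-cong (λ i → trans (∑-cong (λ m → lem (g m) (v ! i) (T i m))) (trans (∑-*ˡ (v ! i) (λ m → T i m * g m))
             (cong (v ! i *_) (sym (lrun-linear (opposite s) k (t A ε s (sr i)) l))))) ⟩
      ∑ (λ i → v ! i * lrun s (suc k) (sr i) ! l) ∎
      where
      open ≡-Reasoning
      g : Fin n → ℤ
      g m = lrun (opposite s) k (sr m) ! l
      T : Fin n → Fin n → ℤ
      T i m = t A ε s (sr i) ! m
      lem : ∀ a b c → a * (b * c) ≡ b * (c * a)
      lem = solve-∀

    lrun-neg : ∀ s k v → lrun s k (negv v) ≡ negv (lrun s k v)
    lrun-neg s k v = lat-ext (λ l → trans (lrun-linear s k (negv v) l) (trans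
      (∑-cong (λ i → trans (cong (_* lrun s k (sr i) ! l) (!-neg v i)) (sym (ℤP.neg-distribˡ-* (v ! i) (lrun s k (sr i) ! l)))))
      (trans (∑-neg (λ i → v ! i * lrun s k (sr i) ! l)) (trans (cong -_ (sym (lrun-linear s k v l)))
        (sym (!-neg (lrun s k v) l))))))

    nonneg-τ≡t : ∀ s v → IsNonneg v → τ A ε s v ≡ t A ε s v
    nonneg-τ≡t s v p = τ≡t s v (λ j _ → p j)

    t-sr-on : ∀ {s i} → ε i ≡ s → t A ε s (sr i) ≡ negv (sr i)
    t-sr-on {s} {i} p = trans (sym (nonneg-τ≡t s (sr i) (sr-nonneg i))) (τ-sr-on p)

  -- The letter of colour `ε i` has just turned -α_i into α_i, so the alternating word goes on with
  -- the opposite colour.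
  orbit : Fin n → ℕ → Lat n
  orbit i m = run A ε (opposite (ε i)) m (sr i)

  record Returns (i : Fin n) (k : ℕ) : Set where
    field
      nonneg : ∀ m → m ℕ.≤ k → IsNonneg (orbit i m)
      target : Fin n
      returns : orbit i (suc k) ≡ negv (sr target)
      -- The last letter is the one that negates the simple root at `target`, so it has that colour.
      colour : sgn (opposite (ε i)) k ≡ ε target

  first-return : ∀ i → ∃ λ k → Returns i k
  first-return i = pack (go (Hitting.hit S (opposite (ε i)) (sr i) (sr-nonneg i) (Root-≢0 (Root-sr i))) (sr-nonneg i) (Root-sr i))
    where
    FirstReturn : Sign → Lat n → Set
    FirstReturn s v = ∃ λ k → (∀ m → m ℕ.≤ k → IsNonneg (run A ε s m v)) ×
      ∃ λ j → run A ε s (suc k) v ≡ negv (sr j) × sgn s k ≡ ε j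
    pack : FirstReturn (opposite (ε i)) (sr i) → ∃ λ k → Returns i k
    pack (k , nn , j , e , c) = k , record { nonneg = nn ; target = j ; returns = e ; colour = c }
    go : ∀ {s v} → Hitting.Hit S s v → IsNonneg v → Root v → FirstReturn s v
    go (Hitting.here i p) v≥0 _ = ⊥-elim (0≤-<0 (v≥0 i) p)
    go {s} {v} (Hitting.there _ h) v≥0 r with nonneg-step s v≥0 r
    ... | inj₂ (j , p , refl) = 0 , (λ { zero z≤n → v≥0 }) , j , τ-sr-on p , sym p
    ... | inj₁ (q , r′) = later (go h q r′)
      where
      later : FirstReturn (opposite s) (τ A ε s v) → FirstReturn s v
      later (k , nn , j , e , c) = suc k , (λ { zero _ → v≥0 ; (suc m) (s≤s p) → nn m p }) , j , e , c

  -- Additivity of the linear orbits on the mesh starting at j: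
  -- Z_j(k+2) + Z_j(k) = Σ_i (-a_ij) Z_i(k+1), where Z_j(m+1) = orbit j m.
  neighbour-return : ∀ {i j k l} → (∀ m → off A m j ≢ 0ℤ → ∃ λ l → k ℕ.≤ l × Returns m l) →
    Returns j k → Returns i l → off A i j ≢ 0ℤ → l ℕ.≤ k
  neighbour-return {i} {j} {k} {l} later rj ri oij = conclude (k ℕ.<? l)
    where
    open Returns rj
    -- Minus the term Z_j(k) of the mesh relation: the first letter has the colour of `j` and
    -- negates `sr j`. Written this way it also covers k = 0.
    X : Lat n
    X = lrun (ε j) k (sr j)
    neighbour-colour : ∀ m → off A m j ≢ 0ℤ → opposite (ε m) ≡ ε j
    neighbour-colour m p = trans (cong opposite (≢⇒opposite (λ q → p (off-colour m j q)))) (opposite² (ε j))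
    sgn-k : sgn (ε j) k ≡ opposite (ε target)
    sgn-k = trans (sym (cong (λ s → sgn s k) (opposite² (ε j)))) (trans (sgn-suc (opposite (ε j)) k) (cong opposite colour))
    orbit-k : orbit j k ≡ sr target
    orbit-k = trans (sym (τ-involutive (ε target) (orbit j k))) (trans (cong (τ A ε (ε target))
      (trans (sym (cong (λ s → τ A ε s (orbit j k)) colour)) (trans (sym (run-suc A ε (opposite (ε j)) k (sr j))) returns)))
      (τ-neg-sr-on refl))
    tX : t A ε (opposite (ε target)) X ≡ negv (sr target)
    tX = begin
      t A ε (opposite (ε target)) X ≡⟨ cong (λ s → t A ε s X) sgn-k ⟨
      t A ε (sgn (ε j) k) X ≡⟨ lrun-suc (ε j) k (sr j) ⟨
      lrun (opposite (ε j)) k (t A ε (ε j) (sr j)) ≡⟨ cong (lrun (opposite (ε j)) k) (t-sr-on refl) ⟩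
      lrun (opposite (ε j)) k (negv (sr j)) ≡⟨ lrun-neg (opposite (ε j)) k (sr j) ⟩
      negv (lrun (opposite (ε j)) k (sr j)) ≡⟨ cong negv (run≡lrun (opposite (ε j)) k (sr j) (λ m p → nonneg m (ℕP.<⇒≤ p))) ⟨
      negv (orbit j k) ≡⟨ cong negv orbit-k ⟩
      negv (sr target) ∎
      where open ≡-Reasoning
    -- One more letter turns `X` into the negative simple root at `target`, and that letter does not
    -- touch the coordinates of target's colour; so `X` already has the final values there.
    X-at : ∀ l → ε l ≡ ε target → X ! l ≡ negv (sr target) ! l
    X-at l p = trans (sym (t-off A ε X (λ q → opposite-≢ (ε target) (trans (sym q) p)))) (cong (_! l) tX)
    Y : ∀ l → Fin n → ℤ
    Y l m = lrun (ε j) k (sr m) ! l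
    mesh : ∀ l → negv (sr target) ! l ≡ X ! l + ∑ (λ m → - off A m j * Y l m)
    mesh l = begin
      negv (sr target) ! l ≡⟨ cong (_! l) returns ⟨
      orbit j (suc k) ! l ≡⟨ cong (_! l) (run≡lrun (opposite (ε j)) (suc k) (sr j) (λ m p → nonneg m (ℕP.≤-pred p))) ⟩
      lrun (opposite (opposite (ε j))) k tj ! l ≡⟨ cong (λ s → lrun s k tj ! l) (opposite² (ε j)) ⟩
      lrun (ε j) k tj ! l ≡⟨ lrun-linear (ε j) k tj l ⟩
      ∑ (λ m → tj ! m * Y l m) ≡⟨ ∑-cong (λ m → trans (cong (_* Y l m) (tj-at m)) (lem (sr j ! m) (off A m j) (Y l m))) ⟩
      ∑ (λ m → Y l m * sr j ! m + - off A m j * Y l m) ≡⟨ ∑-+ (λ m → Y l m * sr j ! m) (λ m → - off A m j * Y l m) ⟩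
      ∑ (λ m → Y l m * sr j ! m) + ∑ (λ m → - off A m j * Y l m) ≡⟨ cong (_+ ∑ (λ m → - off A m j * Y l m)) (∑-sr j (Y l)) ⟩
      X ! l + ∑ (λ m → - off A m j * Y l m) ∎
      where
      open ≡-Reasoning
      tj : Lat n
      tj = t A ε (opposite (ε j)) (sr j)
      lem : ∀ a b c → (a - b) * c ≡ c * a + - b * c
      lem = solve-∀
      tj-at : ∀ m → tj ! m ≡ sr j ! m - off A m j
      tj-at m with ε m SignP.≟ opposite (ε j)
      ... | yes p = trans (t-on A ε (sr j) p) (trans (cong₂ (λ x y → - x - y) z (offSum-sr A j m)) (cong (_- off A m j) (sym z)))
        where
        z : sr j ! m ≡ 0ℤ
        z = sr-diff {i = j} {m} (λ { refl → opposite-≢ (ε j) (sym p) })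
      ... | no p = trans (t-off A ε (sr j) p) (trans (sym (ℤP.+-identityʳ (sr j ! m)))
              (cong (λ x → sr j ! m - x) (sym (off-colour m j (trans (≢⇒opposite p) (opposite² (ε j)))))))
    Y-orbit : ∀ l m → off A m j ≢ 0ℤ → Y l m ≡ orbit m k ! l × IsNonneg (orbit m k)
    Y-orbit l m p = use (later m p)
      where
      use : (∃ λ l → k ℕ.≤ l × Returns m l) → Y l m ≡ orbit m k ! l × IsNonneg (orbit m k)
      use (l′ , k≤l′ , rm) = trans (cong (λ s → lrun s k (sr m) ! l) (sym (neighbour-colour m p)))
            (cong (_! l) (sym (run≡lrun (opposite (ε m)) k (sr m) (λ q h → Returns.nonneg rm q (ℕP.≤-trans (ℕP.<⇒≤ h) k≤l′)))))
          , Returns.nonneg rm k k≤l′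
    terms-nonneg : ∀ l m → 0ℤ ≤ - off A m j * Y l m
    terms-nonneg l m = by-cases (off A m j ℤ.≟ 0ℤ)
      where
      by-cases : Dec (off A m j ≡ 0ℤ) → 0ℤ ≤ - off A m j * Y l m
      by-cases (yes p) = ℤP.≤-reflexive (sym (trans (cong (λ x → - x * Y l m) p) (ℤP.*-zeroˡ (Y l m))))
      by-cases (no p) = 0≤* (≤0⇒0≤- (off-nonpos m j)) (subst (0ℤ ≤_) (sym (proj₁ (Y-orbit l m p))) (proj₂ (Y-orbit l m p) l))
    -- On these coordinates `X` accounts for the whole left side of the mesh relation, so the
    -- neighbours' nonnegative contributions sum to zero and vanish one by one.
    terms-zero : ∀ l → ε l ≡ ε target → ∀ m → - off A m j * Y l m ≡ 0ℤ
    terms-zero l p = ∑-nonneg-zero (terms-nonneg l) (cancel (negv (sr target) ! l) _ (trans (mesh l) (cong (_+ ∑ (λ m → - off A m j * Y l m)) (X-at l p))))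
      where
      lem : ∀ a b → (a + b) - a ≡ b
      lem = solve-∀
      cancel : ∀ a b → a ≡ a + b → b ≡ 0ℤ
      cancel a b e = trans (sym (lem a b)) (trans (cong (_- a) (sym e)) (ℤP.+-inverseʳ a))
    unicolour : ∀ l → ε l ≢ opposite (ε target) → orbit i k ! l ≡ 0ℤ
    unicolour l p = [ (λ q → ⊥-elim (oij (trans (sym (ℤP.neg-involutive (off A i j))) (cong -_ q))))
                    , (λ q → trans (sym (proj₁ (Y-orbit l i oij))) q) ]′
      (ℤP.i*j≡0⇒i≡0∨j≡0 (- off A i j) (terms-zero l (trans (≢⇒opposite p) (opposite² (ε target))) i))
    conclude : Dec (k ℕ.< l) → l ℕ.≤ k
    conclude (no p) = ℕP.≮⇒≥ p
    -- If `i` returned later, `orbit i k` would be a positive root living on one colour, hence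
    -- simple, and the next letter has exactly that colour. The orbit would be negative at step k +
    -- 1, which is at most l.
    conclude (yes p) = ⊥-elim (impossible (Root-unicolour (root-of (AP-run (opposite (ε i)) k (pos (sr-nonneg i) (Root-sr i))))
        nn unicolour))
      where
      nn : IsNonneg (orbit i k)
      nn = Returns.nonneg ri k (ℕP.<⇒≤ p)
      root-of : AP (orbit i k) → Root (orbit i k)
      root-of (pos _ r) = r
      root-of (neg u e) = ⊥-elim (¬nonneg-neg-sr u (subst IsNonneg e nn))
      impossible : (∃ λ i′ → ε i′ ≡ opposite (ε target) × orbit i k ≡ sr i′) → ⊥
      impossible (i′ , c , e) = ¬nonneg-neg-sr i′ (subst IsNonneg next (Returns.nonneg ri (suc k) p))
        where
        next : orbit i (suc k) ≡ negv (sr i′)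
        next = trans (run-suc A ε (opposite (ε i)) k (sr i)) (trans (cong (τ A ε (sgn (opposite (ε i)) k)) e)
          (τ-sr-on (trans c (sym (trans (cong (λ s → sgn s k) (neighbour-colour i oij)) sgn-k)))))

  private
    minimum : ∀ {m} (f : Fin m → ℕ) → Fin m → ∃ λ i → ∀ j → f i ℕ.≤ f j
    minimum {suc zero} f _ = zero , λ { zero → ℕP.≤-refl }
    minimum {suc (suc m)} f _ with minimum (f ∘ suc) zero
    ... | i , p with f zero ℕ.≤? f (suc i)
    ...   | yes q = zero , λ { zero → ℕP.≤-refl ; (suc j) → ℕP.≤-trans q (p j) }
    ...   | no q = suc i , λ { zero → ℕP.<⇒≤ (ℕP.≰⇒> q) ; (suc j) → p j }

    ⌊≟⌋-cong : ∀ {a b k} → (a ≡ k → b ≡ k) → (b ≡ k → a ≡ k) → ⌊ a ℕ.≟ k ⌋ ≡ ⌊ b ℕ.≟ k ⌋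
    ⌊≟⌋-cong {a} {b} {k} f g with a ℕ.≟ k | b ℕ.≟ k
    ... | yes _ | yes _ = refl
    ... | no _ | no _ = refl
    ... | yes p | no q = ⊥-elim (q (f p))
    ... | no p | yes q = ⊥-elim (p (g q))

    ⌊≟⌋-refl : ∀ {a k} → ⌊ a ℕ.≟ k ⌋ ≡ ⌊ k ℕ.≟ k ⌋ → a ≡ k
    ⌊≟⌋-refl {a} {k} e with a ℕ.≟ k | k ℕ.≟ k
    ... | yes p | _ = p
    ... | no _ | no q = ⊥-elim (q refl)

    off-≢0-sym : ∀ i j → off A i j ≢ 0ℤ → off A j i ≢ 0ℤ
    off-≢0-sym i j p q with ℤP.i*j≡0⇒i≡0∨j≡0 (d i) (trans (off-sym i j) (trans (cong (d j *_) q) (ℤP.*-zeroʳ (d j))))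
    ... | inj₁ r = ℤP.<-irrefl (sym r) (0<d i)
    ... | inj₂ r = p r

    -- At a vertex of least return time all neighbours return no earlier, so `neighbour-return`
    -- applies and forces equality there. The set of vertices with the least time is thus closed
    -- under edges, and connectedness makes it everything.
    equal-times : Irreducible A → (time : Fin n → ℕ) → (∀ i → Returns i (time i)) →
      ∀ i₁ → (∀ j → time i₁ ℕ.≤ time j) → ∀ i → time i ≡ time i₁
    equal-times irr time ret i₁ least i = ⌊≟⌋-refl (irr (λ i → ⌊ time i ℕ.≟ time i₁ ⌋) mark-const i i₁)
      where
      spread : ∀ i j → off A j i ≢ 0ℤ → time i ≡ time i₁ → time j ≡ time i₁
      spread i j p q = ℕP.≤-antisym (neighbour-return (λ m _ → time m , least m , ret m)
        (subst (Returns i) q (ret i)) (ret j) p) (least j)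
      mark-const : ∀ i j → A i j ≢ 0ℤ → ⌊ time i ℕ.≟ time i₁ ⌋ ≡ ⌊ time j ℕ.≟ time i₁ ⌋
      mark-const i j p with ≡-or-≢ i j
      ... | inj₁ refl = refl
      ... | inj₂ r = ⌊≟⌋-cong (spread i j (off-≢0-sym i j (λ q → p (trans (sym (off-≢ A r)) q))))
                              (spread j i (λ q → p (trans (sym (off-≢ A r)) q)))

  uniform-return : Irreducible A → Fin n → ∃ λ k → ∀ i → Returns i k
  uniform-return irr i₀ = go (proj₁ ∘ first-return) (proj₂ ∘ first-return)
    where
    go : (time : Fin n → ℕ) → (∀ i → Returns i (time i)) → ∃ λ k → ∀ i → Returns i k
    go time ret with minimum time i₀
    ... | i₁ , least = time i₁ , λ i → subst (Returns i) (equal-times irr time ret i₁ least i) (ret i)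

-- Periodicity and exchange

sgn-+ : ∀ s k m → sgn s (k ℕ.+ m) ≡ sgn (sgn s k) m
sgn-+ s zero m = refl
sgn-+ s (suc k) m = sgn-+ (opposite s) k m

module Orbits {n} {ε : Fin n → Sign} {d w : Fin n → ℤ} {A : Matrix n} (S : System ε d w A)
  (A-diag : ∀ i → A i i ≡ + 2) (c : Lat n → Lat n → ℕ) (isDegree : IsCompatDegree A ε c)
  (k : ℕ) (returns : ∀ i → Return.Returns S i k) where
  open System S
  open SystemProperties S
  open AlmostPositive S
  open Expansions {ε = ε} {d} {w} using (Expansion; expansion; τ-sumv; All-AP-τ; AllPairs-Compat-τ; cluster-expansion)
  open Roots S A-diag
  module Ret i = Return.Returns (returns i)

  -- One letter turns -α_j into α_j, k + 1 letters lead on to a negative simple root, and one letter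
  -- is idle because it fixes the root. The idle letter comes last if the word starts with the
  -- colour of `j`, and first otherwise. In type A_2 this gives k = 2 and period 5.
  period : ℕ
  period = suc (suc (suc k))

  private
    first-target : ∀ {s j} → ε j ≡ s → run A ε s (suc (suc k)) (negv (sr j)) ≡ negv (sr (Ret.target j))
    first-target {j = j} refl = trans (cong (run A ε (opposite (ε j)) (suc k)) (τ-neg-sr-on refl)) (Ret.returns j)

    next-sign : ∀ j → sgn (opposite (ε j)) (suc k) ≡ opposite (ε (Ret.target j))
    next-sign j = trans (sgn-suc (opposite (ε j)) k) (cong opposite (Ret.colour j))

  run-neg-sr : ∀ s j → run A ε s period (negv (sr j)) ≡ negv (sr (Ret.target j))
  run-neg-sr s j with ε j SignP.≟ s
  ... | yes refl = trans (run-suc A ε (ε j) (suc (suc k)) (negv (sr j))) (trans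
          (cong₂ (τ A ε) (next-sign j) (first-target refl))
          (τ-neg-sr-off (λ p → opposite-≢ (ε (Ret.target j)) (sym p))))
  ... | no p = trans (cong (run A ε (opposite s) (suc (suc k))) (τ-neg-sr-off p)) (first-target (≢⇒opposite p))

  run-injective : ∀ s m {u v} → run A ε s m u ≡ run A ε s m v → u ≡ v
  run-injective s m {u} {v} p = trans (sym (back-run s m u)) (trans (cong (back A ε s m) p) (back-run s m v))

  private
    -- The inverse word is alternating of the same length, and `run-neg-sr` holds for either
    -- starting colour; consequently `target` is an involution.
    back-neg-sr : ∀ s l → back A ε s period (negv (sr l)) ≡ negv (sr (Ret.target l))
    back-neg-sr s l = trans (back≡run A ε s period (negv (sr l))) (run-neg-sr (sgn (opposite s) period) l)

    run-target : ∀ s l → run A ε s period (negv (sr (Ret.target l))) ≡ negv (sr l)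
    run-target s l = trans (cong (run A ε s period) (sym (back-neg-sr s l))) (run-back s period (negv (sr l)))

    +∣⊔0∣ : ∀ {x} → 0ℤ ≤ x → + ∣ x ⊔ 0ℤ ∣ ≡ x
    +∣⊔0∣ p = trans (cong (λ y → + ∣ y ∣) (⊔-nonneg p)) (ℤP.0≤i⇒+∣i∣≡i p)

  degree-run : ∀ s m {α β} → AlmostPos A α → AlmostPos A β → c (run A ε s m α) (run A ε s m β) ≡ c α β
  degree-run s zero a b = refl
  degree-run s (suc m) a b = trans (degree-run (opposite s) m (AlmostPos-τ s a) (AlmostPos-τ s b))
    (proj₂ isDegree s _ _ a b)

  -- After a full period the negative simple roots are permuted, and the compatibility
  -- degrees with them are the coordinates.
  run-period-AP : ∀ s {ρ} → AP ρ → ∀ l → run A ε s period ρ ! l ≡ ρ ! Ret.target l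
  run-period-AP s {ρ} (neg i refl) l = by-cases (≡-or-≢ (Ret.target l) i)
    where
    by-cases : Ret.target l ≡ i ⊎ Ret.target l ≢ i → run A ε s period (negv (sr i)) ! l ≡ negv (sr i) ! Ret.target l
    by-cases (inj₁ refl) = trans (cong (_! l) (run-target s l)) (trans (neg-sr-same l) (sym (neg-sr-same i)))
    by-cases (inj₂ p) = trans (cong (_! l) (run-neg-sr s i)) (trans (neg-sr-diff l≢) (sym (neg-sr-diff p)))
      where
      l≢ : l ≢ Ret.target i
      l≢ q = -1≢0 (trans (sym (neg-sr-same i)) (trans (cong (_! i) same) (neg-sr-diff {i = Ret.target l} {i} (λ r → p (sym r)))))
        where
        -1≢0 : - 1ℤ ≢ 0ℤ
        -1≢0 ()
        same : negv (sr i) ≡ negv (sr (Ret.target l))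
        same = run-injective s period (trans (run-neg-sr s i) (trans (cong (λ x → negv (sr x)) (sym q)) (sym (run-target s l))))
  run-period-AP s {ρ} a@(pos ρ≥0 _) l = compare (AP-run s period a)
    where
    compare : AP (run A ε s period ρ) → run A ε s period ρ ! l ≡ ρ ! Ret.target l
    compare (pos q _) = trans (sym (+∣⊔0∣ (q l))) (trans (cong +_ degrees) (+∣⊔0∣ (ρ≥0 (Ret.target l))))
      where
      aρ : AlmostPos A ρ
      aρ = AP⇒AlmostPos a
      degrees : ∣ run A ε s period ρ ! l ⊔ 0ℤ ∣ ≡ ∣ ρ ! Ret.target l ⊔ 0ℤ ∣
      degrees = trans (sym (proj₁ isDegree l (run A ε s period ρ) (AlmostPos-run s period aρ)))
        (trans (cong (λ x → c x (run A ε s period ρ)) (sym (run-target s l)))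
          (trans (degree-run s period (inj₂ (Ret.target l , refl)) aρ) (proj₁ isDegree (Ret.target l) ρ aρ)))
    -- A positive root cannot arrive at a negative simple root, because the inverse word takes the
    -- latter to a negative simple root again.
    compare (neg i e) = ⊥-elim (¬nonneg-neg-sr (Ret.target i) (subst IsNonneg
      (trans (sym (back-run s period ρ)) (trans (cong (back A ε s period) e) (back-neg-sr s i))) ρ≥0))

  run-sumv : ∀ s m {L} → All AP L → AllPairs Compat L → run A ε s m (sumv L) ≡ sumv (List.map (run A ε s m) L)
  run-sumv s zero {L} a p = cong sumv (sym (ListP.map-id L))
  run-sumv s (suc m) {L} a p = trans (cong (run A ε (opposite s) m) (τ-sumv S s p))
    (trans (run-sumv (opposite s) m (All-AP-τ S s a) (AllPairs-Compat-τ S s a p)) (cong sumv (sym (ListP.map-∘ L))))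

  run-period : ∀ s v l → run A ε s period v ! l ≡ v ! Ret.target l
  run-period s v l = expand (cluster-expansion S v)
    where
    sums : ∀ {L} → All AP L → sumv (List.map (run A ε s period) L) ! l ≡ sumv L ! Ret.target l
    sums [] = trans (!-0 l) (sym (!-0 (Ret.target l)))
    sums {ρ ∷ L} (a ∷ as) = trans (!-+ (run A ε s period ρ) (sumv (List.map (run A ε s period) L)) l)
      (trans (cong₂ _+_ (run-period-AP s a l) (sums as)) (sym (!-+ ρ (sumv L) (Ret.target l))))
    expand : Expansion S _ v → run A ε s period v ! l ≡ v ! Ret.target l
    expand (expansion L a p _ refl) = trans (cong (_! l) (run-sumv s period a p)) (sums a)

  run-period-+ : ∀ s u v → run A ε s period (u +v v) ≡ run A ε s period u +v run A ε s period v
  run-period-+ s u v = lat-ext (λ l → trans (run-period s (u +v v) l) (trans (!-+ u v (Ret.target l))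
    (trans (cong₂ _+_ (sym (run-period s u l)) (sym (run-period s v l)))
      (sym (!-+ (run A ε s period u) (run A ε s period v) l)))))

  -- Sums conjugated by alternating words: σ(σ⁻¹a + σ⁻¹b) with σ⁻¹ = `run s m`

  conj : Sign → ℕ → Lat n → Lat n → Lat n
  conj s m a b = back A ε s m (run A ε s m a +v run A ε s m b)

  conj-+ : ∀ s m q a b → conj s (m ℕ.+ q) a b ≡ back A ε s m (conj (sgn s m) q (run A ε s m a) (run A ε s m b))
  conj-+ s m q a b = trans (back-+ A ε s m q (run A ε s (m ℕ.+ q) a +v run A ε s (m ℕ.+ q) b)) (cong (λ x → back A ε s m (back A ε (sgn s m) q x))
    (cong₂ _+v_ (run-+ A ε s m q a) (run-+ A ε s m q b)))

  conj-period : ∀ s a b → conj s period a b ≡ a +v b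
  conj-period s a b = trans (cong (back A ε s period) (sym (run-period-+ s a b))) (back-run s period (a +v b))

  conj-periodic : ∀ s m a b → conj s (m ℕ.+ period) a b ≡ conj s m a b
  conj-periodic s m a b = trans (conj-+ s m period a b) (cong (back A ε s m) (conj-period (sgn s m) (run A ε s m a) (run A ε s m b)))

  -- When `τ s` fixes `a`, an extra first letter `s` only replaces `b` by its image. This links
  -- words with the two starting colours and is the source of the second value.
  conj-fixed : ∀ s m a b → τ A ε s a ≡ a → conj (opposite s) m a b ≡ τ A ε s (conj s (suc m) a (τ A ε s b))
  conj-fixed s m a b p = trans (sym (τ-involutive s (conj (opposite s) m a b)))
    (cong (τ A ε s) (cong₂ (λ x y → τ A ε s (conj (opposite s) m x y)) (sym p) (sym (τ-involutive s b))))

  -- τ_s is additive on calm vectors; an almost positive root fails to be calm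
  -- only if it is a negative simple root fixed by τ_s.
  Calm : Sign → Lat n → Set
  Calm s v = ∀ j → ε j ≢ s → 0ℤ ≤ v ! j

  CalmAt : Sign → Lat n → ℕ → Set
  CalmAt s v m = Calm (sgn s m) (run A ε s m v)

  CalmAt-+ : ∀ s v m q → CalmAt s v (m ℕ.+ q) → CalmAt (sgn s m) (run A ε s m v) q
  CalmAt-+ s v m q = subst₂ Calm (sgn-+ s m q) (run-+ A ε s m q v)

  CalmAt-+⁻ : ∀ s v m q → CalmAt (sgn s m) (run A ε s m v) q → CalmAt s v (m ℕ.+ q)
  CalmAt-+⁻ s v m q = subst₂ Calm (sym (sgn-+ s m q)) (sym (run-+ A ε s m q v))

  -- Every letter is additive on the pair it meets, so the word passes through the sum and cancels
  -- against its inverse.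
  conj-calm : ∀ s m a b → (∀ q → q ℕ.< m → CalmAt s a q) → (∀ q → q ℕ.< m → CalmAt s b q) → conj s m a b ≡ a +v b
  conj-calm s zero a b _ _ = refl
  conj-calm s (suc m) a b p q = trans
    (cong (τ A ε s) (trans (conj-calm (opposite s) m (τ A ε s a) (τ A ε s b) (λ r h → p (suc r) (s≤s h)) (λ r h → q (suc r) (s≤s h)))
      (sym (τ-+-nonneg s a b (p 0 (s≤s z≤n)) (q 0 (s≤s z≤n))))))
    (τ-involutive s (a +v b))

  Jump : Sign → Lat n → Set
  Jump s v = ∃ λ i → ε i ≢ s × v ≡ negv (sr i)

  calm-or-jump : ∀ s {v} → AP v → Calm s v ⊎ Jump s v
  calm-or-jump s (pos p _) = inj₁ (λ j _ → p j)
  calm-or-jump s (neg i refl) with ε i SignP.≟ s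
  ... | no p = inj₂ (i , p , refl)
  ... | yes p = inj₁ (λ j q → ℤP.≤-reflexive (sym (neg-sr-diff {i = i} {j} (λ { refl → q p }))))

  first-jump : ∀ s v → AP v → ∀ m → (∀ q → q ℕ.< m → CalmAt s v q) ⊎
    ∃ λ l → l ℕ.< m × Jump (sgn s l) (run A ε s l v)
  first-jump s v a zero = inj₁ (λ _ ())
  first-jump s v a (suc m) with first-jump s v a m
  ... | inj₂ (l , p , j) = inj₂ (l , ℕP.m≤n⇒m≤1+n p , j)
  ... | inj₁ p with calm-or-jump (sgn s m) (AP-run s m a)
  ...   | inj₂ j = inj₂ (m , ℕP.≤-refl , j)
  ...   | inj₁ q = inj₁ (λ r h → [ (λ h′ → p r h′) , (λ { refl → q }) ]′ (ℕP.m≤n⇒m<n∨m≡n (ℕP.≤-pred h)))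

  -- Starting with its own colour, -α_i is flipped by the first letter and then stays nonnegative
  -- for k + 1 steps, so the bound is one less than a period.
  calm-return : ∀ i m → m ℕ.< suc (suc k) → CalmAt (ε i) (negv (sr i)) m
  calm-return i zero _ j p = ℤP.≤-reflexive (sym (neg-sr-diff {i = i} {j} (λ { refl → p refl })))
  calm-return i (suc m) h j _ = subst (λ v → 0ℤ ≤ run A ε (opposite (ε i)) m v ! j) (sym (τ-neg-sr-on refl))
    (Ret.nonneg i m (ℕP.≤-pred (ℕP.≤-pred h)) j)

  -- A negative simple root fixed by one letter is flipped by the next, which puts it in the
  -- situation of `calm-return`. Two jumps of one root are therefore at least a whole period apart.
  calm-after-jump : ∀ s v l → Jump (sgn s l) (run A ε s l v) → ∀ q → q ℕ.< suc (suc k) → CalmAt s v (suc l ℕ.+ q)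
  calm-after-jump s v l (i , p , e) q h = CalmAt-+⁻ s v (suc l) q
    (subst₂ (λ r u → CalmAt r u q) (sym sign) (sym state) (calm-return i q h))
    where
    sign : sgn s (suc l) ≡ ε i
    sign = trans (sgn-suc s l) (sym (≢⇒opposite p))
    state : run A ε s (suc l) v ≡ negv (sr i)
    state = trans (run-suc A ε s l v) (trans (cong (τ A ε (sgn s l)) e) (τ-neg-sr-off p))

  exchange : Fin n → Lat n → Lat n
  exchange j b = τ A ε (opposite (ε j)) (negv (sr j) +v τ A ε (opposite (ε j)) b)

  module _ (j : Fin n) (b : Lat n) (ap-b : AP b) where

    private
      a : Lat n
      a = negv (sr j)
      s₀ : Sign
      s₀ = opposite (ε j)
      τa : τ A ε s₀ a ≡ a
      τa = τ-neg-sr-off (λ p → opposite-≢ (ε j) (sym p))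

      -- This word is a full period with its first letter `s₀` removed. Since `s₀` fixes `a`, it can
      -- be restored by `conj-fixed`, and over a full period the conjugated sum is the plain sum.
      conj-end : conj (ε j) (suc (suc k)) a b ≡ exchange j b
      conj-end = trans (cong (λ s → conj s (suc (suc k)) a b) (sym (opposite² (ε j))))
        (trans (conj-fixed s₀ (suc (suc k)) a b τa) (cong (τ A ε s₀) (conj-period s₀ a (τ A ε s₀ b))))

      -- Within the window `a` never jumps and `b` jumps at most once. Before the jump of `b` the
      -- value is the plain sum; after it the value no longer changes up to the end of the window,
      -- where `conj-end` identifies it.
      conj-window : ∀ m → m ℕ.≤ suc (suc k) → conj (ε j) m a b ≡ a +v b ⊎ conj (ε j) m a b ≡ exchange j b
      conj-window m h with first-jump (ε j) b ap-b m
      ... | inj₁ calm = inj₁ (conj-calm (ε j) m a b (λ q q<m → calm-return j q (ℕP.<-≤-trans q<m h)) calm)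
      ... | inj₂ (l , l<m , jump) = inj₂ (trans (sym (trans (cong (λ x → conj (ε j) x a b) (sym (ℕP.m+[n∸m]≡n h)))
              (trans (conj-+ (ε j) m q a b) (cong (back A ε (ε j) m)
                (conj-calm (sgn (ε j) m) q (run A ε (ε j) m a) (run A ε (ε j) m b) calm-a calm-b))))) conj-end)
        where
        q : ℕ
        q = suc (suc k) ℕ.∸ m
        below : ∀ r → r ℕ.< q → m ℕ.+ r ℕ.< suc (suc k)
        below r p = subst (m ℕ.+ r ℕ.<_) (ℕP.m+[n∸m]≡n h) (ℕP.+-monoʳ-< m p)
        calm-a : ∀ r → r ℕ.< q → CalmAt (sgn (ε j) m) (run A ε (ε j) m a) r
        calm-a r p = CalmAt-+ (ε j) a m r (calm-return j (m ℕ.+ r) (below r p))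
        calm-b : ∀ r → r ℕ.< q → CalmAt (sgn (ε j) m) (run A ε (ε j) m b) r
        calm-b r p = CalmAt-+ (ε j) b m r (subst (CalmAt (ε j) b) split
          (calm-after-jump (ε j) b l jump (m ℕ.+ r ℕ.∸ suc l) (ℕP.≤-<-trans (ℕP.m∸n≤m (m ℕ.+ r) (suc l)) (below r p))))
          where
          split : suc l ℕ.+ (m ℕ.+ r ℕ.∸ suc l) ≡ m ℕ.+ r
          split = ℕP.m+[n∸m]≡n (ℕP.≤-trans l<m (ℕP.m≤m+n m r))

      -- Reduction of m modulo the period, with `N` bounding the recursion. A length beyond the
      -- window is at least `period`, so no case is lost.
      conj-bounded : ∀ N m → m ℕ.≤ N → conj (ε j) m a b ≡ a +v b ⊎ conj (ε j) m a b ≡ exchange j b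
      conj-bounded zero zero _ = inj₁ refl
      conj-bounded (suc N) m h with m ℕ.≤? suc (suc k)
      ... | yes p = conj-window m p
      ... | no p = [ (λ e → inj₁ (trans shift e)) , (λ e → inj₂ (trans shift e)) ]′ (conj-bounded N (m ℕ.∸ period) smaller)
        where
        period≤m : period ℕ.≤ m
        period≤m = ℕP.≰⇒> p
        shift : conj (ε j) m a b ≡ conj (ε j) (m ℕ.∸ period) a b
        shift = trans (cong (λ x → conj (ε j) x a b) (sym (ℕP.m∸n+n≡m period≤m))) (conj-periodic (ε j) (m ℕ.∸ period) a b)
        smaller : m ℕ.∸ period ℕ.≤ N
        smaller = ℕP.≤-pred (ℕP.<-≤-trans (ℕP.∸-monoʳ-< {m} {period} {0} (s≤s z≤n) period≤m) h)

    conj-from-own-colour : ∀ m → conj (ε j) m a b ≡ a +v b ⊎ conj (ε j) m a b ≡ exchange j b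
    conj-from-own-colour m = conj-bounded m m ℕP.≤-refl

  -- A word starting with the colour opposite to that of `j` begins with a letter fixing -α_j.
  -- Stripping it replaces `b` by its image and interchanges the two values, because `exchange` is
  -- the conjugate of the plain sum by this very letter.
  conj-two-values : ∀ j b → AP b → ∀ s m →
    conj s m (negv (sr j)) b ≡ negv (sr j) +v b ⊎ conj s m (negv (sr j)) b ≡ exchange j b
  conj-two-values j b ap s m with s SignP.≟ ε j
  conj-two-values j b ap s m | yes refl = conj-from-own-colour j b ap m
  conj-two-values j b ap s zero | no p = inj₁ refl
  conj-two-values j b ap s (suc m) | no p with ≢⇒opposite p
  ... | refl = [ (λ e → inj₂ (trans unfold (cong (τ A ε s₀) e)))
               , (λ e → inj₁ (trans unfold (trans (cong (τ A ε s₀) e) (trans (τ-involutive s₀ (negv (sr j) +v τ A ε s₀ (τ A ε s₀ b)))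
                   (cong (negv (sr j) +v_) (τ-involutive s₀ b)))))) ]′
               (conj-from-own-colour j (τ A ε s₀ b) (AP-τ s₀ ap) m)
    where
    s₀ : Sign
    s₀ = opposite (ε j)
    unfold : conj s₀ (suc m) (negv (sr j)) b ≡ τ A ε s₀ (conj (ε j) m (negv (sr j)) (τ A ε s₀ b))
    unfold = trans (sym (τ-involutive s₀ (conj s₀ (suc m) (negv (sr j)) b))) (cong (τ A ε s₀) (trans
      (cong (λ x → τ A ε s₀ (conj s₀ (suc m) (negv (sr j)) x)) (sym (τ-involutive s₀ b)))
      (trans (sym (conj-fixed s₀ m (negv (sr j)) (τ A ε s₀ b) (τ-neg-sr-off (λ q → opposite-≢ (ε j) (sym q)))))
        (cong (λ r → conj r m (negv (sr j)) (τ A ε s₀ b)) (opposite² (ε j))))))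

  -- Arbitrary words, with outer letters peeled off both sides at once so that no reversal occurs

  wconj : List Sign → Lat n → Lat n → Lat n
  wconj [] a b = a +v b
  wconj (s ∷ ws) a b = τ A ε s (wconj ws (τ A ε s a) (τ A ε s b))

  applyW-reverse-∷ : ∀ s ws a → applyW A ε (List.reverse (s ∷ ws)) a ≡ applyW A ε (List.reverse ws) (τ A ε s a)
  applyW-reverse-∷ s ws a = trans (cong (λ x → applyW A ε x a) (ListP.unfold-reverse s ws))
    (ListP.foldr-++ (τ A ε) a (List.reverse ws) (s ∷ []))

  wconj-applyW : ∀ ws a b → wconj ws a b ≡ applyW A ε ws (applyW A ε (List.reverse ws) a +v applyW A ε (List.reverse ws) b)
  wconj-applyW [] a b = refl
  wconj-applyW (s ∷ ws) a b = cong (τ A ε s) (trans (wconj-applyW ws (τ A ε s a) (τ A ε s b))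
    (cong₂ (λ x y → applyW A ε ws (x +v y)) (sym (applyW-reverse-∷ s ws a)) (sym (applyW-reverse-∷ s ws b))))

  -- Equal adjacent letters cancel because each `τ` is an involution. The resulting word depends on
  -- `ws` alone and serves all pairs of vectors.
  wconj-alternating : ∀ ws → ∃ λ s → ∃ λ m → ∀ a b → wconj ws a b ≡ conj s m a b
  wconj-alternating [] = Sign.+ , 0 , λ a b → refl
  wconj-alternating (s ∷ ws) = extend (wconj-alternating ws)
    where
    step : ∀ r m → (∀ a b → wconj ws a b ≡ conj r m a b) → ∀ a b → wconj (s ∷ ws) a b ≡ τ A ε s (conj r m (τ A ε s a) (τ A ε s b))
    step r m p a b = cong (τ A ε s) (p (τ A ε s a) (τ A ε s b))
    collapse : ∀ m a b → τ A ε s (conj s (suc m) (τ A ε s a) (τ A ε s b)) ≡ conj (opposite s) m a b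
    collapse m a b = trans (τ-involutive s (conj (opposite s) m (τ A ε s (τ A ε s a)) (τ A ε s (τ A ε s b))))
      (cong₂ (conj (opposite s) m) (τ-involutive s a) (τ-involutive s b))
    extend : (∃ λ r → ∃ λ m → ∀ a b → wconj ws a b ≡ conj r m a b) → ∃ λ r → ∃ λ m → ∀ a b → wconj (s ∷ ws) a b ≡ conj r m a b
    extend (r , m , p) with r SignP.≟ opposite s
    ... | yes refl = s , suc m , step (opposite s) m p
    extend (r , zero , p) | no q = s , 1 , step r zero p
    extend (r , suc m , p) | no q = opposite s , m , λ a b → trans (step r (suc m) p a b)
      (trans (cong (λ x → τ A ε s (conj x (suc m) (τ A ε s a) (τ A ε s b))) (trans (≢⇒opposite q) (opposite² s))) (collapse m a b))

  private
    -- Multiplying group elements by a fixed one only permutes them, so the values for a transported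
    -- pair are the transported values of the original pair.
    wconj-back : ∀ s m ws a b → ∃ λ ws′ → wconj ws (back A ε s m a) (back A ε s m b) ≡ back A ε s m (wconj ws′ a b)
    wconj-back s zero ws a b = ws , refl
    wconj-back s (suc m) ws a b = lift (wconj-back (opposite s) m (s ∷ ws) a b)
      where
      lift : (∃ λ ws′ → wconj (s ∷ ws) (back A ε (opposite s) m a) (back A ε (opposite s) m b) ≡ back A ε (opposite s) m (wconj ws′ a b)) → _
      lift (ws′ , p) = ws′ , trans (sym (τ-involutive s _)) (cong (τ A ε s) p)

    back-wconj : ∀ s m ws a b → ∃ λ ws′ → back A ε s m (wconj ws a b) ≡ wconj ws′ (back A ε s m a) (back A ε s m b)
    back-wconj s zero ws a b = ws , refl
    back-wconj s (suc m) ws a b = lift (back-wconj (opposite s) m ws a b)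
      where
      lift : (∃ λ ws′ → back A ε (opposite s) m (wconj ws a b) ≡ wconj ws′ (back A ε (opposite s) m a) (back A ε (opposite s) m b)) → _
      lift (ws′ , p) = s ∷ ws′ , cong (τ A ε s) (trans p (sym (cong₂ (wconj ws′) (τ-involutive s _) (τ-involutive s _))))

  private
    exactly-two : ∀ {α α′ p q} → p ≢ q → α +v α′ ≡ p → (∀ ws → wconj ws α α′ ≡ p ⊎ wconj ws α α′ ≡ q) →
      (∃ λ ws → q ≡ wconj ws α α′) → ExactlyTwo A ε α α′ q
    exactly-two {α} {α′} p≢q refl values (ws , e) = (λ r → p≢q (sym r)) , λ x →
      (λ { (ws′ , refl) → subst (λ y → y ≡ α +v α′ ⊎ y ≡ _) (wconj-applyW ws′ α α′) (values ws′) }) ,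
      λ { (inj₁ refl) → [] , refl ; (inj₂ refl) → ws , trans e (wconj-applyW ws α α′) }

  exchange-wconj : ∀ j b → exchange j b ≡ wconj (opposite (ε j) ∷ []) (negv (sr j)) b
  exchange-wconj j b = cong (λ x → τ A ε (opposite (ε j)) (x +v τ A ε (opposite (ε j)) b))
    (sym (τ-neg-sr-off (λ q → opposite-≢ (ε j) (sym q))))

  wconj-two-values : ∀ j b → AP b → ∀ ws → wconj ws (negv (sr j)) b ≡ negv (sr j) +v b ⊎ wconj ws (negv (sr j)) b ≡ exchange j b
  wconj-two-values j b ap ws = go (wconj-alternating ws)
    where
    go : (∃ λ s → ∃ λ m → ∀ a b → wconj ws a b ≡ conj s m a b) → _
    go (s , m , p) = subst (λ x → x ≡ negv (sr j) +v b ⊎ x ≡ exchange j b) (sym (p (negv (sr j)) b)) (conj-two-values j b ap s m)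

  ExactlyTwo-neg-sr : ∀ j b → AP b → negv (sr j) +v b ≢ exchange j b → ExactlyTwo A ε (negv (sr j)) b (exchange j b)
  ExactlyTwo-neg-sr j b ap p = exactly-two p refl (wconj-two-values j b ap) (opposite (ε j) ∷ [] , exchange-wconj j b)

  -- Transport carries the two values for -α_j and `b` to the two values for the transported pair,
  -- but it need not carry the plain sum to the plain sum. Which of the two is α + α′ is decided by
  -- evaluating the empty word.
  ExactlyTwo-back : ∀ s m j b → AP b → negv (sr j) +v b ≢ exchange j b →
    ∃ λ γ → ExactlyTwo A ε (back A ε s m (negv (sr j))) (back A ε s m b) γ
  ExactlyTwo-back s m j b ap e≢f = choose (values [])
    where
    a α α′ e f : Lat n
    a = negv (sr j)
    α = back A ε s m a
    α′ = back A ε s m b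
    e = back A ε s m (a +v b)
    f = back A ε s m (exchange j b)
    e≢f′ : e ≢ f
    e≢f′ r = e≢f (trans (sym (run-back s m (a +v b))) (trans (cong (run A ε s m) r) (run-back s m (exchange j b))))
    values : ∀ ws → wconj ws α α′ ≡ e ⊎ wconj ws α α′ ≡ f
    values ws = go (wconj-back s m ws a b)
      where
      go : (∃ λ ws′ → wconj ws α α′ ≡ back A ε s m (wconj ws′ a b)) → wconj ws α α′ ≡ e ⊎ wconj ws α α′ ≡ f
      go (ws′ , p) = [ (λ r → inj₁ (trans p (cong (back A ε s m) r))) , (λ r → inj₂ (trans p (cong (back A ε s m) r))) ]′
        (wconj-two-values j b ap ws′)
    choose : α +v α′ ≡ e ⊎ α +v α′ ≡ f → ∃ λ γ → ExactlyTwo A ε α α′ γ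
    choose (inj₁ p) = f , exactly-two e≢f′ p values (go (back-wconj s m (opposite (ε j) ∷ []) a b))
      where
      go : (∃ λ ws′ → back A ε s m (wconj (opposite (ε j) ∷ []) a b) ≡ wconj ws′ α α′) → ∃ λ ws → f ≡ wconj ws α α′
      go (ws′ , q) = ws′ , trans (cong (back A ε s m) (exchange-wconj j b)) q
    choose (inj₂ p) = e , exactly-two (λ r → e≢f′ (sym r)) p (λ ws → [ inj₂ , inj₁ ]′ (values ws)) (back-wconj s m [] a b)

  -- The two applications of `τ` of colour opposite to `j` would cancel but for the vector -α_j
  -- added between them. As b_j = 1, this addition lowers the positive part at `j` by exactly 1, and
  -- the missing contribution at each neighbour is a_ij.
  exchange-formula : ∀ j b → b ! j ≡ 1ℤ → exchange j b ≡ (b +v negv (sr j)) +v nbrSum A j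
  exchange-formula j b bj = lat-ext go
    where
    s₀ : Sign
    s₀ = opposite (ε j)
    a u : Lat n
    a = negv (sr j)
    u = a +v τ A ε s₀ b
    nbr-at : ∀ l → nbrSum A j ! l ≡ off A l j
    nbr-at l = trans (VecP.lookup∘tabulate _ l) swap
      where
      swap : (if ⌊ l Fin.≟ j ⌋ then 0ℤ else A l j) ≡ off A l j
      swap with l Fin.≟ j | j Fin.≟ l
      ... | yes _ | yes _ = refl
      ... | no _ | no _ = refl
      ... | yes p | no q = ⊥-elim (q (sym p))
      ... | no p | yes q = ⊥-elim (p (sym q))
    rhs : ∀ l → ((b +v a) +v nbrSum A j) ! l ≡ (b ! l + a ! l) + off A l j
    rhs l = trans (!-+ (b +v a) (nbrSum A j) l) (cong₂ _+_ (!-+ b a l) (nbr-at l))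
    -- The hypothesis b_j = 1 is what makes this exact: at `j` the intermediate vector `u` has
    -- coordinate 0.
    split : ∀ m → ε m ≢ s₀ → b ! m ⊔ 0ℤ ≡ sr j ! m + (u ! m ⊔ 0ℤ)
    split m p = trans (by-cases (≡-or-≢ m j)) (cong (λ x → sr j ! m + (x ⊔ 0ℤ))
        (sym (trans (!-+ a (τ A ε s₀ b) m) (cong (_+_ (a ! m)) (τ-off A ε b p)))))
      where
      by-cases : m ≡ j ⊎ m ≢ j → b ! m ⊔ 0ℤ ≡ sr j ! m + ((a ! m + b ! m) ⊔ 0ℤ)
      by-cases (inj₁ refl) = trans (cong (_⊔ 0ℤ) bj) (sym (cong₂ (λ x y → x + (y ⊔ 0ℤ)) (sr-same j) (cong₂ _+_ (neg-sr-same j) bj)))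
      by-cases (inj₂ q) = sym (trans (cong₂ (λ x y → x + ((y + b ! m) ⊔ 0ℤ)) (sr-diff q) (neg-sr-diff q))
        (trans (ℤP.+-identityˡ ((0ℤ + b ! m) ⊔ 0ℤ)) (cong (_⊔ 0ℤ) (ℤP.+-identityˡ (b ! m)))))
    go : ∀ l → exchange j b ! l ≡ ((b +v a) +v nbrSum A j) ! l
    go l = by-cases (ε l SignP.≟ s₀)
      where
      pos-sum u-sum : ℤ
      pos-sum = ∑ (λ m → off A l m * (b ! m ⊔ 0ℤ))
      u-sum = ∑ (λ m → off A l m * (u ! m ⊔ 0ℤ))
      by-cases : Dec (ε l ≡ s₀) → exchange j b ! l ≡ ((b +v a) +v nbrSum A j) ! l
      by-cases (yes p) = trans (τ-on A ε u p) (trans (cong (λ x → - x - u-sum)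
          (trans (!-+ a (τ A ε s₀ b) l) (cong₂ _+_ a-l (τ-on A ε b p))))
          (trans (cong (λ x → - (0ℤ + (- (b ! l) - x)) - u-sum) sums)
            (trans (lem (b ! l) (off A l j) u-sum) (sym (trans (rhs l) (cong (λ x → b ! l + x + off A l j) a-l))))))
        where
        a-l : a ! l ≡ 0ℤ
        a-l = neg-sr-diff {i = j} {l} (λ { refl → opposite-≢ (ε j) (sym p) })
        sums : pos-sum ≡ off A l j + u-sum
        sums = trans (off-sum-cong p split) (trans (∑-cong (λ m → ℤP.*-distribˡ-+ (off A l m) (sr j ! m) (u ! m ⊔ 0ℤ)))
          (trans (∑-+ (λ m → off A l m * sr j ! m) (λ m → off A l m * (u ! m ⊔ 0ℤ))) (cong (_+ u-sum) (∑-sr j (off A l)))))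
        lem : ∀ x o y → - (0ℤ + (- x - (o + y))) - y ≡ x + 0ℤ + o
        lem = solve-∀
      by-cases (no p) = trans (τ-off A ε u p) (trans (!-+ a (τ A ε s₀ b) l) (trans (cong (_+_ (a ! l)) (τ-off A ε b p))
        (sym (trans (rhs l) (trans (cong (_+_ (b ! l + a ! l)) (off-colour l j (trans (≢⇒opposite p) (opposite² (ε j)))))
          (lem (b ! l) (a ! l)))))))
        where
        lem : ∀ x y → x + y + 0ℤ ≡ y + x
        lem = solve-∀

  -- By the formula the two values differ by `nbrSum A j`, which is nonzero at any neighbour of `j`.
  exchange-≢ : ∀ j b → b ! j ≡ 1ℤ → (∃ λ i → off A i j ≢ 0ℤ) → negv (sr j) +v b ≢ exchange j b
  exchange-≢ j b bj (i , oij) e = oij (cancel (b ! i) (negv (sr j) ! i) (off A i j) (begin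
      negv (sr j) ! i + b ! i ≡⟨ !-+ (negv (sr j)) b i ⟨
      (negv (sr j) +v b) ! i ≡⟨ cong (_! i) (trans e (exchange-formula j b bj)) ⟩
      ((b +v negv (sr j)) +v nbrSum A j) ! i ≡⟨ trans (!-+ (b +v negv (sr j)) (nbrSum A j) i) (cong₂ _+_ (!-+ b (negv (sr j)) i) nbr-at) ⟩
      (b ! i + negv (sr j) ! i) + off A i j ∎))
    where
    open ≡-Reasoning
    i≢j : i ≢ j
    i≢j refl = oij (off-diag A i)
    nbr-at : nbrSum A j ! i ≡ off A i j
    nbr-at = trans (VecP.lookup∘tabulate _ i) (trans lem (sym (off-≢ A i≢j)))
      where
      lem : (if ⌊ i Fin.≟ j ⌋ then 0ℤ else A i j) ≡ A i j
      lem with i Fin.≟ j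
      ... | yes p = ⊥-elim (i≢j p)
      ... | no _ = refl
    cancel : ∀ x y o → y + x ≡ x + y + o → o ≡ 0ℤ
    cancel x y o p = trans (lem x y o) (trans (cong (_- (y + x)) (sym p)) (ℤP.+-inverseʳ (y + x)))
      where
      lem : ∀ x y o → o ≡ (x + y + o) - (y + x)
      lem = solve-∀

-- Without neighbours of `j` the indicator of `j` would be constant along edges, hence constant by
-- irreducibility, which is impossible once there is a second vertex.
has-neighbour : ∀ {n} (A : Matrix n) → 2 ℕ.≤ n → Irreducible A → (∀ i j → off A i j ≡ 0ℤ → off A j i ≡ 0ℤ) →
  ∀ j → ∃ λ i → off A i j ≢ 0ℤ
has-neighbour {n} A 2≤n irr off-zero-sym j = by-cases (FinP.any? (λ i → nonzero? (off A i j)))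
  where
  nonzero? : ∀ x → Dec (x ≢ 0ℤ)
  nonzero? x with x ℤ.≟ 0ℤ
  ... | yes p = no (λ q → q p)
  ... | no p = yes p
  other : ∀ {n} → 2 ℕ.≤ n → (j : Fin n) → ∃ λ i → i ≢ j
  other (s≤s (s≤s _)) zero = suc zero , λ ()
  other (s≤s (s≤s _)) (suc _) = zero , λ ()
  by-cases : Dec (∃ λ i → off A i j ≢ 0ℤ) → ∃ λ i → off A i j ≢ 0ℤ
  by-cases (yes p) = p
  by-cases (no isolated) = ⊥-elim (proj₂ (other 2≤n j) (same (irr mark mark-const (proj₁ (other 2≤n j)) j)))
    where
    mark : Fin n → Bool
    mark i = ⌊ i Fin.≟ j ⌋
    column : ∀ i → off A i j ≡ 0ℤ
    column i with off A i j ℤ.≟ 0ℤ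
    ... | yes p = p
    ... | no p = ⊥-elim (isolated (i , p))
    mark-const : ∀ i k → A i k ≢ 0ℤ → mark i ≡ mark k
    mark-const i k p with ≡-or-≢ i k
    ... | inj₁ refl = refl
    ... | inj₂ i≢k with i Fin.≟ j | k Fin.≟ j
    ...   | yes _ | yes _ = refl
    ...   | no _ | no _ = refl
    ...   | yes refl | no _ = ⊥-elim (p (trans (sym (off-≢ A i≢k)) (off-zero-sym k i (column k))))
    ...   | no _ | yes refl = ⊥-elim (p (trans (sym (off-≢ A i≢k)) (column i)))
    same : ∀ {i} → mark i ≡ mark j → i ≡ j
    same {i} e with i Fin.≟ j | j Fin.≟ j
    ... | yes p | _ = p
    ... | no _ | no q = ⊥-elim (q refl)

positive-part-one : ∀ x → ∣ x ⊔ 0ℤ ∣ ≡ 1 → x ≡ 1ℤ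
positive-part-one (+ zero) ()
positive-part-one (+ suc zero) _ = refl
positive-part-one (+ suc (suc m)) ()
positive-part-one -[1+ m ] ()

theorem1p14 : (n : ℕ) → 2 ℕ.≤ n → (A : Matrix n) → FiniteCartan A → Irreducible A →
    (ε : Fin n → Sign) → Bipartition A ε →
    (c : Lat n → Lat n → ℕ) → IsCompatDegree A ε c →
    ((α α' : Lat n) → AlmostPos A α → AlmostPos A α' → c α α' ≡ 1 → c α' α ≡ 1 →
    Σ (Lat n) (λ γ → ExactlyTwo A ε α α' γ))
    ×
    ((j : Fin n) (α : Lat n) → AlmostPos A α →
    c (negv (sr j)) α ≡ 1 → c α (negv (sr j)) ≡ 1 →
    ExactlyTwo A ε (negv (sr j)) α
    (τ A ε (opposite (ε j)) (negv (sr j) +v τ A ε (opposite (ε j)) α))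
    ×
    (τ A ε (opposite (ε j)) (negv (sr j) +v τ A ε (opposite (ε j)) α)
    ≡ (α +v negv (sr j)) +v nbrSum A j))
theorem1p14 (suc n) 2≤n A (A-diag , A-off , A-zero , d , d-pos , A-sym , A-posdef) irr ε bip c deg =
  with-returns (Return.uniform-return S irr zero)
  where
  open FromCartan A ε bip A-diag A-off d d-pos A-sym A-posdef renaming (system to S)
  open AlmostPositive S
  open Roots S A-diag
  off-zero-sym : ∀ i j → off A i j ≡ 0ℤ → off A j i ≡ 0ℤ
  off-zero-sym i j p with ≡-or-≢ i j
  ... | inj₁ refl = p
  ... | inj₂ q = trans (off-≢ A (λ r → q (sym r))) (A-zero i j (trans (sym (off-≢ A q)) p))
  with-returns : (∃ λ k → ∀ i → Return.Returns S i k) → _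
  with-returns (k , returns) = general , special
    where
    open Orbits S A-diag c deg k returns
    coordinate : ∀ j b → AlmostPos A b → c (negv (sr j)) b ≡ 1 → b ! j ≡ 1ℤ
    coordinate j b ap e = positive-part-one (b ! j) (trans (sym (proj₁ deg j b ap)) e)
    distinct : ∀ j b → b ! j ≡ 1ℤ → negv (sr j) +v b ≢ exchange j b
    distinct j b e = exchange-≢ j b e (has-neighbour A 2≤n irr off-zero-sym j)
    special : ∀ j α → AlmostPos A α → c (negv (sr j)) α ≡ 1 → c α (negv (sr j)) ≡ 1 →
      ExactlyTwo A ε (negv (sr j)) α (exchange j α) × exchange j α ≡ (α +v negv (sr j)) +v nbrSum A j
    special j α ap e _ = ExactlyTwo-neg-sr j α (AlmostPos⇒AP ap) (distinct j α αj) , exchange-formula j α αj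
      where
      αj : α ! j ≡ 1ℤ
      αj = coordinate j α ap e
    general : ∀ α α′ → AlmostPos A α → AlmostPos A α′ → c α α′ ≡ 1 → c α′ α ≡ 1 → Σ (Lat (suc n)) (ExactlyTwo A ε α α′)
    general α α′ ap ap′ e _ = transport (orbit-meets-neg-simples Sign.+ (AlmostPos⇒AP ap))
      where
      transport : (∃ λ m → ∃ λ j → run A ε Sign.+ m α ≡ negv (sr j)) → Σ (Lat (suc n)) (ExactlyTwo A ε α α′)
      transport (m , j , q) = subst₂ (λ x y → Σ (Lat (suc n)) (ExactlyTwo A ε x y))
        (trans (cong (back A ε Sign.+ m) (sym q)) (back-run Sign.+ m α)) (back-run Sign.+ m α′)
        (ExactlyTwo-back Sign.+ m j β (AlmostPos⇒AP aβ) (distinct j β (coordinate j β aβ degree)))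
        where
        β : Lat (suc n)
        β = run A ε Sign.+ m α′
        aβ : AlmostPos A β
        aβ = AlmostPos-run Sign.+ m ap′
        degree : c (negv (sr j)) β ≡ 1
        degree = trans (cong (λ x → c x β) (sym q)) (trans (degree-run Sign.+ m ap ap′) e)
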